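{- For every $n$ there exist a relation $f_0\subseteq\{0,1\}^n\times\{0,1\}^n$ and a partial Boolean function $g_0\subseteq\{0,1\}^n\times\{0,1\}$ such that \[\mathrm{R}_{4/9}(f_0)\in\Theta(\sqrt n),\qquad \mathrm{R}_{1/3}(g_0)\in\Theta(n),\qquad \mathrm{R}_{1/3}(f_0\circ g_0^n)\in\Theta(n).\]
   Context: Partial Boolean function: $g\subseteq\{0,1\}^m\times\{0,1\}$; $g^{ -1}(b)$ is the set of $x$ with $(x,b)\in g$, $(x,1-b)\notin g$; non-valid inputs (outside $g^{ -1}(0)\cup g^{ -1}(1)$) are related to both $0$ and $1$; $g(x)$ is the unique $b$ for valid $x$. Composition: $((x_1,\dots,x_n),s)\in f\circ g^n$ iff some $x_i$ is not valid, or all are valid and $((g(x_1),\dots,g(x_n)),s)\in f$. $\mathrm{R}_\epsilon(h)$ for a relation $h\subseteq\{0,1\}^k\times S$ is the minimum worst-case number of queries of a randomized query algorithm $\mathcal A$ with $\Pr[(x,\mathcal A(x))\in h]\ge1-\epsilon$ for every input $x$. Asymptotic notation is as $n\to\infty$.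
   Formalization: Randomized query algorithms are finite distributions over decision trees with rational probabilities instead of arbitrary real ones; the values of R are the same, since a rational linear system that is feasible over the reals has a rational solution. -}

module Defs where

open import Data.Nat using (ℕ; zero; suc; _≤_)
open import Data.Fin using (Fin; zero; suc)
open import Data.Bool using (Bool; true; false; if_then_else_)
open import Data.Maybe using (Maybe; just; nothing)
open import Data.Product using (Σ; _×_; _,_; proj₁; proj₂)
open import Data.List using (List; []; _∷_)
open import Data.List.Relation.Unary.All using (All)
open import Data.Integer using (+_)
open import Data.Rational using (ℚ; 0ℚ; 1ℚ; _+_; _-_; _/_)
import Data.Rational as Q
open import Relation.Binary.PropositionalEquality using (_≡_)

-- Inputs are Boolean strings indexed by a (finite) index type I, i.e. x : I → Bool.
-- {0,1}^k is  Fin k → Bool.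

Rel : Set → Set → Set
Rel I S = (I → Bool) → S → Bool

-- A partial Boolean function on {0,1}^m: nothing = non-valid input.
PartialFn : ℕ → Set
PartialFn m = (Fin m → Bool) → Maybe Bool

-- The relation associated with a partial Boolean function:
-- valid x related only to g(x); non-valid x related to both 0 and 1.
asRel : ∀ {m} → PartialFn m → Rel (Fin m) Bool
asRel g x b with g x
... | just c  = Data.Bool._∧_ (Data.Bool._∨_ (Data.Bool.not c) b) (Data.Bool._∨_ c (Data.Bool.not b))
... | nothing = true

allJust : ∀ n → (Fin n → Maybe Bool) → Maybe (Fin n → Bool)
allJust zero    v = just (λ ())
allJust (suc n) v with v zero | allJust n (λ i → v (suc i))
... | just b  | just w = just λ { zero → b ; (suc i) → w i }
... | _       | _      = nothing

compose : ∀ {n m} {S : Set} → Rel (Fin n) S → PartialFn m → Rel (Fin n × Fin m) S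
compose {n} f g x s with allJust n (λ i → g (λ j → x (i , j)))
... | just y  = f y s
... | nothing = true

data DT (I S : Set) : Set where
  leaf  : S → DT I S
  query : I → DT I S → DT I S → DT I S   -- query x i; left branch if 0, right if 1

run : ∀ {I S} → DT I S → (I → Bool) → S
run (leaf s) x = s
run (query i t₀ t₁) x = if x i then run t₁ x else run t₀ x

cost : ∀ {I S} → DT I S → (I → Bool) → ℕ
cost (leaf s) x = 0
cost (query i t₀ t₁) x = suc (if x i then cost t₁ x else cost t₀ x)

-- Randomized query algorithm: finite probability distribution (rational weights)
-- over deterministic decision trees.
RAlg : Set → Set → Set
RAlg I S = List (ℚ × DT I S)

totalWeight : ∀ {I S} → RAlg I S → ℚ
totalWeight [] = 0ℚ
totalWeight ((p , _) ∷ A) = p + totalWeight A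

successProb : ∀ {I S} → RAlg I S → Rel I S → (I → Bool) → ℚ
successProb [] h x = 0ℚ
successProb ((p , t) ∷ A) h x =
  (if h x (run t x) then p else 0ℚ) + successProb A h x

record IsRAlg {I S : Set} (A : RAlg I S) : Set where
  field
    nonneg : All (λ pt → 0ℚ Q.≤ proj₁ pt) A
    sums1  : totalWeight A ≡ 1ℚ

CostAtMost : ∀ {I S} → RAlg I S → ℕ → Set
CostAtMost A q = All (λ pt → ∀ x → cost (proj₂ pt) x ≤ q) A

ComputesWithError : ∀ {I S} → ℚ → Rel I S → RAlg I S → Set
ComputesWithError ε h A = ∀ x → (1ℚ - ε) Q.≤ successProb A h x

R≤ : ∀ {I S} → ℚ → Rel I S → ℕ → Set
R≤ {I} {S} ε h q = Σ (RAlg I S) λ A → IsRAlg A × ComputesWithError ε h A × CostAtMost A q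

R≥ : ∀ {I S} → ℚ → Rel I S → ℕ → Set
R≥ {I} {S} ε h q = ∀ (A : RAlg I S) k → IsRAlg A → ComputesWithError ε h A → CostAtMost A k → q ≤ k

4/9 : ℚ
4/9 = + 4 / 9

1/3 : ℚ
1/3 = + 1 / 3

{-# OPTIONS --safe #-}
module Submission where

-- Let u = ⌊√n / 256⌋. The relation f₀ accepts s when s agrees with x on at least n/2 + 512u positions, and
-- g₀ is the majority of m = 32u² bits under the promise that the ±1 sum is at least u in absolute value.
--
-- Upper bounds. Reading 2048u bits and guessing the others solves f₀. For f₀ ∘ g₀ⁿ, one random bit of each
-- block is correct with probability at least 1/2 + u/2m = 1/2 + 1/64u, so the n answers have expected surplus
-- at least n/32u, a large multiple of √n, and Chebyshev applies.
--
-- Lower bounds. No value of an r-step ±1 walk has probability above 1/√r. Hence, for a uniform block, a set of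
-- q known bits with sum s biases the sign of the total by O(|s|/u), and at most half of the
-- completions violate the promise. Since E[s²] is at most the number of queries, u²/16 queries leave the sign almost
-- unbiased, which bounds g₀. Since |s| ≤ q, every leaf of a tree for f₀ ∘ g₀ⁿ with Q queries has total bias at
-- most Q/u, and the second moment of the agreement, at most n + (Q/u)², is too small when Q < 256u². The bound
-- for f₀ is the case of one-bit blocks.

open import Defs

-- No tail bound beyond Chebyshev is used, because constant margins suffice. The lower bounds cap
-- success at 1/2 for `f₀` and the composition and at 5/8 for `g₀`, while 5/9 and 2/3 are demanded;
-- all of this is counted in integers. The hard inputs must obey the promise in every block and
-- still be a product after the answers are fixed. The promise concerns each block alone, so blocks
-- stay independent at a leaf. Biases of at most `q / u` then add up to at most `Q / u` however the
-- queries are spread, and no accounting per block is required. For `g₀` alone this linear bound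
-- would yield only order `u` queries, which forces the quadratic potential. Constants: `16u²` free
-- bits put mass at most `1/(4u)` on each value, so the promise gap loses at most half; `m = 32u²`
-- keeps that many free after `16u²` queries. For a threshold `t·u`, the upper bound on the
-- composition wants `2m·t·u ≤ n·u`, that is `64t·u² ≤ n`, and the lower bounds want `4n ≤ t²u²`.
-- Rounding the root costs a factor 4, `n ≤ 256t·u²`, so `t = 1024` suffices, and
-- `64t = 65536 = 256²`.

-- Anticoncentration of the simple ±1 walk.

module Walk where

  open import Data.Nat using (ℕ; zero; suc; z≤n)
  import Data.Nat as ℕ
  import Data.Nat.Properties as ℕₚ
  open import Data.Integer hiding (suc)
  open import Data.Integer.Properties
  open import Algebra.Properties.CommutativeSemigroup +-commutativeSemigroup using (interchange)
  open import Data.Integer.Tactic.RingSolver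
  import Data.Nat.Tactic.RingSolver as ℕR
  open import Data.Sum using (_⊎_; inj₁; inj₂)
  open import Data.Product using (_,_)
  open import Relation.Binary.PropositionalEquality

  -- This is `2 ^ r` times the expectation of `φ` at the end of an `r`-step uniform ±1 walk from
  -- `s`, left unnormalised to stay in ℤ.
  walk : ℕ → (ℤ → ℤ) → ℤ → ℤ
  walk zero    φ s = φ s
  walk (suc r) φ s = walk r φ (s + 1ℤ) + walk r φ (s - 1ℤ)

  walk-cong : ∀ r {φ ψ : ℤ → ℤ} → (∀ s → φ s ≡ ψ s) → ∀ s → walk r φ s ≡ walk r ψ s
  walk-cong zero    eq s = eq s
  walk-cong (suc r) eq s = cong₂ _+_ (walk-cong r eq _) (walk-cong r eq _)

  walk-mono : ∀ r {φ ψ : ℤ → ℤ} → (∀ s → φ s ≤ ψ s) → ∀ s → walk r φ s ≤ walk r ψ s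
  walk-mono zero    le s = le s
  walk-mono (suc r) le s = +-mono-≤ (walk-mono r le _) (walk-mono r le _)

  walk-+ : ∀ r φ ψ s → walk r (λ z → φ z + ψ z) s ≡ walk r φ s + walk r ψ s
  walk-+ zero    φ ψ s = refl
  walk-+ (suc r) φ ψ s = trans (cong₂ _+_ (walk-+ r φ ψ _) (walk-+ r φ ψ _))
    (interchange (walk r φ (s + 1ℤ)) (walk r ψ (s + 1ℤ)) (walk r φ (s - 1ℤ)) (walk r ψ (s - 1ℤ)))

  walk-neg : ∀ r φ s → walk r (λ z → - φ z) s ≡ - walk r φ s
  walk-neg zero    φ s = refl
  walk-neg (suc r) φ s = trans (cong₂ _+_ (walk-neg r φ _) (walk-neg r φ _))
    (sym (neg-distrib-+ (walk r φ (s + 1ℤ)) (walk r φ (s - 1ℤ))))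

  walk-shift : ∀ r φ a s → walk r (λ z → φ (z + a)) s ≡ walk r φ (s + a)
  walk-shift zero    φ a s = refl
  walk-shift (suc r) φ a s = cong₂ _+_
    (trans (walk-shift r φ a (s + 1ℤ)) (cong (walk r φ) (swapʳ s 1ℤ a)))
    (trans (walk-shift r φ a (s - 1ℤ)) (cong (walk r φ) (swapʳ s (- 1ℤ) a)))
    where
    swapʳ : ∀ s e a → s + e + a ≡ s + a + e
    swapʳ = solve-∀

  walk-reflect : ∀ r φ s → walk r (λ z → φ (- z)) s ≡ walk r φ (- s)
  walk-reflect zero    φ s = refl
  walk-reflect (suc r) φ s = trans (cong₂ _+_
    (trans (walk-reflect r φ (s + 1ℤ)) (cong (walk r φ) (neg-distrib-+ s 1ℤ)))
    (trans (walk-reflect r φ (s - 1ℤ)) (cong (walk r φ) (neg-distrib-+ s (- 1ℤ)))))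
    (+-comm (walk r φ (- s - 1ℤ)) (walk r φ (- s + 1ℤ)))

  walk-1 : ∀ r s → walk r (λ _ → 1ℤ) s ≡ + (2 ℕ.^ r)
  walk-1 zero    s = refl
  walk-1 (suc r) s = trans (cong₂ _+_ (walk-1 r _) (walk-1 r _))
    (cong (λ z → + (2 ℕ.^ r ℕ.+ z)) (sym (ℕₚ.+-identityʳ _)))

  δ₀ : ℤ → ℤ
  δ₀ (+ zero)  = 1ℤ
  δ₀ +[1+ _ ]  = 0ℤ
  δ₀ -[1+ _ ]  = 0ℤ

  -- A binomial coefficient: `r` choose `(r + v)/2` at the starting point `v` when the parities
  -- match and the absolute value of `v` is at most `r`, and zero otherwise.
  hits : ℕ → ℤ → ℤ
  hits r = walk r δ₀

  δ₀-even : ∀ s → δ₀ (- s) ≡ δ₀ s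
  δ₀-even (+ zero) = refl
  δ₀-even +[1+ _ ] = refl
  δ₀-even -[1+ _ ] = refl

  δ₀≥0 : ∀ s → 0ℤ ≤ δ₀ s
  δ₀≥0 (+ zero) = +≤+ z≤n
  δ₀≥0 +[1+ _ ] = +≤+ z≤n
  δ₀≥0 -[1+ _ ] = +≤+ z≤n

  walk-0 : ∀ r s → walk r (λ _ → 0ℤ) s ≡ 0ℤ
  walk-0 zero    s = refl
  walk-0 (suc r) s = cong₂ _+_ (walk-0 r _) (walk-0 r _)

  hits≥0 : ∀ r s → 0ℤ ≤ hits r s
  hits≥0 r s = subst (_≤ hits r s) (walk-0 r s) (walk-mono r δ₀≥0 s)

  hits-even : ∀ r s → hits r (- s) ≡ hits r s
  hits-even r s = trans (sym (walk-reflect r δ₀ s)) (walk-cong r δ₀-even s)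

  -- The binomial recurrence (k + 1) C(r, k + 1) = (r − k) C(r, k), in the coordinate v = 2k − r.
  hits-ratio : ∀ r v → (+ r + v + + 2) * hits r (v + + 2) ≡ (+ r - v) * hits r v
  hits-ratio zero v = base v
    where
    base : ∀ v → (0ℤ + v + + 2) * δ₀ (v + + 2) ≡ (0ℤ - v) * δ₀ v
    base (+ zero) = refl
    base (+[1+ n ]) rewrite ℕₚ.+-comm n 2 = trans (*-zeroʳ +[1+ suc (suc n) ]) (sym (*-zeroʳ (0ℤ - +[1+ n ])))
    base -[1+ 0 ] = refl
    base -[1+ 1 ] = refl
    base -[1+ suc (suc n) ] = trans (*-zeroʳ -[1+ n ]) (sym (*-zeroʳ +[1+ suc (suc n) ]))
  hits-ratio (suc r) v = begin
    (+ suc r + v + + 2) * (hits r (v + + 2 + 1ℤ) + hits r (v + + 2 - 1ℤ))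
      ≡⟨ cong₂ (λ a b → (+ suc r + v + + 2) * (hits r a + hits r b)) (e₁ v) (e₂ v) ⟩
    (+ suc r + v + + 2) * (a + b)
      ≡⟨ cong (λ z → (z + v + + 2) * (a + b)) (suc-1+ r) ⟩
    (1ℤ + + r + v + + 2) * (a + b)
      ≡⟨ e₃ (+ r) v a b ⟩
    (+ r + (v + 1ℤ) + + 2) * a + (+ r + v + + 3) * b
      ≡⟨ cong (_+ (+ r + v + + 3) * b) (hits-ratio r (v + 1ℤ)) ⟩
    (+ r - (v + 1ℤ)) * b + (+ r + v + + 3) * b
      ≡⟨ e₄ (+ r) v b ⟩
    (+ r - v + 1ℤ) * b + (+ r + (v - 1ℤ) + + 2) * b
      ≡⟨ cong (λ z → (+ r - v + 1ℤ) * b + z) (cong (λ z → (+ r + (v - 1ℤ) + + 2) * hits r z) (e₅ v)) ⟩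
    (+ r - v + 1ℤ) * b + (+ r + (v - 1ℤ) + + 2) * hits r (v - 1ℤ + + 2)
      ≡⟨ cong (λ z → (+ r - v + 1ℤ) * b + z) (hits-ratio r (v - 1ℤ)) ⟩
    (+ r - v + 1ℤ) * b + (+ r - (v - 1ℤ)) * hits r (v - 1ℤ)
      ≡⟨ e₆ (+ r) v b (hits r (v - 1ℤ)) ⟩
    (1ℤ + + r - v) * (b + hits r (v - 1ℤ))
      ≡⟨ cong (λ z → (z - v) * (b + hits r (v - 1ℤ))) (sym (suc-1+ r)) ⟩
    (+ suc r - v) * (b + hits r (v - 1ℤ)) ∎
    where
    open ≡-Reasoning
    a = hits r (v + 1ℤ + + 2)
    b = hits r (v + 1ℤ)
    suc-1+ : ∀ r → + suc r ≡ 1ℤ + + r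
    suc-1+ r = refl
    e₁ : ∀ v → v + + 2 + 1ℤ ≡ v + 1ℤ + + 2
    e₁ = solve-∀
    e₂ : ∀ v → v + + 2 - 1ℤ ≡ v + 1ℤ
    e₂ = solve-∀
    e₃ : ∀ r v a b → (1ℤ + r + v + + 2) * (a + b) ≡ (r + (v + 1ℤ) + + 2) * a + (r + v + + 3) * b
    e₃ = solve-∀
    e₄ : ∀ r v b → (r - (v + 1ℤ)) * b + (r + v + + 3) * b ≡ (r - v + 1ℤ) * b + (r + (v - 1ℤ) + + 2) * b
    e₄ = solve-∀
    e₅ : ∀ v → v + 1ℤ ≡ v - 1ℤ + + 2
    e₅ = solve-∀
    e₆ : ∀ r v b c → (r - v + 1ℤ) * b + (r - (v - 1ℤ)) * c ≡ (1ℤ + r - v) * (b + c)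
    e₆ = solve-∀

  -- Unimodality within a parity class. By Pascal's rule both sides share the term
  -- `hits r (+ suc k)`, and two uses of the induction hypothesis compare the rest. The offset makes
  -- the lowest case compare 1 with -1, where symmetry gives equality.
  hits-decreasing : ∀ r k → hits r (+ suc k) ≤ hits r (+ k - 1ℤ)
  hits-decreasing zero    zero    = ≤-refl
  hits-decreasing zero    (suc k) = δ₀≥0 (+ k)
  hits-decreasing (suc r) zero    = ≤-reflexive (trans (+-comm (hits r (+ 2)) (hits r 0ℤ)) (cong (λ z → hits r 0ℤ + z) (sym (hits-even r (+ 2)))))
  hits-decreasing (suc r) (suc k) = subst₂ _≤_ refl (cong (λ z → hits r z + hits r (+ k - 1ℤ)) (cong +_ (ℕₚ.+-comm 1 k)))
    (≤-trans (≤-reflexive (+-comm (hits r (+ (suc (suc k) ℕ.+ 1))) (hits r (+ suc k))))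
      (+-monoʳ-≤ (hits r (+ suc k)) (≤-trans (subst (λ z → hits r (+ z) ≤ hits r (+ suc k)) (ℕₚ.+-comm 1 (suc (suc k))) (hits-decreasing r (suc (suc k)))) (hits-decreasing r k))))

  hits-max : ∀ r n → hits r (+ n) ≤ hits r 0ℤ ⊎ hits r (+ n) ≤ hits r 1ℤ
  hits-max r zero = inj₁ ≤-refl
  hits-max r (suc zero) = inj₂ ≤-refl
  hits-max r (suc (suc n)) with hits-max r n
  ... | inj₁ le = inj₁ (≤-trans (hits-decreasing r (suc n)) le)
  ... | inj₂ le = inj₂ (≤-trans (hits-decreasing r (suc n)) le)

  *-mono-≤-nonNeg : ∀ {a b c d} → 0ℤ ≤ a → 0ℤ ≤ c → a ≤ b → c ≤ d → a * c ≤ b * d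
  *-mono-≤-nonNeg {a} {b} {c} {d} 0≤a 0≤c a≤b c≤d = ≤-trans
    (*-monoʳ-≤-nonNeg c {{nonNegative 0≤c}} a≤b)
    (*-monoˡ-≤-nonNeg b {{nonNegative (≤-trans 0≤a a≤b)}} c≤d)

  -- The two central coefficients alternate with the parity of `r`, hence the mutual induction.
  -- Symmetry makes a step from 1 to 0 an exact doubling. In the other direction `hits-ratio` at 0
  -- gives the factor `(2r + 2)/(r + 2)`, whose square is absorbed by the change from `1 + r` to
  -- `3 + r`.
  hits-0-bound : ∀ r → hits r 0ℤ * hits r 0ℤ * + (1 ℕ.+ r) ≤ + (4 ℕ.^ r)
  hits-1-bound : ∀ r → hits r 1ℤ * hits r 1ℤ * + (2 ℕ.+ r) ≤ + (4 ℕ.^ r)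

  hits-0-bound zero    = ≤-refl
  hits-0-bound (suc r) = begin
    (hits r 1ℤ + hits r -1ℤ) * (hits r 1ℤ + hits r -1ℤ) * + (2 ℕ.+ r)
      ≡⟨ cong (λ z → (hits r 1ℤ + z) * (hits r 1ℤ + z) * + (2 ℕ.+ r)) (hits-even r 1ℤ) ⟩
    (hits r 1ℤ + hits r 1ℤ) * (hits r 1ℤ + hits r 1ℤ) * + (2 ℕ.+ r)
      ≡⟨ e (hits r 1ℤ) (+ (2 ℕ.+ r)) ⟩
    + 4 * (hits r 1ℤ * hits r 1ℤ * + (2 ℕ.+ r))
      ≤⟨ *-monoˡ-≤-nonNeg (+ 4) (hits-1-bound r) ⟩
    + 4 * + (4 ℕ.^ r)
      ≡⟨ pos-* 4 (4 ℕ.^ r) ⟨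
    + (4 ℕ.^ suc r) ∎
    where
    open ≤-Reasoning
    e : ∀ c k → (c + c) * (c + c) * k ≡ + 4 * (c * c * k)
    e = solve-∀
  hits-1-bound zero    = +≤+ z≤n
  hits-1-bound (suc r) = *-cancelˡ-≤-pos _ _ ((+ 2 + + r) * (+ 2 + + r)) (begin
    k * k * (b * b * (+ 3 + + r))
      ≡⟨ e₁ (+ r) b ⟩
    (+ r + 0ℤ + + 2) * b * ((+ r + 0ℤ + + 2) * b) * (+ 3 + + r)
      ≡⟨ cong (λ z → z * z * (+ 3 + + r)) step ⟩
    (+ r + + r + + 2) * c * ((+ r + + r + + 2) * c) * (+ 3 + + r)
      ≡⟨ e₂ (+ r) c ⟩
    + 4 * ((1ℤ + + r) * (+ 3 + + r)) * (c * c * (1ℤ + + r))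
      -- The only loss in the recursion is `(r + 1)(r + 3) ≤ (r + 2)²`.
      ≤⟨ *-mono-≤-nonNeg (+≤+ z≤n) (≤-trans (≤-reflexive (sym (*-zeroˡ (1ℤ + + r)))) (*-monoʳ-≤-nonNeg (1ℤ + + r) (≤-trans (≤-reflexive (sym (*-zeroˡ c))) (*-monoʳ-≤-nonNeg c {{nonNegative (hits≥0 r 0ℤ)}} (hits≥0 r 0ℤ)))))
           (≤-trans (i≤i+j _ (+ 4)) (≤-reflexive (e₃ (+ r)))) (hits-0-bound r) ⟩
    + 4 * (k * k) * + (4 ℕ.^ r)
      ≡⟨ e₄ (k * k) (+ (4 ℕ.^ r)) ⟩
    k * k * (+ 4 * + (4 ℕ.^ r))
      ≡⟨ cong (λ z → k * k * z) (sym (pos-* 4 (4 ℕ.^ r))) ⟩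
    k * k * + (4 ℕ.^ suc r) ∎)
    where
    open ≤-Reasoning
    k = + 2 + + r
    a = hits r (+ 2)
    c = hits r 0ℤ
    b = a + c
    e₀ : ∀ r a c → (r + 0ℤ + + 2) * (a + c) ≡ (r + 0ℤ + + 2) * a + (r + + 2) * c
    e₀ = solve-∀
    e₀′ : ∀ r c → (r - 0ℤ) * c + (r + + 2) * c ≡ (r + r + + 2) * c
    e₀′ = solve-∀
    step : (+ r + 0ℤ + + 2) * b ≡ (+ r + + r + + 2) * c
    step = trans (e₀ (+ r) a c) (trans (cong (_+ (+ r + + 2) * c) (hits-ratio r 0ℤ)) (e₀′ (+ r) c))
    e₁ : ∀ r b → (+ 2 + r) * (+ 2 + r) * (b * b * (+ 3 + r)) ≡ (r + 0ℤ + + 2) * b * ((r + 0ℤ + + 2) * b) * (+ 3 + r)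
    e₁ = solve-∀
    e₂ : ∀ r c → (r + r + + 2) * c * ((r + r + + 2) * c) * (+ 3 + r) ≡ + 4 * ((1ℤ + r) * (+ 3 + r)) * (c * c * (1ℤ + r))
    e₂ = solve-∀
    e₃ : ∀ r → + 4 * ((1ℤ + r) * (+ 3 + r)) + + 4 ≡ + 4 * ((+ 2 + r) * (+ 2 + r))
    e₃ = solve-∀
    e₄ : ∀ a b → + 4 * a * b ≡ a * (+ 4 * b)
    e₄ = solve-∀

  sq≡ : ∀ i → i * i ≡ + (∣ i ∣ ℕ.* ∣ i ∣)
  sq≡ (+ n)    = sym (pos-* n n)
  sq≡ -[1+ n ] = refl

  sq≥0 : ∀ i → 0ℤ ≤ i * i
  sq≥0 i = subst (0ℤ ≤_) (sym (sq≡ i)) (+≤+ z≤n)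

  sq-cancel-≤ : ∀ {m n} → m ℕ.* m ℕ.≤ n ℕ.* n → m ℕ.≤ n
  sq-cancel-≤ le = ℕₚ.≮⇒≥ λ n<m → ℕₚ.<⇒≱ (ℕₚ.*-mono-< n<m n<m) le

  hits-bound : ∀ r v → hits r v * hits r v * + (1 ℕ.+ r) ≤ + (4 ℕ.^ r)
  hits-bound r (+ n) with hits-max r n
  ... | inj₁ le = ≤-trans (*-monoʳ-≤-nonNeg (+ (1 ℕ.+ r)) (*-mono-≤-nonNeg (hits≥0 r (+ n)) (hits≥0 r (+ n)) le le)) (hits-0-bound r)
  ... | inj₂ le = ≤-trans (*-mono-≤-nonNeg (sq≥0 (hits r (+ n))) (+≤+ z≤n) (*-mono-≤-nonNeg (hits≥0 r (+ n)) (hits≥0 r (+ n)) le le)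
      (+≤+ (ℕₚ.n≤1+n (1 ℕ.+ r)))) (hits-1-bound r)
  hits-bound r -[1+ n ] = subst (λ z → z * z * + (1 ℕ.+ r) ≤ + (4 ℕ.^ r)) (sym (hits-even r +[1+ n ])) (hits-bound r +[1+ n ])

  -- Each value has probability at most `1/(4u)`: the square root of `hits-bound` with `(4u)² ≤ r`,
  -- taken by comparing squares.
  hits-small : ∀ u r v → 16 ℕ.* (u ℕ.* u) ℕ.≤ r → + (4 ℕ.* u) * hits r v ≤ + (2 ℕ.^ r)
  hits-small u r v 16u²≤r = begin
    + (4 ℕ.* u) * hits r v   ≡⟨ cong (λ z → + (4 ℕ.* u) * z) (0≤i⇒+∣i∣≡i (hits≥0 r v)) ⟨
    + (4 ℕ.* u) * + c        ≡⟨ pos-* (4 ℕ.* u) c ⟨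
    + (4 ℕ.* u ℕ.* c)        ≤⟨ +≤+ (sq-cancel-≤ squares) ⟩
    + (2 ℕ.^ r)              ∎
    where
    open ≤-Reasoning
    c = ∣ hits r v ∣
    e₁ : ∀ u c → 4 ℕ.* u ℕ.* c ℕ.* (4 ℕ.* u ℕ.* c) ≡ c ℕ.* c ℕ.* (16 ℕ.* (u ℕ.* u))
    e₁ = ℕR.solve-∀
    bound : c ℕ.* c ℕ.* (1 ℕ.+ r) ℕ.≤ 4 ℕ.^ r
    bound = drop‿+≤+ (subst (_≤ + (4 ℕ.^ r))
      (trans (cong (_* + (1 ℕ.+ r)) (sq≡ (hits r v))) (sym (pos-* (c ℕ.* c) (1 ℕ.+ r)))) (hits-bound r v))
    4^r : ∀ r → 4 ℕ.^ r ≡ 2 ℕ.^ r ℕ.* 2 ℕ.^ r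
    4^r r = trans (ℕₚ.^-*-assoc 2 2 r)
      (trans (cong (λ z → 2 ℕ.^ (r ℕ.+ z)) (ℕₚ.+-identityʳ r)) (ℕₚ.^-distribˡ-+-* 2 r r))
    squares : 4 ℕ.* u ℕ.* c ℕ.* (4 ℕ.* u ℕ.* c) ℕ.≤ 2 ℕ.^ r ℕ.* 2 ℕ.^ r
    squares = subst₂ ℕ._≤_ (sym (e₁ u c)) (4^r r)
      (ℕₚ.≤-trans (ℕₚ.*-monoʳ-≤ (c ℕ.* c) (ℕₚ.≤-trans 16u²≤r (ℕₚ.n≤1+n r))) bound)

  unitStep : ℤ → ℤ
  unitStep (+ _)    = 1ℤ
  unitStep -[1+ _ ] = 0ℤ

  unitStep-suc : ∀ s → unitStep (s + 1ℤ) ≡ unitStep s + δ₀ (s + 1ℤ)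
  unitStep-suc (+ n) rewrite ℕₚ.+-comm n 1 = refl
  unitStep-suc -[1+ zero ]  = refl
  unitStep-suc -[1+ suc n ] = refl

  -- Counts the walks from `s` with a nonnegative endpoint, an unnormalised distribution function of
  -- `s`.
  upper : ℕ → ℤ → ℤ
  upper r = walk r unitStep

  -- The discrete derivative of the tail count is a point count; this is what turns
  -- anticoncentration into a Lipschitz bound.
  upper-suc : ∀ r s → upper r (s + 1ℤ) ≡ upper r s + hits r (s + 1ℤ)
  upper-suc r s = begin
    upper r (s + 1ℤ)                               ≡⟨ walk-shift r unitStep 1ℤ s ⟨
    walk r (λ z → unitStep (z + 1ℤ)) s                    ≡⟨ walk-cong r unitStep-suc s ⟩
    walk r (λ z → unitStep z + δ₀ (z + 1ℤ)) s             ≡⟨ walk-+ r unitStep (λ z → δ₀ (z + 1ℤ)) s ⟩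
    upper r s + walk r (λ z → δ₀ (z + 1ℤ)) s       ≡⟨ cong (λ z → upper r s + z) (walk-shift r δ₀ 1ℤ s) ⟩
    upper r s + hits r (s + 1ℤ)                    ∎
    where open ≡-Reasoning

  upper-mono : ∀ r s k → upper r s ≤ upper r (s + + k)
  upper-mono r s zero    = ≤-reflexive (cong (upper r) (sym (+-identityʳ s)))
  upper-mono r s (suc k) = begin
    upper r s                                  ≤⟨ upper-mono r s k ⟩
    upper r (s + + k)                          ≡⟨ +-identityʳ _ ⟨
    upper r (s + + k) + 0ℤ                     ≤⟨ +-monoʳ-≤ (upper r (s + + k)) (hits≥0 r (s + + k + 1ℤ)) ⟩
    upper r (s + + k) + hits r (s + + k + 1ℤ)  ≡⟨ upper-suc r (s + + k) ⟨
    upper r (s + + k + 1ℤ)                     ≡⟨ cong (upper r) (e s (+ k)) ⟩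
    upper r (s + + suc k)                      ∎
    where
    open ≤-Reasoning
    e : ∀ s k → s + k + 1ℤ ≡ s + (1ℤ + k)
    e = solve-∀

  upper-lipschitz : ∀ u r s k → 16 ℕ.* (u ℕ.* u) ℕ.≤ r →
    + (4 ℕ.* u) * (upper r (s + + k) - upper r s) ≤ + k * + (2 ℕ.^ r)
  upper-lipschitz u r s zero 16u²≤r = ≤-reflexive (begin
    + (4 ℕ.* u) * (upper r (s + 0ℤ) - upper r s)  ≡⟨ cong (λ z → + (4 ℕ.* u) * (upper r z - upper r s)) (+-identityʳ s) ⟩
    + (4 ℕ.* u) * (upper r s - upper r s)         ≡⟨ cong (+ (4 ℕ.* u) *_) (+-inverseʳ (upper r s)) ⟩
    + (4 ℕ.* u) * 0ℤ                              ≡⟨ *-zeroʳ (+ (4 ℕ.* u)) ⟩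
    0ℤ                                            ∎)
    where open ≡-Reasoning
  upper-lipschitz u r s (suc k) 16u²≤r = begin
    + (4 ℕ.* u) * (upper r (s + + suc k) - upper r s)
      ≡⟨ cong (λ z → + (4 ℕ.* u) * (z - upper r s)) (trans (cong (upper r) (e₁ s (+ k))) (upper-suc r (s + + k))) ⟩
    + (4 ℕ.* u) * (upper r (s + + k) + hits r (s + + k + 1ℤ) - upper r s)
      ≡⟨ e₂ (+ (4 ℕ.* u)) (upper r (s + + k)) (hits r (s + + k + 1ℤ)) (upper r s) ⟩
    + (4 ℕ.* u) * hits r (s + + k + 1ℤ) + + (4 ℕ.* u) * (upper r (s + + k) - upper r s)
      ≤⟨ +-mono-≤ (hits-small u r (s + + k + 1ℤ) 16u²≤r) (upper-lipschitz u r s k 16u²≤r) ⟩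
    + (2 ℕ.^ r) + + k * + (2 ℕ.^ r)
      ≡⟨ e₃ (+ k) (+ (2 ℕ.^ r)) ⟩
    + suc k * + (2 ℕ.^ r) ∎
    where
    open ≤-Reasoning
    e₁ : ∀ s k → s + (1ℤ + k) ≡ s + k + 1ℤ
    e₁ = solve-∀
    e₂ : ∀ a b c d → a * (b + c - d) ≡ a * c + a * (b - d)
    e₂ = solve-∀
    e₃ : ∀ k p → p + k * p ≡ (1ℤ + k) * p
    e₃ = solve-∀

-- The sign of a walk under the promise: its bias and the mass lost in the gap.

module Threshold where

  open import Data.Nat using (ℕ; zero; suc; z≤n)
  import Data.Nat as ℕ
  import Data.Nat.Properties as ℕₚ
  open import Data.Bool using (Bool; true; false; if_then_else_)
  open import Data.Maybe using (Maybe; just; nothing; maybe)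
  open import Data.Integer hiding (suc)
  open import Data.Integer.Properties
  open import Data.Integer.Tactic.RingSolver
  open import Relation.Nullary using (yes; no; does)
  open import Relation.Binary.PropositionalEquality
  open Walk

  σ : Bool → ℤ
  σ b = if b then 1ℤ else -1ℤ

  decide : ℕ → ℤ → Maybe Bool
  decide u s = if does (+ u ≤? s) then just true
               else if does (s ≤? - + u) then just false else nothing

  vote : ℕ → ℤ → ℤ
  vote u s = maybe σ 0ℤ (decide u s)

  decided : ℕ → ℤ → ℤ
  decided u s = maybe (λ _ → 1ℤ) 0ℤ (decide u s)

  unitStep-nonneg : ∀ {s} → 0ℤ ≤ s → unitStep s ≡ 1ℤ
  unitStep-nonneg (+≤+ _) = refl

  unitStep-neg : ∀ {s} → s < 0ℤ → unitStep s ≡ 0ℤ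
  unitStep-neg -<+ = refl

  -- Over the integers `s > - u` is `0 ≤ s + u - 1`, which is where the -1 comes from. Recording
  -- both step values beside the decision makes `vote` and `decided` affine combinations of two unit
  -- steps, hence their walks combinations of two tail counts.
  data Side (u : ℕ) (s : ℤ) : Set where
    high : decide u s ≡ just true  → unitStep (s - + u) ≡ 1ℤ → unitStep (s + + u - 1ℤ) ≡ 1ℤ → Side u s
    mid  : decide u s ≡ nothing    → unitStep (s - + u) ≡ 0ℤ → unitStep (s + + u - 1ℤ) ≡ 1ℤ → Side u s
    low  : decide u s ≡ just false → unitStep (s - + u) ≡ 0ℤ → unitStep (s + + u - 1ℤ) ≡ 0ℤ → Side u s

  side : ∀ u s → 1 ℕ.≤ u → Side u s
  side u s 1≤u with + u ≤? s in eq₁ | s ≤? - + u in eq₂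
  ... | yes u≤s | _ = high e (unitStep-nonneg (i≤j⇒0≤j-i u≤s)) (unitStep-nonneg (begin
      0ℤ                ≤⟨ +-mono-≤ (+≤+ z≤n) (i≤j⇒0≤j-i (+≤+ 1≤u)) ⟩
      + u + (+ u - 1ℤ)  ≤⟨ +-monoˡ-≤ (+ u - 1ℤ) u≤s ⟩
      s + (+ u - 1ℤ)    ≡⟨ +-assoc s (+ u) -1ℤ ⟨
      s + + u - 1ℤ      ∎))
    where
    open ≤-Reasoning
    e : decide u s ≡ just true
    e rewrite eq₁ = refl
  ... | no u≰s | yes s≤-u = low e (unitStep-neg (below (≰⇒> u≰s))) (unitStep-neg (begin-strict
      s + + u - 1ℤ        ≤⟨ +-monoˡ-≤ -1ℤ (+-monoˡ-≤ (+ u) s≤-u) ⟩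
      - + u + + u - 1ℤ    ≡⟨ cong (_- 1ℤ) (+-inverseˡ (+ u)) ⟩
      -1ℤ                 <⟨ -<+ ⟩
      0ℤ                  ∎))
    where
    open ≤-Reasoning
    e : decide u s ≡ just false
    e rewrite eq₁ | eq₂ = refl
    below : s < + u → s - + u < 0ℤ
    below lt = subst (s - + u <_) (+-inverseʳ (+ u)) (+-monoˡ-< (- + u) lt)
  ... | no u≰s | no s≰-u = mid e (unitStep-neg (below (≰⇒> u≰s))) (unitStep-nonneg (begin
      0ℤ                           ≡⟨ +-inverseʳ (1ℤ - + u) ⟨
      (1ℤ - + u) + - (1ℤ - + u)    ≤⟨ +-monoˡ-≤ (- (1ℤ - + u)) (i<j⇒suc[i]≤j (≰⇒> s≰-u)) ⟩
      s + - (1ℤ - + u)             ≡⟨ e₁ s (+ u) ⟩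
      s + + u - 1ℤ                 ∎))
    where
    open ≤-Reasoning
    e : decide u s ≡ nothing
    e rewrite eq₁ | eq₂ = refl
    below : s < + u → s - + u < 0ℤ
    below lt = subst (s - + u <_) (+-inverseʳ (+ u)) (+-monoˡ-< (- + u) lt)
    e₁ : ∀ s u → s + - (1ℤ - u) ≡ s + u - 1ℤ
    e₁ = solve-∀

  vote-unitStep : ∀ u s → 1 ℕ.≤ u → vote u s ≡ unitStep (s - + u) + unitStep (s + + u - 1ℤ) - 1ℤ
  vote-unitStep u s 1≤u with side u s 1≤u
  ... | high a b c rewrite a | b | c = refl
  ... | mid  a b c rewrite a | b | c = refl
  ... | low  a b c rewrite a | b | c = refl

  decided-unitStep : ∀ u s → 1 ℕ.≤ u → decided u s ≡ 1ℤ + - unitStep (s + + u - 1ℤ) + unitStep (s - + u)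
  decided-unitStep u s 1≤u with side u s 1≤u
  ... | high a b c rewrite a | b | c = refl
  ... | mid  a b c rewrite a | b | c = refl
  ... | low  a b c rewrite a | b | c = refl

  vote≤decided : ∀ u s → vote u s ≤ decided u s
  vote≤decided u s with decide u s
  ... | just true  = ≤-refl
  ... | just false = -≤+
  ... | nothing    = ≤-refl

  -decided≤vote : ∀ u s → - decided u s ≤ vote u s
  -decided≤vote u s with decide u s
  ... | just true  = -≤+
  ... | just false = ≤-refl
  ... | nothing    = ≤-refl

  unitStep-reflect : ∀ s → unitStep (- s - 1ℤ) ≡ 1ℤ + - unitStep s
  unitStep-reflect (+ zero) = refl
  unitStep-reflect +[1+ n ] = refl
  unitStep-reflect -[1+ zero ] = refl
  unitStep-reflect -[1+ suc n ] = refl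

  -- Reflection exchanges nonnegative with negative endpoints, and 0 belongs to only one of the two
  -- classes; hence the shift by one.
  upper-reflect : ∀ r s → upper r (- s - 1ℤ) ≡ + (2 ℕ.^ r) + - upper r s
  upper-reflect r s = begin
    upper r (- s - 1ℤ)                      ≡⟨ cong (upper r) (neg-distrib-+ s 1ℤ) ⟨
    upper r (- (s + 1ℤ))                    ≡⟨ walk-reflect r unitStep (s + 1ℤ) ⟨
    walk r (λ z → unitStep (- z)) (s + 1ℤ)         ≡⟨ walk-shift r (λ z → unitStep (- z)) 1ℤ s ⟨
    walk r (λ z → unitStep (- (z + 1ℤ))) s         ≡⟨ walk-cong r (λ z → trans (cong unitStep (neg-distrib-+ z 1ℤ)) (unitStep-reflect z)) s ⟩
    walk r (λ z → 1ℤ + - unitStep z) s             ≡⟨ walk-+ r (λ _ → 1ℤ) (λ z → - unitStep z) s ⟩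
    walk r (λ _ → 1ℤ) s + walk r (λ z → - unitStep z) s
      ≡⟨ cong₂ _+_ (walk-1 r s) (walk-neg r unitStep s) ⟩
    + (2 ℕ.^ r) + - upper r s               ∎
    where open ≡-Reasoning

  module _ (u : ℕ) (1≤u : 1 ℕ.≤ u) (r : ℕ) where

    private
      U = + u
      P = + (2 ℕ.^ r)

    -- By symmetry the bias vanishes at `s = 0`. Eliminating the total mass through `upper-reflect`
    -- exposes the bias as two increments of `upper` over a displacement by `s`, to which the
    -- Lipschitz bound applies.
    walk-vote : ∀ s → walk r (vote u) s ≡ (upper r (s - U) - upper r (- U)) + (upper r (s + (U - 1ℤ)) - upper r (U - 1ℤ))
    walk-vote s = begin
      walk r (vote u) s
        ≡⟨ walk-cong r (λ z → trans (vote-unitStep u z 1≤u) (cong (λ y → unitStep (z - U) + unitStep y - 1ℤ) (+-assoc z U -1ℤ))) s ⟩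
      walk r (λ z → unitStep (z - U) + unitStep (z + (U - 1ℤ)) + - 1ℤ) s
        ≡⟨ walk-+ r (λ z → unitStep (z - U) + unitStep (z + (U - 1ℤ))) (λ _ → - 1ℤ) s ⟩
      walk r (λ z → unitStep (z - U) + unitStep (z + (U - 1ℤ))) s + walk r (λ _ → - 1ℤ) s
        ≡⟨ cong₂ _+_ (walk-+ r (λ z → unitStep (z - U)) (λ z → unitStep (z + (U - 1ℤ))) s)
             (trans (walk-neg r (λ _ → 1ℤ) s) (cong -_ (walk-1 r s))) ⟩
      walk r (λ z → unitStep (z - U)) s + walk r (λ z → unitStep (z + (U - 1ℤ))) s - P
        ≡⟨ cong (_- P) (cong₂ _+_ (walk-shift r unitStep (- U) s) (walk-shift r unitStep (U - 1ℤ) s)) ⟩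
      upper r (s - U) + upper r (s + (U - 1ℤ)) - P
        ≡⟨ e₁ (upper r (s - U)) (upper r (s + (U - 1ℤ))) P (upper r (U - 1ℤ)) ⟩
      (upper r (s - U) - (P + - upper r (U - 1ℤ))) + (upper r (s + (U - 1ℤ)) - upper r (U - 1ℤ))
        ≡⟨ cong (λ z → (upper r (s - U) - z) + (upper r (s + (U - 1ℤ)) - upper r (U - 1ℤ)))
             (trans (sym (upper-reflect r (U - 1ℤ))) (cong (upper r) (e₂ U))) ⟩
      (upper r (s - U) - upper r (- U)) + (upper r (s + (U - 1ℤ)) - upper r (U - 1ℤ)) ∎
      where
      open ≡-Reasoning
      e₁ : ∀ a b p c → a + b - p ≡ (a - (p + - c)) + (b - c)
      e₁ = solve-∀
      e₂ : ∀ U → - (U - 1ℤ) - 1ℤ ≡ - U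
      e₂ = solve-∀

    walk-decided : ∀ s → walk r (decided u) s ≡ P - (upper r (s + (U - 1ℤ)) - upper r (s - U))
    walk-decided s = begin
      walk r (decided u) s
        ≡⟨ walk-cong r (λ z → trans (decided-unitStep u z 1≤u) (cong (λ y → 1ℤ + - unitStep y + unitStep (z - U)) (+-assoc z U -1ℤ))) s ⟩
      walk r (λ z → 1ℤ + - unitStep (z + (U - 1ℤ)) + unitStep (z - U)) s
        ≡⟨ walk-+ r (λ z → 1ℤ + - unitStep (z + (U - 1ℤ))) (λ z → unitStep (z - U)) s ⟩
      walk r (λ z → 1ℤ + - unitStep (z + (U - 1ℤ))) s + walk r (λ z → unitStep (z - U)) s
        ≡⟨ cong (_+ walk r (λ z → unitStep (z - U)) s) (walk-+ r (λ _ → 1ℤ) (λ z → - unitStep (z + (U - 1ℤ))) s) ⟩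
      walk r (λ _ → 1ℤ) s + walk r (λ z → - unitStep (z + (U - 1ℤ))) s + walk r (λ z → unitStep (z - U)) s
        ≡⟨ cong₂ _+_ (cong₂ _+_ (walk-1 r s) (trans (walk-neg r (λ z → unitStep (z + (U - 1ℤ))) s) (cong -_ (walk-shift r unitStep (U - 1ℤ) s))))
             (walk-shift r unitStep (- U) s) ⟩
      P + - upper r (s + (U - 1ℤ)) + upper r (s - U)
        ≡⟨ e₁ P (upper r (s + (U - 1ℤ))) (upper r (s - U)) ⟩
      P - (upper r (s + (U - 1ℤ)) - upper r (s - U)) ∎
      where
      open ≡-Reasoning
      e₁ : ∀ p a b → p + - a + b ≡ p - (a - b)
      e₁ = solve-∀

    module _ (16u²≤r : 16 ℕ.* (u ℕ.* u) ℕ.≤ r) where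

      private
        increment : ℤ → ℕ → ℤ
        increment a k = upper r (a + + k) - upper r a

        increment≥0 : ∀ a k → 0ℤ ≤ increment a k
        increment≥0 a k = i≤j⇒0≤j-i (upper-mono r a k)

        two-increments : ∀ a b k →
          2 ℕ.* u ℕ.* ∣ increment a k + increment b k ∣ ℕ.≤ k ℕ.* 2 ℕ.^ r
        two-increments a b k = ℕₚ.*-cancelˡ-≤ 2 (drop‿+≤+ (begin
          + (2 ℕ.* (2 ℕ.* u ℕ.* ∣ D ∣))          ≡⟨ cong +_ (trans (sym (ℕₚ.*-assoc 2 (2 ℕ.* u) ∣ D ∣)) (cong (ℕ._* ∣ D ∣) (sym (ℕₚ.*-assoc 2 2 u)))) ⟩
          + (4 ℕ.* u ℕ.* ∣ D ∣)                  ≡⟨ pos-* (4 ℕ.* u) ∣ D ∣ ⟩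
          + (4 ℕ.* u) * + ∣ D ∣                  ≡⟨ cong (+ (4 ℕ.* u) *_) (0≤i⇒+∣i∣≡i (+-mono-≤ (increment≥0 a k) (increment≥0 b k))) ⟩
          + (4 ℕ.* u) * (increment a k + increment b k)
            ≡⟨ *-distribˡ-+ (+ (4 ℕ.* u)) (increment a k) (increment b k) ⟩
          + (4 ℕ.* u) * increment a k + + (4 ℕ.* u) * increment b k
            ≤⟨ +-mono-≤ (upper-lipschitz u r a k 16u²≤r) (upper-lipschitz u r b k 16u²≤r) ⟩
          + k * P + + k * P                      ≡⟨ e (+ k * P) ⟩
          + 2 * (+ k * P)                        ≡⟨ cong (+ 2 *_) (sym (pos-* k (2 ℕ.^ r))) ⟩
          + 2 * + (k ℕ.* 2 ℕ.^ r)                ≡⟨ pos-* 2 (k ℕ.* 2 ℕ.^ r) ⟨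
          + (2 ℕ.* (k ℕ.* 2 ℕ.^ r))              ∎))
          where
          open ≤-Reasoning
          D = increment a k + increment b k
          e : ∀ x → x + x ≡ + 2 * x
          e = solve-∀

      walk-vote-bound : ∀ s → 2 ℕ.* u ℕ.* ∣ walk r (vote u) s ∣ ℕ.≤ ∣ s ∣ ℕ.* 2 ℕ.^ r
      walk-vote-bound (+ k) = subst (λ z → 2 ℕ.* u ℕ.* ∣ z ∣ ℕ.≤ k ℕ.* 2 ℕ.^ r) (sym eq) (two-increments (- U) (U - 1ℤ) k)
        where
        eq : walk r (vote u) (+ k) ≡ increment (- U) k + increment (U - 1ℤ) k
        eq = trans (walk-vote (+ k)) (cong₂ (λ x y → (upper r x - upper r (- U)) + (upper r y - upper r (U - 1ℤ)))
               (+-comm (+ k) (- U)) (+-comm (+ k) (U - 1ℤ)))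
      -- For negative `s` the increments start at the displaced points and run up to the undisplaced
      -- ones, which reverses the overall sign.
      walk-vote-bound s@(-[1+ k ]) = subst (λ z → 2 ℕ.* u ℕ.* z ℕ.≤ suc k ℕ.* 2 ℕ.^ r) (sym eq) (two-increments (s - U) (s + (U - 1ℤ)) (suc k))
        where
        open ≡-Reasoning
        e₁ : ∀ a b c d → (a - b) + (c - d) ≡ - ((b - a) + (d - c))
        e₁ = solve-∀
        e₂ : ∀ k x → x ≡ - k + x + k
        e₂ = solve-∀
        eq : ∣ walk r (vote u) s ∣ ≡ ∣ increment (s - U) (suc k) + increment (s + (U - 1ℤ)) (suc k) ∣
        eq = begin
          ∣ walk r (vote u) s ∣
            ≡⟨ cong ∣_∣ (trans (walk-vote s) (e₁ (upper r (s - U)) (upper r (- U)) (upper r (s + (U - 1ℤ))) (upper r (U - 1ℤ)))) ⟩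
          ∣ - ((upper r (- U) - upper r (s - U)) + (upper r (U - 1ℤ) - upper r (s + (U - 1ℤ)))) ∣
            ≡⟨ ∣-i∣≡∣i∣ ((upper r (- U) - upper r (s - U)) + (upper r (U - 1ℤ) - upper r (s + (U - 1ℤ)))) ⟩
          ∣ (upper r (- U) - upper r (s - U)) + (upper r (U - 1ℤ) - upper r (s + (U - 1ℤ))) ∣
            ≡⟨ cong₂ (λ x y → ∣ (upper r x - upper r (s - U)) + (upper r y - upper r (s + (U - 1ℤ))) ∣)
                 (e₂ (+ suc k) (- U)) (e₂ (+ suc k) (U - 1ℤ)) ⟩
          ∣ increment (s - U) (suc k) + increment (s + (U - 1ℤ)) (suc k) ∣ ∎

      -- The promise fails on `2u - 1` consecutive values, each of mass at most `1/(4u)`, so at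
      -- least half of the mass survives.
      walk-decided-bound : ∀ s → P ≤ + 2 * walk r (decided u) s
      walk-decided-bound s = *-cancelˡ-≤-pos _ _ (U + U) {{positive 0<2u}} (begin
        (U + U) * P                          ≡⟨ e₁ U P ⟩
        + 4 * U * P - (U + U) * P            ≤⟨ +-monoʳ-≤ (+ 4 * U * P) (neg-mono-≤ (upper-lipschitz′)) ⟩
        + 4 * U * P - + 4 * U * gap          ≡⟨ e₂ U P gap ⟩
        (U + U) * (+ 2 * (P - gap))          ≡⟨ cong (λ z → (U + U) * (+ 2 * z)) (walk-decided s) ⟨
        (U + U) * (+ 2 * walk r (decided u) s) ∎)
        where
        open ≤-Reasoning
        gap = upper r (s + (U - 1ℤ)) - upper r (s - U)
        0<2u : 0ℤ < U + U
        0<2u = +<+ (ℕₚ.≤-trans 1≤u (ℕₚ.m≤m+n u u))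
        e₁ : ∀ U P → (U + U) * P ≡ + 4 * U * P - (U + U) * P
        e₁ = solve-∀
        e₂ : ∀ U P g → + 4 * U * P - + 4 * U * g ≡ (U + U) * (+ 2 * (P - g))
        e₂ = solve-∀
        e₃ : ∀ s U → s + (U - 1ℤ) + 1ℤ ≡ s - U + (U + U)
        e₃ = solve-∀
        upper-lipschitz′ : + 4 * U * gap ≤ (U + U) * P
        upper-lipschitz′ = begin
          + 4 * U * gap
            ≡⟨ cong (_* gap) (sym (pos-* 4 u)) ⟩
          + (4 ℕ.* u) * gap
            -- The window of width `2u - 1` is enlarged by one point, so that the bound comes out as
            -- exactly one half.
            ≤⟨ *-monoˡ-≤-nonNeg (+ (4 ℕ.* u)) (+-monoˡ-≤ (- upper r (s - U)) (subst (upper r (s + (U - 1ℤ)) ≤_) (cong (upper r) (e₃ s U)) (upper-mono r (s + (U - 1ℤ)) 1))) ⟩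
          + (4 ℕ.* u) * increment (s - U) (u ℕ.+ u)
            ≤⟨ upper-lipschitz u r (s - U) (u ℕ.+ u) 16u²≤r ⟩
          (U + U) * P ∎

-- Finite sums as unnormalised expectations, and second moments of product distributions.

module Sums where

  open import Data.Nat using (ℕ; zero; suc; z≤n; s≤s)
  import Data.Nat as ℕ
  import Data.Nat.Properties as ℕₚ
  open import Data.Bool using (Bool; true; false; if_then_else_)
  open import Data.Fin using (Fin; zero; suc)
  open import Data.List using (List; []; _∷_; _++_; map; length; filterᵇ; concatMap)
  open import Data.List.Relation.Unary.All using (All; []; _∷_)
  import Data.List.Relation.Unary.All as All
  import Data.List.Relation.Unary.All.Properties as Allₚ
  open import Data.Vec using (Vec; []; _∷_; lookup)
  open import Data.Product using (_×_; _,_; proj₁; proj₂)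
  open import Data.Integer hiding (suc)
  open import Data.Integer.Properties
  open import Data.Integer.Tactic.RingSolver
  import Data.Nat.Tactic.RingSolver as ℕR
  open import Algebra.Properties.CommutativeSemigroup +-commutativeSemigroup using (interchange)
  open import Algebra.Properties.CommutativeMonoid.Sum +-0-commutativeMonoid using () renaming (sum to sumℤ)
  open import Algebra.Properties.CommutativeMonoid.Sum ℕₚ.+-0-commutativeMonoid using () renaming (sum to sumℕ)
  open import Relation.Binary.PropositionalEquality
  open Walk using (sq≥0)

  private variable
    A B : Set

  ∑ : List A → (A → ℤ) → ℤ
  ∑ []      F = 0ℤ
  ∑ (a ∷ l) F = F a + ∑ l F

  ∑-cong : ∀ (l : List A) {F G} → (∀ a → F a ≡ G a) → ∑ l F ≡ ∑ l G
  ∑-cong []      eq = refl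
  ∑-cong (a ∷ l) eq = cong₂ _+_ (eq a) (∑-cong l eq)

  ∑-cong-All : ∀ {l : List A} {F G} → All (λ a → F a ≡ G a) l → ∑ l F ≡ ∑ l G
  ∑-cong-All []         = refl
  ∑-cong-All (eq ∷ eqs) = cong₂ _+_ eq (∑-cong-All eqs)

  ∑-mono : ∀ {l : List A} {F G} → All (λ a → F a ≤ G a) l → ∑ l F ≤ ∑ l G
  ∑-mono []          = ≤-refl
  ∑-mono (le ∷ les) = +-mono-≤ le (∑-mono les)

  ∑-++ : ∀ (l k : List A) F → ∑ (l ++ k) F ≡ ∑ l F + ∑ k F
  ∑-++ []      k F = sym (+-identityˡ (∑ k F))
  ∑-++ (a ∷ l) k F = trans (cong (λ z → F a + z) (∑-++ l k F)) (sym (+-assoc (F a) (∑ l F) (∑ k F)))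

  ∑-map : ∀ (f : B → A) l F → ∑ (map f l) F ≡ ∑ l (λ b → F (f b))
  ∑-map f []      F = refl
  ∑-map f (b ∷ l) F = cong (λ z → F (f b) + z) (∑-map f l F)

  ∑-concatMap : ∀ (f : B → List A) l F → ∑ (concatMap f l) F ≡ ∑ l (λ b → ∑ (f b) F)
  ∑-concatMap f []      F = refl
  ∑-concatMap f (b ∷ l) F = trans (∑-++ (f b) (concatMap f l) F) (cong (λ z → ∑ (f b) F + z) (∑-concatMap f l F))

  ∑-filterᵇ : ∀ (p : A → Bool) l F → ∑ (filterᵇ p l) F ≡ ∑ l (λ a → if p a then F a else 0ℤ)
  ∑-filterᵇ p []      F = refl
  ∑-filterᵇ p (a ∷ l) F with p a
  ... | true  = cong (λ z → F a + z) (∑-filterᵇ p l F)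
  ... | false = trans (∑-filterᵇ p l F) (sym (+-identityˡ _))

  ∑-+ : ∀ (l : List A) F G → ∑ l (λ a → F a + G a) ≡ ∑ l F + ∑ l G
  ∑-+ []      F G = refl
  ∑-+ (a ∷ l) F G = trans (cong (λ z → F a + G a + z) (∑-+ l F G)) (interchange (F a) (G a) (∑ l F) (∑ l G))

  ∑-*ˡ : ∀ (l : List A) c F → ∑ l (λ a → c * F a) ≡ c * ∑ l F
  ∑-*ˡ []      c F = sym (*-zeroʳ c)
  ∑-*ˡ (a ∷ l) c F = trans (cong (λ z → c * F a + z) (∑-*ˡ l c F)) (sym (*-distribˡ-+ c (F a) (∑ l F)))

  ∑-const : ∀ (l : List A) c → ∑ l (λ _ → c) ≡ + length l * c
  ∑-const []      c = sym (*-zeroˡ c)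
  ∑-const (a ∷ l) c = trans (cong (λ z → c + z) (∑-const l c)) (sym (suc-* (+ length l) c))

  ∑-1 : ∀ (l : List A) → ∑ l (λ _ → 1ℤ) ≡ + length l
  ∑-1 l = trans (∑-const l 1ℤ) (*-identityʳ (+ length l))

  𝟙 : Bool → ℤ
  𝟙 b = if b then 1ℤ else 0ℤ

  count : (A → Bool) → List A → ℕ
  count p []      = 0
  count p (a ∷ l) = (if p a then 1 else 0) ℕ.+ count p l

  ∑-𝟙 : ∀ (p : A → Bool) l → ∑ l (λ a → 𝟙 (p a)) ≡ + count p l
  ∑-𝟙 p []      = refl
  ∑-𝟙 p (a ∷ l) with p a
  ... | true  = cong (λ z → 1ℤ + z) (∑-𝟙 p l)
  ... | false = trans (+-identityˡ _) (∑-𝟙 p l)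

  -- Markov's inequality for a square. Only members of `l` have to satisfy the implication, so the
  -- promise on the inputs is available in proving it.
  markov : ∀ (l : List A) p (Y : A → ℤ) (K : ℤ) → All (λ a → p a ≡ true → K ≤ Y a * Y a) l →
           K * + count p l ≤ ∑ l (λ a → Y a * Y a)
  markov l p Y K le = begin
    K * + count p l                 ≡⟨ cong (K *_) (∑-𝟙 p l) ⟨
    K * ∑ l (λ a → 𝟙 (p a))         ≡⟨ ∑-*ˡ l K (λ a → 𝟙 (p a)) ⟨
    ∑ l (λ a → K * 𝟙 (p a))         ≤⟨ ∑-mono (All.map (λ {a} → pointwise a) le) ⟩
    ∑ l (λ a → Y a * Y a)           ∎
    where
    open ≤-Reasoning
    pointwise : ∀ a → (p a ≡ true → K ≤ Y a * Y a) → K * 𝟙 (p a) ≤ Y a * Y a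
    pointwise a h with p a
    ... | true  = ≤-trans (≤-reflexive (*-identityʳ K)) (h refl)
    ... | false = ≤-trans (≤-reflexive (*-zeroʳ K)) (sq≥0 (Y a))

  -- A list stands for the uniform distribution on its entries, with multiplicity; this is the
  -- product of such distributions.
  tuples : ∀ n → (Fin n → List A) → List (Vec A n)
  tuples zero    L = [] ∷ []
  tuples (suc n) L = concatMap (λ a → map (a ∷_) (tuples n (λ i → L (suc i)))) (L zero)

  ∑-tuples : ∀ n (L : Fin (suc n) → List A) F →
    ∑ (tuples (suc n) L) F ≡ ∑ (L zero) (λ a → ∑ (tuples n (λ i → L (suc i))) (λ w → F (a ∷ w)))
  ∑-tuples n L F = trans (∑-concatMap (λ a → map (a ∷_) (tuples n (λ i → L (suc i)))) (L zero) F)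
    (∑-cong (L zero) (λ a → ∑-map (a ∷_) (tuples n (λ i → L (suc i))) F))

  length-tuples : ∀ n (L : Fin (suc n) → List A) →
    length (tuples (suc n) L) ≡ length (L zero) ℕ.* length (tuples n (λ i → L (suc i)))
  length-tuples n L = +-injective (begin
    + length (tuples (suc n) L)                          ≡⟨ ∑-1 (tuples (suc n) L) ⟨
    ∑ (tuples (suc n) L) (λ _ → 1ℤ)                      ≡⟨ ∑-tuples n L (λ _ → 1ℤ) ⟩
    ∑ (L zero) (λ _ → ∑ T (λ _ → 1ℤ))                    ≡⟨ ∑-cong (L zero) (λ _ → ∑-1 T) ⟩
    ∑ (L zero) (λ _ → + length T)                        ≡⟨ ∑-const (L zero) (+ length T) ⟩
    + length (L zero) * + length T                       ≡⟨ pos-* (length (L zero)) (length T) ⟨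
    + (length (L zero) ℕ.* length T)                     ∎)
    where
    open ≡-Reasoning
    T = tuples n (λ i → L (suc i))

  tuples-nonempty : ∀ n (L : Fin n → List A) → (∀ i → 1 ℕ.≤ length (L i)) → 1 ℕ.≤ length (tuples n L)
  tuples-nonempty zero    L ne = s≤s z≤n
  tuples-nonempty (suc n) L ne = subst (1 ℕ.≤_) (sym (length-tuples n L))
    (ℕₚ.*-mono-≤ (ne zero) (tuples-nonempty n (λ i → L (suc i)) (λ i → ne (suc i))))

  tuples-All : ∀ n (L : Fin n → List A) {Q : Fin n → A → Set} → (∀ i → All (Q i) (L i)) →
    All (λ w → ∀ i → Q i (lookup w i)) (tuples n L)
  tuples-All zero    L all = (λ ()) ∷ []
  tuples-All (suc n) L {Q} all = Allₚ.concat⁺ (Allₚ.map⁺ (All.map (λ q → Allₚ.map⁺ (All.map (cons q) (tuples-All n (λ i → L (suc i)) (λ i → all (suc i))))) (all zero)))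
    where
    cons : ∀ {a w} → Q zero a → (∀ i → Q (suc i) (lookup w i)) → ∀ i → Q i (lookup (a ∷ w) i)
    cons q qs zero    = q
    cons q qs (suc i) = qs i

  ∑-shift : ∀ (l : List A) x F → ∑ l (λ a → x + F a) ≡ + length l * x + ∑ l F
  ∑-shift l x F = trans (∑-+ l (λ _ → x) F) (cong (_+ ∑ l F) (∑-const l x))

  ∑-shift² : ∀ (l : List A) x F → ∑ l (λ a → (x + F a) * (x + F a)) ≡
    + length l * (x * x) + + 2 * x * ∑ l F + ∑ l (λ a → F a * F a)
  ∑-shift² l x F = begin
    ∑ l (λ a → (x + F a) * (x + F a))
      ≡⟨ ∑-cong l (λ a → e x (F a)) ⟩
    ∑ l (λ a → x * x + + 2 * x * F a + F a * F a)
      ≡⟨ ∑-+ l (λ a → x * x + + 2 * x * F a) (λ a → F a * F a) ⟩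
    ∑ l (λ a → x * x + + 2 * x * F a) + ∑ l (λ a → F a * F a)
      ≡⟨ cong (_+ ∑ l (λ a → F a * F a)) (trans (∑-shift l (x * x) (λ a → + 2 * x * F a)) (cong (λ z → + length l * (x * x) + z) (∑-*ˡ l (+ 2 * x) F))) ⟩
    + length l * (x * x) + + 2 * x * ∑ l F + ∑ l (λ a → F a * F a) ∎
    where
    open ≡-Reasoning
    e : ∀ x y → (x + y) * (x + y) ≡ x * x + + 2 * x * y + y * y
    e = solve-∀

  i≤∣i∣ : ∀ i → i ≤ + ∣ i ∣
  i≤∣i∣ (+ n)    = ≤-refl
  i≤∣i∣ -[1+ n ] = -≤+

  dot : ∀ {n} → (Fin n → A → ℤ) → Vec A n → ℤ
  dot e w = sumℤ (λ i → e i (lookup w i))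

  module SecondMoment (v : ℕ) where

    -- For independent summands with means at most `β i` in absolute value and second moments at
    -- most `v`, the square of the sum has mean at most `(Σ β)² + n v`. The first moment is carried
    -- along because the cross term of the induction is the product of the two first moments.
    moments : ∀ n (L : Fin n → List A) (e : Fin n → A → ℤ) (β : Fin n → ℕ) →
      (∀ i → ∣ ∑ (L i) (e i) ∣ ℕ.≤ β i ℕ.* length (L i)) →
      (∀ i → ∑ (L i) (λ a → e i a * e i a) ≤ + (v ℕ.* length (L i))) →
      ∣ ∑ (tuples n L) (dot e) ∣ ℕ.≤ sumℕ β ℕ.* length (tuples n L) ×
      ∑ (tuples n L) (λ w → dot e w * dot e w) ≤ + ((sumℕ β ℕ.* sumℕ β ℕ.+ n ℕ.* v) ℕ.* length (tuples n L))
    moments zero    L e β first second = z≤n , ≤-refl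
    moments (suc n) L e β first second = m₁ , m₂
      where
      T  = tuples n (λ i → L (suc i))
      d  = dot (λ i → e (suc i))
      IH = moments n (λ i → L (suc i)) (λ i → e (suc i)) (λ i → β (suc i)) (λ i → first (suc i)) (λ i → second (suc i))
      l  = L zero
      E  = e zero
      M  = length l
      P  = length T
      b  = β zero
      β′ = sumℕ (λ i → β (suc i))
      S₁ = ∑ T d
      S₂ = ∑ T (λ w → d w * d w)
      sum₁ : ∑ (tuples (suc n) L) (dot e) ≡ + P * ∑ l E + + M * S₁
      sum₁ = begin
        ∑ (tuples (suc n) L) (dot e)            ≡⟨ ∑-tuples n L (dot e) ⟩
        ∑ l (λ a → ∑ T (λ w → E a + d w))       ≡⟨ ∑-cong l (λ a → ∑-shift T (E a) d) ⟩
        ∑ l (λ a → + P * E a + S₁)              ≡⟨ ∑-+ l (λ a → + P * E a) (λ _ → S₁) ⟩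
        ∑ l (λ a → + P * E a) + ∑ l (λ _ → S₁)  ≡⟨ cong₂ _+_ (∑-*ˡ l (+ P) E) (∑-const l S₁) ⟩
        + P * ∑ l E + + M * S₁                  ∎
        where open ≡-Reasoning
      sum₂ : ∑ (tuples (suc n) L) (λ w → dot e w * dot e w) ≡
             + P * ∑ l (λ a → E a * E a) + + 2 * (∑ l E * S₁) + + M * S₂
      sum₂ = begin
        ∑ (tuples (suc n) L) (λ w → dot e w * dot e w)
          ≡⟨ ∑-tuples n L (λ w → dot e w * dot e w) ⟩
        ∑ l (λ a → ∑ T (λ w → (E a + d w) * (E a + d w)))
          ≡⟨ ∑-cong l (λ a → trans (∑-shift² T (E a) d) (cong (λ z → + P * (E a * E a) + z + S₂) (e₁ (E a) S₁))) ⟩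
        ∑ l (λ a → + P * (E a * E a) + + 2 * S₁ * E a + S₂)
          ≡⟨ ∑-+ l (λ a → + P * (E a * E a) + + 2 * S₁ * E a) (λ _ → S₂) ⟩
        ∑ l (λ a → + P * (E a * E a) + + 2 * S₁ * E a) + ∑ l (λ _ → S₂)
          ≡⟨ cong₂ _+_ (trans (∑-+ l (λ a → + P * (E a * E a)) (λ a → + 2 * S₁ * E a))
               (cong₂ _+_ (∑-*ˡ l (+ P) (λ a → E a * E a)) (trans (∑-*ˡ l (+ 2 * S₁) E) (e₂ (∑ l E) S₁)))) (∑-const l S₂) ⟩
        + P * ∑ l (λ a → E a * E a) + + 2 * (∑ l E * S₁) + + M * S₂ ∎
        where
        open ≡-Reasoning
        e₁ : ∀ a s → + 2 * a * s ≡ + 2 * s * a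
        e₁ = solve-∀
        e₂ : ∀ a s → + 2 * s * a ≡ + 2 * (a * s)
        e₂ = solve-∀
      m₁ : ∣ ∑ (tuples (suc n) L) (dot e) ∣ ℕ.≤ (b ℕ.+ β′) ℕ.* length (tuples (suc n) L)
      m₁ = begin
        ∣ ∑ (tuples (suc n) L) (dot e) ∣               ≡⟨ cong ∣_∣ sum₁ ⟩
        ∣ + P * ∑ l E + + M * S₁ ∣                     ≤⟨ ∣i+j∣≤∣i∣+∣j∣ (+ P * ∑ l E) (+ M * S₁) ⟩
        ∣ + P * ∑ l E ∣ ℕ.+ ∣ + M * S₁ ∣               ≡⟨ cong₂ ℕ._+_ (abs-* (+ P) (∑ l E)) (abs-* (+ M) S₁) ⟩
        P ℕ.* ∣ ∑ l E ∣ ℕ.+ M ℕ.* ∣ S₁ ∣               ≤⟨ ℕₚ.+-mono-≤ (ℕₚ.*-monoʳ-≤ P (first zero)) (ℕₚ.*-monoʳ-≤ M (proj₁ IH)) ⟩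
        P ℕ.* (b ℕ.* M) ℕ.+ M ℕ.* (β′ ℕ.* P)           ≡⟨ e₁ P b M β′ ⟩
        (b ℕ.+ β′) ℕ.* (M ℕ.* P)                       ≡⟨ cong ((b ℕ.+ β′) ℕ.*_) (length-tuples n L) ⟨
        (b ℕ.+ β′) ℕ.* length (tuples (suc n) L)       ∎
        where
        open ℕₚ.≤-Reasoning
        e₁ : ∀ P b M c → P ℕ.* (b ℕ.* M) ℕ.+ M ℕ.* (c ℕ.* P) ≡ (b ℕ.+ c) ℕ.* (M ℕ.* P)
        e₁ = ℕR.solve-∀
      cross : ∑ l E * S₁ ≤ + (b ℕ.* M ℕ.* (β′ ℕ.* P))
      cross = ≤-trans (i≤∣i∣ (∑ l E * S₁)) (+≤+ (subst (ℕ._≤ b ℕ.* M ℕ.* (β′ ℕ.* P)) (sym (abs-* (∑ l E) S₁))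
                (ℕₚ.*-mono-≤ (first zero) (proj₁ IH))))
      m₂ : ∑ (tuples (suc n) L) (λ w → dot e w * dot e w) ≤
           + (((b ℕ.+ β′) ℕ.* (b ℕ.+ β′) ℕ.+ suc n ℕ.* v) ℕ.* length (tuples (suc n) L))
      m₂ = begin
        ∑ (tuples (suc n) L) (λ w → dot e w * dot e w)
          ≡⟨ sum₂ ⟩
        + P * ∑ l (λ a → E a * E a) + + 2 * (∑ l E * S₁) + + M * S₂
          ≤⟨ +-mono-≤ (+-mono-≤ (*-monoˡ-≤-nonNeg (+ P) (second zero)) (*-monoˡ-≤-nonNeg (+ 2) cross)) (*-monoˡ-≤-nonNeg (+ M) (proj₂ IH)) ⟩
        + P * + (v ℕ.* M) + + 2 * + (b ℕ.* M ℕ.* (β′ ℕ.* P)) + + M * + ((β′ ℕ.* β′ ℕ.+ n ℕ.* v) ℕ.* P)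
          ≡⟨ cong₂ _+_ (cong₂ _+_ (sym (pos-* P _)) (sym (pos-* 2 (b ℕ.* M ℕ.* (β′ ℕ.* P))))) (sym (pos-* M _)) ⟩
        + (P ℕ.* (v ℕ.* M) ℕ.+ 2 ℕ.* (b ℕ.* M ℕ.* (β′ ℕ.* P)) ℕ.+ M ℕ.* ((β′ ℕ.* β′ ℕ.+ n ℕ.* v) ℕ.* P))
          -- The square of `b` is added as slack, to complete the square of `b + β′`.
          ≤⟨ +≤+ (ℕₚ.m≤m+n _ (b ℕ.* b ℕ.* (M ℕ.* P))) ⟩
        + (P ℕ.* (v ℕ.* M) ℕ.+ 2 ℕ.* (b ℕ.* M ℕ.* (β′ ℕ.* P)) ℕ.+ M ℕ.* ((β′ ℕ.* β′ ℕ.+ n ℕ.* v) ℕ.* P) ℕ.+ b ℕ.* b ℕ.* (M ℕ.* P))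
          ≡⟨ cong +_ (e₁ P v M b β′ n) ⟩
        + (((b ℕ.+ β′) ℕ.* (b ℕ.+ β′) ℕ.+ suc n ℕ.* v) ℕ.* (M ℕ.* P))
          ≡⟨ cong (λ z → + (((b ℕ.+ β′) ℕ.* (b ℕ.+ β′) ℕ.+ suc n ℕ.* v) ℕ.* z)) (length-tuples n L) ⟨
        + (((b ℕ.+ β′) ℕ.* (b ℕ.+ β′) ℕ.+ suc n ℕ.* v) ℕ.* length (tuples (suc n) L)) ∎
        where
        open ≤-Reasoning
        e₁ : ∀ P v M b c n →
          P ℕ.* (v ℕ.* M) ℕ.+ 2 ℕ.* (b ℕ.* M ℕ.* (c ℕ.* P)) ℕ.+ M ℕ.* ((c ℕ.* c ℕ.+ n ℕ.* v) ℕ.* P) ℕ.+ b ℕ.* b ℕ.* (M ℕ.* P)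
          ≡ ((b ℕ.+ c) ℕ.* (b ℕ.+ c) ℕ.+ suc n ℕ.* v) ℕ.* (M ℕ.* P)
        e₁ = ℕR.solve-∀

-- One block with some bits known: its completions and the bias of its sign.

module PartialAssignments where

  open import Data.Nat using (ℕ; zero; suc; z≤n)
  import Data.Nat as ℕ
  import Data.Nat.Properties as ℕₚ
  open import Data.Bool using (Bool; true; false; if_then_else_)
  open import Data.Maybe using (Maybe; just; nothing; is-just)
  open import Data.Maybe.Properties using (just-injective)
  open import Data.Fin using (zero; suc)
  open import Data.List using (List; []; _∷_; _++_; map; length; filterᵇ)
  open import Data.List.Relation.Unary.All using (All; []; _∷_)
  import Data.List.Relation.Unary.All as All
  import Data.List.Relation.Unary.All.Properties as Allₚ
  open import Data.Vec using (Vec; []; _∷_)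
  open import Data.Integer hiding (suc)
  open import Data.Integer.Properties
  open import Data.Integer.Tactic.RingSolver
  import Data.Nat.Tactic.RingSolver as ℕR
  open import Algebra.Properties.CommutativeSemigroup +-commutativeSemigroup using (interchange)
  open import Relation.Nullary using (yes; no)
  open import Relation.Binary.PropositionalEquality
  open import Data.Sum using (inj₁; inj₂)
  open Walk
  open Threshold
  open Sums

  Partial : ℕ → Set
  Partial m = Vec (Maybe Bool) m

  -- Positions beyond the length read as false.
  at : ∀ {m} → Vec Bool m → ℕ → Bool
  at []      _       = false
  at (b ∷ v) zero    = b
  at (b ∷ v) (suc j) = at v j

  -- Positions beyond the block count as already known, with the default value of `at`. A query to a
  -- padding bit therefore leaves the state of knowledge unchanged.
  known : ∀ {m} → Partial m → ℕ → Maybe Bool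
  known []      _       = just false
  known (c ∷ ρ) zero    = c
  known (c ∷ ρ) (suc j) = known ρ j

  set : ∀ {m} → Partial m → ℕ → Bool → Partial m
  set []      _       b = []
  set (c ∷ ρ) zero    b = just b ∷ ρ
  set (c ∷ ρ) (suc j) b = c ∷ set ρ j b

  completions : ∀ {m} → Partial m → List (Vec Bool m)
  completions []            = [] ∷ []
  completions (just b ∷ ρ)  = map (b ∷_) (completions ρ)
  completions (nothing ∷ ρ) = map (true ∷_) (completions ρ) ++ map (false ∷_) (completions ρ)

  free fixed : ∀ {m} → Partial m → ℕ
  free []             = 0
  free (just _ ∷ ρ)   = free ρ
  free (nothing ∷ ρ)  = suc (free ρ)
  fixed []            = 0
  fixed (just _ ∷ ρ)  = suc (fixed ρ)
  fixed (nothing ∷ ρ) = fixed ρ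

  seen : ∀ {m} → Partial m → ℤ
  seen []            = 0ℤ
  seen (just b ∷ ρ)  = σ b + seen ρ
  seen (nothing ∷ ρ) = seen ρ

  signSum : ∀ {m} → Vec Bool m → ℤ
  signSum []      = 0ℤ
  signSum (b ∷ v) = σ b + signSum v

  free+fixed : ∀ {m} (ρ : Partial m) → free ρ ℕ.+ fixed ρ ≡ m
  free+fixed []            = refl
  free+fixed (just _ ∷ ρ)  = trans (ℕₚ.+-suc (free ρ) (fixed ρ)) (cong suc (free+fixed ρ))
  free+fixed (nothing ∷ ρ) = cong suc (free+fixed ρ)

  ∣σ∣ : ∀ b → ∣ σ b ∣ ≡ 1
  ∣σ∣ true  = refl
  ∣σ∣ false = refl

  ∣seen∣≤fixed : ∀ {m} (ρ : Partial m) → ∣ seen ρ ∣ ℕ.≤ fixed ρ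
  ∣seen∣≤fixed []            = z≤n
  ∣seen∣≤fixed (just b ∷ ρ)  = ℕₚ.≤-trans (∣i+j∣≤∣i∣+∣j∣ (σ b) (seen ρ))
    (ℕₚ.+-mono-≤ (ℕₚ.≤-reflexive (∣σ∣ b)) (∣seen∣≤fixed ρ))
  ∣seen∣≤fixed (nothing ∷ ρ) = ∣seen∣≤fixed ρ

  fixed-set : ∀ {m} (ρ : Partial m) j b → known ρ j ≡ nothing → fixed (set ρ j b) ≡ suc (fixed ρ)
  fixed-set (nothing ∷ ρ) zero    b un = refl
  fixed-set (just _ ∷ ρ)  (suc j) b un = cong suc (fixed-set ρ j b un)
  fixed-set (nothing ∷ ρ) (suc j) b un = fixed-set ρ j b un

  free-set : ∀ {m} (ρ : Partial m) j b → known ρ j ≡ nothing → free ρ ≡ suc (free (set ρ j b))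
  free-set (nothing ∷ ρ) zero    b un = refl
  free-set (just _ ∷ ρ)  (suc j) b un = free-set ρ j b un
  free-set (nothing ∷ ρ) (suc j) b un = cong suc (free-set ρ j b un)

  seen-set : ∀ {m} (ρ : Partial m) j b → known ρ j ≡ nothing → seen (set ρ j b) ≡ seen ρ + σ b
  seen-set (nothing ∷ ρ) zero    b un = +-comm (σ b) (seen ρ)
  seen-set (just c ∷ ρ)  (suc j) b un = trans (cong (λ z → σ c + z) (seen-set ρ j b un)) (sym (+-assoc (σ c) (seen ρ) (σ b)))
  seen-set (nothing ∷ ρ) (suc j) b un = seen-set ρ j b un

  known-set : ∀ {m} (ρ : Partial m) j b → known ρ j ≡ nothing → known (set ρ j b) j ≡ just b
  known-set (_ ∷ ρ) zero    b un = refl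
  known-set (_ ∷ ρ) (suc j) b un = known-set ρ j b un

  known-set-mono : ∀ {m} (ρ : Partial m) j b k c → known ρ j ≡ nothing → known ρ k ≡ just c → known (set ρ j b) k ≡ just c
  known-set-mono (nothing ∷ ρ) zero    b zero    c un ()
  known-set-mono (_ ∷ ρ) zero    b (suc k) c un kn = kn
  known-set-mono (_ ∷ ρ) (suc j) b zero    c un kn = kn
  known-set-mono (_ ∷ ρ) (suc j) b (suc k) c un kn = known-set-mono ρ j b k c un kn

  completions-known : ∀ {m} (ρ : Partial m) j {b} → known ρ j ≡ just b → All (λ v → at v j ≡ b) (completions ρ)
  completions-known [] j kn = just-injective kn ∷ []
  completions-known (just c ∷ ρ) zero kn = Allₚ.map⁺ (All.universal (λ _ → just-injective kn) (completions ρ))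
  completions-known (just c ∷ ρ) (suc j) kn = Allₚ.map⁺ (completions-known ρ j kn)
  completions-known (nothing ∷ ρ) (suc j) kn =
    Allₚ.++⁺ (Allₚ.map⁺ (completions-known ρ j kn)) (Allₚ.map⁺ (completions-known ρ j kn))

  ∑-nothing : ∀ {m} (ρ : Partial m) F → ∑ (completions (nothing ∷ ρ)) F ≡
    ∑ (completions ρ) (λ v → F (true ∷ v)) + ∑ (completions ρ) (λ v → F (false ∷ v))
  ∑-nothing ρ F = trans (∑-++ (map (true ∷_) (completions ρ)) (map (false ∷_) (completions ρ)) F)
    (cong₂ _+_ (∑-map (true ∷_) (completions ρ) F) (∑-map (false ∷_) (completions ρ) F))

  completions-split : ∀ {m} (ρ : Partial m) j F → known ρ j ≡ nothing →
    ∑ (completions ρ) F ≡ ∑ (completions (set ρ j true)) F + ∑ (completions (set ρ j false)) F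
  completions-split (nothing ∷ ρ) zero F un = ∑-++ (map (true ∷_) (completions ρ)) (map (false ∷_) (completions ρ)) F
  completions-split (just c ∷ ρ) (suc j) F un = begin
    ∑ (completions (just c ∷ ρ)) F
      ≡⟨ ∑-map (c ∷_) (completions ρ) F ⟩
    ∑ (completions ρ) (λ v → F (c ∷ v))
      ≡⟨ completions-split ρ j (λ v → F (c ∷ v)) un ⟩
    ∑ (completions (set ρ j true)) (λ v → F (c ∷ v)) + ∑ (completions (set ρ j false)) (λ v → F (c ∷ v))
      ≡⟨ cong₂ _+_ (∑-map (c ∷_) (completions (set ρ j true)) F) (∑-map (c ∷_) (completions (set ρ j false)) F) ⟨
    ∑ (completions (just c ∷ set ρ j true)) F + ∑ (completions (just c ∷ set ρ j false)) F ∎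
    where open ≡-Reasoning
  completions-split (nothing ∷ ρ) (suc j) F un = begin
    ∑ (completions (nothing ∷ ρ)) F
      ≡⟨ ∑-nothing ρ F ⟩
    ∑ (completions ρ) (λ v → F (true ∷ v)) + ∑ (completions ρ) (λ v → F (false ∷ v))
      ≡⟨ cong₂ _+_ (completions-split ρ j (λ v → F (true ∷ v)) un) (completions-split ρ j (λ v → F (false ∷ v)) un) ⟩
    (tt + tf) + (ft + ff)
      ≡⟨ interchange tt tf ft ff ⟩
    (tt + ft) + (tf + ff)
      ≡⟨ cong₂ _+_ (∑-nothing (set ρ j true) F) (∑-nothing (set ρ j false) F) ⟨
    ∑ (completions (nothing ∷ set ρ j true)) F + ∑ (completions (nothing ∷ set ρ j false)) F ∎
    where
    open ≡-Reasoning
    tt = ∑ (completions (set ρ j true))  (λ v → F (true ∷ v))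
    tf = ∑ (completions (set ρ j false)) (λ v → F (true ∷ v))
    ft = ∑ (completions (set ρ j true))  (λ v → F (false ∷ v))
    ff = ∑ (completions (set ρ j false)) (λ v → F (false ∷ v))

  -- A function of the total does not see which positions are free: completing `ρ` is a walk with
  -- one step per free bit, started at the sum of the known ones. The offset `a` collects the bits
  -- already passed in the induction.
  completions-walk : ∀ {m} (ρ : Partial m) φ a →
    ∑ (completions ρ) (λ v → φ (a + signSum v)) ≡ walk (free ρ) φ (a + seen ρ)
  completions-walk [] φ a = +-identityʳ (φ (a + 0ℤ))
  completions-walk (just b ∷ ρ) φ a = begin
    ∑ (map (b ∷_) (completions ρ)) (λ v → φ (a + signSum v))
      ≡⟨ ∑-map (b ∷_) (completions ρ) (λ v → φ (a + signSum v)) ⟩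
    ∑ (completions ρ) (λ v → φ (a + (σ b + signSum v)))
      ≡⟨ ∑-cong (completions ρ) (λ v → cong φ (sym (+-assoc a (σ b) (signSum v)))) ⟩
    ∑ (completions ρ) (λ v → φ (a + σ b + signSum v))
      ≡⟨ completions-walk ρ φ (a + σ b) ⟩
    walk (free ρ) φ (a + σ b + seen ρ)
      ≡⟨ cong (walk (free ρ) φ) (+-assoc a (σ b) (seen ρ)) ⟩
    walk (free ρ) φ (a + (σ b + seen ρ)) ∎
    where open ≡-Reasoning
  completions-walk (nothing ∷ ρ) φ a = begin
    ∑ (completions (nothing ∷ ρ)) (λ v → φ (a + signSum v))
      ≡⟨ ∑-nothing ρ (λ v → φ (a + signSum v)) ⟩
    ∑ (completions ρ) (λ v → φ (a + (1ℤ + signSum v))) + ∑ (completions ρ) (λ v → φ (a + (-1ℤ + signSum v)))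
      ≡⟨ cong₂ _+_ (step 1ℤ) (step -1ℤ) ⟩
    walk (free ρ) φ (a + seen ρ + 1ℤ) + walk (free ρ) φ (a + seen ρ - 1ℤ) ∎
    where
    open ≡-Reasoning
    e : ∀ a b c → a + b + c ≡ a + c + b
    e = solve-∀
    step : ∀ c → ∑ (completions ρ) (λ v → φ (a + (c + signSum v))) ≡ walk (free ρ) φ (a + seen ρ + c)
    step c = trans (∑-cong (completions ρ) (λ v → cong φ (sym (+-assoc a c (signSum v)))))
      (trans (completions-walk ρ φ (a + c)) (cong (walk (free ρ) φ) (e a c (seen ρ))))

  valid : ∀ {m} → ℕ → Vec Bool m → Bool
  valid u v = is-just (decide u (signSum v))

  validCompletions : ∀ {m} → ℕ → Partial m → List (Vec Bool m)
  validCompletions u ρ = filterᵇ (valid u) (completions ρ)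

  -- `vote` is zero where the promise fails, so the sum over valid completions equals the sum over
  -- all of them, and conditioning affects only the normalisation.
  ∑-vote : ∀ {m} u (ρ : Partial m) → ∑ (validCompletions u ρ) (λ v → vote u (signSum v)) ≡ walk (free ρ) (vote u) (seen ρ)
  ∑-vote u ρ = begin
    ∑ (validCompletions u ρ) (λ v → vote u (signSum v))
      ≡⟨ ∑-filterᵇ (valid u) (completions ρ) (λ v → vote u (signSum v)) ⟩
    ∑ (completions ρ) (λ v → if valid u v then vote u (signSum v) else 0ℤ)
      ≡⟨ ∑-cong (completions ρ) (λ v → trans (pointwise (signSum v)) (cong (vote u) (sym (+-identityˡ (signSum v))))) ⟩
    ∑ (completions ρ) (λ v → vote u (0ℤ + signSum v))
      ≡⟨ completions-walk ρ (vote u) 0ℤ ⟩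
    walk (free ρ) (vote u) (0ℤ + seen ρ)
      ≡⟨ cong (walk (free ρ) (vote u)) (+-identityˡ (seen ρ)) ⟩
    walk (free ρ) (vote u) (seen ρ) ∎
    where
    open ≡-Reasoning
    pointwise : ∀ s → (if is-just (decide u s) then vote u s else 0ℤ) ≡ vote u s
    pointwise s with decide u s
    ... | just _  = refl
    ... | nothing = refl

  length-valid : ∀ {m} u (ρ : Partial m) → + length (validCompletions u ρ) ≡ walk (free ρ) (decided u) (seen ρ)
  length-valid u ρ = begin
    + length (validCompletions u ρ)
      ≡⟨ ∑-1 (validCompletions u ρ) ⟨
    ∑ (validCompletions u ρ) (λ _ → 1ℤ)
      ≡⟨ ∑-filterᵇ (valid u) (completions ρ) (λ _ → 1ℤ) ⟩
    ∑ (completions ρ) (λ v → if valid u v then 1ℤ else 0ℤ)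
      ≡⟨ ∑-cong (completions ρ) (λ v → trans (pointwise (signSum v)) (cong (decided u) (sym (+-identityˡ (signSum v))))) ⟩
    ∑ (completions ρ) (λ v → decided u (0ℤ + signSum v))
      ≡⟨ completions-walk ρ (decided u) 0ℤ ⟩
    walk (free ρ) (decided u) (0ℤ + seen ρ)
      ≡⟨ cong (walk (free ρ) (decided u)) (+-identityˡ (seen ρ)) ⟩
    walk (free ρ) (decided u) (seen ρ) ∎
    where
    open ≡-Reasoning
    pointwise : ∀ s → (if is-just (decide u s) then 1ℤ else 0ℤ) ≡ decided u s
    pointwise s with decide u s
    ... | just _  = refl
    ... | nothing = refl

  ∣walk-vote∣≤walk-decided : ∀ u r s → + ∣ walk r (vote u) s ∣ ≤ walk r (decided u) s
  ∣walk-vote∣≤walk-decided u r s with +∣i∣≡i⊎+∣i∣≡-i (walk r (vote u) s)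
  ... | inj₁ eq = subst (_≤ walk r (decided u) s) (sym eq) (walk-mono r (vote≤decided u) s)
  ... | inj₂ eq = subst₂ _≤_ (sym eq) (neg-involutive (walk r (decided u) s))
    (neg-mono-≤ (subst (_≤ walk r (vote u) s) (walk-neg r (decided u) s) (walk-mono r (-decided≤vote u) s)))

  length-valid-≥ : ∀ {m} u (ρ : Partial m) → 1 ℕ.≤ u → 16 ℕ.* (u ℕ.* u) ℕ.≤ free ρ →
    2 ℕ.^ free ρ ℕ.≤ 2 ℕ.* length (validCompletions u ρ)
  length-valid-≥ u ρ 1≤u big = drop‿+≤+ (subst (+ (2 ℕ.^ free ρ) ≤_)
    (trans (cong (+ 2 *_) (sym (length-valid u ρ))) (sym (pos-* 2 (length (validCompletions u ρ))))) (walk-decided-bound u 1≤u (free ρ) big (seen ρ)))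

  -- With at least half of the bits free this is walk-vote-bound; otherwise fixed ρ ≥ 16u² ≥ u and it is trivial.
  vote-bias : ∀ {m} u (ρ : Partial m) → 1 ℕ.≤ u → m ≡ 32 ℕ.* (u ℕ.* u) →
    u ℕ.* ∣ ∑ (validCompletions u ρ) (λ v → vote u (signSum v)) ∣ ℕ.≤ fixed ρ ℕ.* length (validCompletions u ρ)
  vote-bias {m} u ρ 1≤u m≡ with 16 ℕ.* (u ℕ.* u) ℕ.≤? free ρ
  ... | yes big = ℕₚ.*-cancelˡ-≤ 2 (begin
      2 ℕ.* (u ℕ.* ∣ ∑ (validCompletions u ρ) (λ v → vote u (signSum v)) ∣)
        ≡⟨ ℕₚ.*-assoc 2 u _ ⟨
      2 ℕ.* u ℕ.* ∣ ∑ (validCompletions u ρ) (λ v → vote u (signSum v)) ∣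
        ≡⟨ cong (λ z → 2 ℕ.* u ℕ.* ∣ z ∣) (∑-vote u ρ) ⟩
      2 ℕ.* u ℕ.* ∣ walk (free ρ) (vote u) (seen ρ) ∣
        ≤⟨ walk-vote-bound u 1≤u (free ρ) big (seen ρ) ⟩
      ∣ seen ρ ∣ ℕ.* 2 ℕ.^ free ρ
        ≤⟨ ℕₚ.*-mono-≤ (∣seen∣≤fixed ρ) (length-valid-≥ u ρ 1≤u big) ⟩
      fixed ρ ℕ.* (2 ℕ.* length (validCompletions u ρ))
        ≡⟨ e (fixed ρ) (length (validCompletions u ρ)) ⟩
      2 ℕ.* (fixed ρ ℕ.* length (validCompletions u ρ)) ∎)
    where
    open ℕₚ.≤-Reasoning
    e : ∀ a b → a ℕ.* (2 ℕ.* b) ≡ 2 ℕ.* (a ℕ.* b)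
    e = ℕR.solve-∀
  ... | no small = ℕₚ.*-mono-≤ u≤fixed (drop‿+≤+ (subst₂ _≤_ (cong (λ z → + ∣ z ∣) (sym (∑-vote u ρ))) (sym (length-valid u ρ))
      (∣walk-vote∣≤walk-decided u (free ρ) (seen ρ))))
    where
    open ℕₚ.≤-Reasoning
    Q = 16 ℕ.* (u ℕ.* u)
    e : ∀ u → 32 ℕ.* (u ℕ.* u) ≡ 16 ℕ.* (u ℕ.* u) ℕ.+ 16 ℕ.* (u ℕ.* u)
    e = ℕR.solve-∀
    u≤fixed : u ℕ.≤ fixed ρ
    u≤fixed = ℕₚ.+-cancelˡ-≤ Q _ _ (begin
      Q ℕ.+ u                ≤⟨ ℕₚ.+-monoʳ-≤ Q (ℕₚ.≤-trans (ℕₚ.m≤m*n u u {{ℕ.>-nonZero 1≤u}}) (ℕₚ.m≤n*m (u ℕ.* u) 16)) ⟩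
      Q ℕ.+ Q                ≡⟨ e u ⟨
      32 ℕ.* (u ℕ.* u)       ≡⟨ m≡ ⟨
      m                      ≡⟨ free+fixed ρ ⟨
      free ρ ℕ.+ fixed ρ     ≤⟨ ℕₚ.+-monoˡ-≤ (fixed ρ) (ℕₚ.<⇒≤ (ℕₚ.≰⇒> small)) ⟩
      Q ℕ.+ fixed ρ          ∎)

-- Decision trees on product distributions: a potential-function argument.

module Adversary where

  open import Data.Nat using (ℕ; zero; suc)
  import Data.Nat as ℕ
  import Data.Nat.Properties as ℕₚ
  open import Data.Bool using (Bool; true; false; if_then_else_; T)
  open import Data.Maybe using (Maybe; just; nothing; fromMaybe)
  open import Data.Fin using (Fin; zero; suc)
  open import Data.List using (List; filterᵇ)
  open import Data.List.Relation.Unary.All using (All)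
  import Data.List.Relation.Unary.All as All
  import Data.List.Relation.Unary.All.Properties as Allₚ
  open import Data.Vec using (Vec; _∷_; lookup; _[_]≔_)
  open import Data.Vec.Properties using (lookup∘updateAt; lookup∘updateAt′)
  import Data.Fin.Properties as Finₚ
  open import Data.Integer hiding (suc)
  open import Data.Integer.Properties
  open import Algebra.Properties.CommutativeMonoid.Sum ℕₚ.+-0-commutativeMonoid using () renaming (sum to sumℕ)
  open import Relation.Nullary using (yes; no)
  open import Relation.Binary.PropositionalEquality
  open import Data.Empty using (⊥-elim)
  open Sums
  open PartialAssignments

  assign : ∀ {m n} → Vec (Partial m) n → Fin n → ℕ → Bool → Vec (Partial m) n
  assign R i j b = R [ i ]≔ set (lookup R i) j b

  module _ {m : ℕ} (p : Vec Bool m → Bool) where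

    rowInputs : Partial m → List (Vec Bool m)
    rowInputs ρ = filterᵇ p (completions ρ)

    -- The inputs that remain at a node. Both the answers and the predicate `p` constrain each row
    -- separately, so the remaining set is still a product.
    inputs : ∀ {n} → Vec (Partial m) n → List (Vec (Vec Bool m) n)
    inputs {n} R = tuples n (λ i → rowInputs (lookup R i))

    rowInputs-split : ∀ ρ j F → known ρ j ≡ nothing →
      ∑ (rowInputs ρ) F ≡ ∑ (rowInputs (set ρ j true)) F + ∑ (rowInputs (set ρ j false)) F
    rowInputs-split ρ j F un = begin
      ∑ (rowInputs ρ) F
        ≡⟨ ∑-filterᵇ p (completions ρ) F ⟩
      ∑ (completions ρ) (λ v → if p v then F v else 0ℤ)
        ≡⟨ completions-split ρ j (λ v → if p v then F v else 0ℤ) un ⟩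
      ∑ (completions (set ρ j true)) (λ v → if p v then F v else 0ℤ) + ∑ (completions (set ρ j false)) (λ v → if p v then F v else 0ℤ)
        ≡⟨ cong₂ _+_ (∑-filterᵇ p (completions (set ρ j true)) F) (∑-filterᵇ p (completions (set ρ j false)) F) ⟨
      ∑ (rowInputs (set ρ j true)) F + ∑ (rowInputs (set ρ j false)) F ∎
      where open ≡-Reasoning

    inputs-split : ∀ {n} (R : Vec (Partial m) n) i j F → known (lookup R i) j ≡ nothing →
      ∑ (inputs R) F ≡ ∑ (inputs (assign R i j true)) F + ∑ (inputs (assign R i j false)) F
    inputs-split (ρ ∷ R) zero j F un = begin
      ∑ (inputs (ρ ∷ R)) F
        ≡⟨ ∑-tuples _ (λ i → rowInputs (lookup (ρ ∷ R) i)) F ⟩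
      ∑ (rowInputs ρ) (λ a → ∑ (inputs R) (λ w → F (a ∷ w)))
        ≡⟨ rowInputs-split ρ j _ un ⟩
      ∑ (rowInputs (set ρ j true)) (λ a → ∑ (inputs R) (λ w → F (a ∷ w))) + ∑ (rowInputs (set ρ j false)) (λ a → ∑ (inputs R) (λ w → F (a ∷ w)))
        ≡⟨ cong₂ _+_ (∑-tuples _ (λ i → rowInputs (lookup (set ρ j true ∷ R) i)) F) (∑-tuples _ (λ i → rowInputs (lookup (set ρ j false ∷ R) i)) F) ⟨
      ∑ (inputs (set ρ j true ∷ R)) F + ∑ (inputs (set ρ j false ∷ R)) F ∎
      where open ≡-Reasoning
    inputs-split (ρ ∷ R) (suc i) j F un = begin
      ∑ (inputs (ρ ∷ R)) F
        ≡⟨ ∑-tuples _ (λ i → rowInputs (lookup (ρ ∷ R) i)) F ⟩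
      ∑ (rowInputs ρ) (λ a → ∑ (inputs R) (λ w → F (a ∷ w)))
        ≡⟨ ∑-cong (rowInputs ρ) (λ a → inputs-split R i j (λ w → F (a ∷ w)) un) ⟩
      ∑ (rowInputs ρ) (λ a → ∑ (inputs (assign R i j true)) (λ w → F (a ∷ w)) + ∑ (inputs (assign R i j false)) (λ w → F (a ∷ w)))
        ≡⟨ ∑-+ (rowInputs ρ) (λ a → ∑ (inputs (assign R i j true)) (λ w → F (a ∷ w))) (λ a → ∑ (inputs (assign R i j false)) (λ w → F (a ∷ w))) ⟩
      ∑ (rowInputs ρ) (λ a → ∑ (inputs (assign R i j true)) (λ w → F (a ∷ w))) + ∑ (rowInputs ρ) (λ a → ∑ (inputs (assign R i j false)) (λ w → F (a ∷ w)))
        ≡⟨ cong₂ _+_ (∑-tuples _ (λ k → rowInputs (lookup (ρ ∷ assign R i j true) k)) F) (∑-tuples _ (λ k → rowInputs (lookup (ρ ∷ assign R i j false) k)) F) ⟨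
      ∑ (inputs (ρ ∷ assign R i j true)) F + ∑ (inputs (ρ ∷ assign R i j false)) F ∎
      where open ≡-Reasoning

    inputs-known : ∀ {n} (R : Vec (Partial m) n) i j {b} → known (lookup R i) j ≡ just b →
      All (λ V → at (lookup V i) j ≡ b) (inputs R)
    -- `tuples-All` wants a predicate for every row; the guard `k ≡ i` makes it vacuous away from
    -- the queried one.
    inputs-known {n} R i j {b} kn = All.map (λ h → h i refl)
      (tuples-All n (λ k → rowInputs (lookup R k)) {λ k v → k ≡ i → at v j ≡ b} row)
      where
      row : ∀ k → All (λ v → k ≡ i → at v j ≡ b) (rowInputs (lookup R k))
      row k with k Finₚ.≟ i
      ... | yes refl = All.map (λ e _ → e) (Allₚ.filter⁺ _ (completions-known (lookup R i) j kn))
      ... | no k≢i   = All.universal (λ _ k≡i → ⊥-elim (k≢i k≡i)) (rowInputs (lookup R k))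

    inputs-all : ∀ {n} (R : Vec (Partial m) n) → All (λ V → ∀ i → T (p (lookup V i))) (inputs R)
    inputs-all {n} R = tuples-All n (λ k → rowInputs (lookup R k)) (λ k → Allₚ.all-filter _ (completions (lookup R k)))

  queries : ∀ {m n} → Vec (Partial m) n → ℕ
  queries R = sumℕ (λ i → fixed (lookup R i))

  queries-assign : ∀ {m n} (R : Vec (Partial m) n) i j b → known (lookup R i) j ≡ nothing →
    queries (assign R i j b) ≡ suc (queries R)
  queries-assign (ρ ∷ R) zero    j b un = cong (ℕ._+ queries R) (fixed-set ρ j b un)
  queries-assign (ρ ∷ R) (suc i) j b un = trans (cong (fixed ρ ℕ.+_) (queries-assign R i j b un)) (ℕₚ.+-suc (fixed ρ) (queries R))

  run-query : ∀ {I S : Set} (t₀ t₁ : DT I S) {q x b} → x q ≡ b → run (query q t₀ t₁) x ≡ run (if b then t₁ else t₀) x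
  run-query t₀ t₁ {b = true}  e rewrite e = refl
  run-query t₀ t₁ {b = false} e rewrite e = refl

  cost-query : ∀ {I S : Set} (t₀ t₁ : DT I S) {q x b} → x q ≡ b → cost (query q t₀ t₁) x ≡ suc (cost (if b then t₁ else t₀) x)
  cost-query t₀ t₁ {b = true}  e rewrite e = refl
  cost-query t₀ t₁ {b = false} e rewrite e = refl

  -- One argument for three query models: one-bit rows for `f₀`, a single row for `g₀`, and `n`
  -- blocks for the composition. The column is a natural number, so an index may address padding
  -- beyond the `m` voting bits.
  module Game {m n : ℕ} {I S : Set} (p : Vec Bool m → Bool) (row : I → Fin n) (col : I → ℕ) where

    State : Set
    State = Vec (Partial m) n

    input : Vec (Vec Bool m) n → I → Bool
    input V q = at (lookup V (row q)) (col q)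

    knownAt : State → I → Maybe Bool
    knownAt R q = known (lookup R (row q)) (col q)

    answer : State → I → Bool → State
    answer R q b = assign R (row q) (col q) b

    Consistent : State → (I → Bool) → Set
    Consistent R x = ∀ q {b} → knownAt R q ≡ just b → x q ≡ b

    consistent-input : ∀ R → Consistent R (λ q → fromMaybe false (knownAt R q))
    consistent-input R q kn rewrite kn = refl

    knownAt-answer : ∀ R q b → knownAt R q ≡ nothing → knownAt (answer R q b) q ≡ just b
    knownAt-answer R q b un = trans (cong (λ ρ → known ρ (col q)) (lookup∘updateAt (row q) R)) (known-set (lookup R (row q)) (col q) b un)

    consistent-answer : ∀ R q b x → knownAt R q ≡ nothing → Consistent (answer R q b) x → Consistent R x
    consistent-answer R q b x un con q′ {c} kn = con q′ kept
      where
      kept : knownAt (answer R q b) q′ ≡ just c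
      kept with row q′ Finₚ.≟ row q
      ... | yes eq rewrite eq = trans (cong (λ ρ → known ρ (col q′)) (lookup∘updateAt (row q) R))
              (known-set-mono (lookup R (row q)) (col q) b (col q′) c un kn)
      ... | no neq = trans (cong (λ ρ → known ρ (col q′)) (lookup∘updateAt′ (row q′) (row q) neq R)) kn

    module _ (F : S → Vec (Vec Bool m) n → ℤ) (Ψ : ℕ → State → ℤ) (D : ℕ)
             (at-leaf : ∀ d R s → queries R ℕ.+ d ℕ.≤ D → ∑ (inputs p R) (F s) ≤ Ψ d R)
             (weaken  : ∀ d R → Ψ d R ≤ Ψ (suc d) R)
             (split   : ∀ d R q → knownAt R q ≡ nothing →
                        Ψ d (answer R q true) + Ψ d (answer R q false) ≤ Ψ (suc d) R) where

      -- The potential `Ψ d R` dominates the total payoff at a state with `d` queries left. A new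
      -- query splits the inputs in two and is paid by `split`; a repeated or padding query uses up
      -- budget without changing the state, which is `weaken`. The invariant with `D` limits how
      -- many bits can be fixed at a leaf. Cost is constrained only on inputs consistent with `R`,
      -- so the condition passes to subtrees.
      tree-bound : ∀ t d R → (∀ x → Consistent R x → cost t x ℕ.≤ d) → queries R ℕ.+ d ℕ.≤ D →
        ∑ (inputs p R) (λ V → F (run t (input V)) V) ≤ Ψ d R
      tree-bound (leaf s) d R cheap small = at-leaf d R s small
      -- Some input is consistent with every state, and on it a query node costs at least one.
      tree-bound (query q t₀ t₁) zero R cheap small with cheap _ (consistent-input R)
      ... | ()
      tree-bound (query q t₀ t₁) (suc d) R cheap small with knownAt R q in eq
      ... | just b = ≤-trans (≤-reflexive (∑-cong-All (All.map (λ {V} e → cong (λ s → F s V) (run-query t₀ t₁ e)) (inputs-known p R (row q) (col q) eq))))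
              (≤-trans (tree-bound (if b then t₁ else t₀) d R
                (λ x con → ℕ.s≤s⁻¹ (subst (ℕ._≤ suc d) (cost-query t₀ t₁ (con q eq)) (cheap x con)))
                (ℕₚ.≤-trans (ℕₚ.+-monoʳ-≤ (queries R) (ℕₚ.n≤1+n d)) small)) (weaken d R))
      ... | nothing = begin
          ∑ (inputs p R) (λ V → F (run (query q t₀ t₁) (input V)) V)
            ≡⟨ inputs-split p R (row q) (col q) _ eq ⟩
          ∑ (inputs p (answer R q true)) (λ V → F (run (query q t₀ t₁) (input V)) V) + ∑ (inputs p (answer R q false)) (λ V → F (run (query q t₀ t₁) (input V)) V)
            ≡⟨ cong₂ _+_ (∑-cong-All (All.map (λ {V} e → cong (λ s → F s V) (run-query t₀ t₁ e)) (inputs-known p (answer R q true) (row q) (col q) (knownAt-answer R q true eq))))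
                         (∑-cong-All (All.map (λ {V} e → cong (λ s → F s V) (run-query t₀ t₁ e)) (inputs-known p (answer R q false) (row q) (col q) (knownAt-answer R q false eq)))) ⟩
          ∑ (inputs p (answer R q true)) (λ V → F (run t₁ (input V)) V) + ∑ (inputs p (answer R q false)) (λ V → F (run t₀ (input V)) V)
            ≤⟨ +-mono-≤ (tree-bound t₁ d (answer R q true) (λ x con → cheap₁ x con) (small′ true))
                        (tree-bound t₀ d (answer R q false) (λ x con → cheap₀ x con) (small′ false)) ⟩
          Ψ d (answer R q true) + Ψ d (answer R q false)
            ≤⟨ split d R q eq ⟩
          Ψ (suc d) R ∎
        where
        open ≤-Reasoning
        cheap₁ : ∀ x → Consistent (answer R q true) x → cost t₁ x ℕ.≤ d
        cheap₁ x con = ℕ.s≤s⁻¹ (subst (ℕ._≤ suc d) (cost-query t₀ t₁ (con q (knownAt-answer R q true eq)))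
          (cheap x (consistent-answer R q true x eq con)))
        cheap₀ : ∀ x → Consistent (answer R q false) x → cost t₀ x ℕ.≤ d
        cheap₀ x con = ℕ.s≤s⁻¹ (subst (ℕ._≤ suc d) (cost-query t₀ t₁ (con q (knownAt-answer R q false eq)))
          (cheap x (consistent-answer R q false x eq con)))
        small′ : ∀ b → queries (answer R q b) ℕ.+ d ℕ.≤ D
        small′ b = subst (ℕ._≤ D) (trans (ℕₚ.+-suc (queries R) d) (cong (ℕ._+ d) (sym (queries-assign R (row q) (col q) b eq)))) small

-- Yao's principle, and uniform mixtures of decision trees.

module Averaging where

  open import Data.Nat using (ℕ; zero; suc; z≤n; s≤s)
  import Data.Nat as ℕ
  import Data.Nat.Properties as ℕₚ
  open import Data.Bool using (Bool; true; false; if_then_else_)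
  open import Data.List using (List; []; _∷_; map; length)
  open import Data.List.Relation.Unary.All using (All; []; _∷_)
  import Data.List.Relation.Unary.All as All
  open import Data.Product using (_,_; proj₁; proj₂)
  import Data.Product as Product
  open import Data.Rational
  open import Data.Rational.Properties
  open import Algebra.Bundles using (CommutativeRing)
  open import Algebra.Properties.Semiring.Mult (CommutativeRing.semiring +-*-commutativeRing) using (×-assocˡ; ×-assoc-*) renaming (_×_ to _·_)
  open import Algebra.Properties.CommutativeMonoid.Mult +-0-commutativeMonoid using (×-distrib-+)
  open import Algebra.Properties.CommutativeSemigroup (CommutativeRing.+-commutativeSemigroup +-*-commutativeRing) using (interchange)
  open import Data.Integer using (+<+; +≤+)
  open import Data.Empty using (⊥-elim)
  open import Relation.Binary.PropositionalEquality
  open Sums using (count)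

  ·-mono : ∀ n {p q} → p ≤ q → n · p ≤ n · q
  ·-mono zero    le = ≤-refl
  ·-mono (suc n) le = +-mono-≤ le (·-mono n le)

  ·-nonneg : ∀ n {p} → 0ℚ ≤ p → 0ℚ ≤ n · p
  ·-nonneg zero    0≤p = ≤-refl
  ·-nonneg (suc n) 0≤p = +-mono-≤ 0≤p (·-nonneg n 0≤p)

  ·-monoˡ : ∀ {m n p} → 0ℚ ≤ p → m ℕ.≤ n → m · p ≤ n · p
  ·-monoˡ {n = n} 0≤p z≤n     = ·-nonneg n 0≤p
  ·-monoˡ {p = p} 0≤p (s≤s le) = +-monoʳ-≤ p (·-monoˡ 0≤p le)

  ·-strict : ∀ n {p q} → p < q → suc n · p < suc n · q
  ·-strict n lt = +-mono-<-≤ lt (·-mono n (<⇒≤ lt))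

  ·-cancel : ∀ n {p q} → suc n · p ≤ suc n · q → p ≤ q
  ·-cancel n {p} {q} le = ≮⇒≥ (λ q<p → <-irrefl refl (<-≤-trans (·-strict n q<p) le))

  ·-comm : ∀ m n p → m · (n · p) ≡ n · (m · p)
  ·-comm m n p = trans (×-assocˡ p m n) (trans (cong (_· p) (ℕₚ.*-comm m n)) (sym (×-assocˡ p n m)))

  0<suc·1 : ∀ n → 0ℚ < suc n · 1ℚ
  0<suc·1 n = +-mono-<-≤ {0ℚ} {1ℚ} {0ℚ} {n · 1ℚ} (*<* (+<+ (s≤s z≤n))) (·-nonneg n {1ℚ} (*≤* (+≤+ z≤n)))

  ·1-reflects-≤ : ∀ m n → m · 1ℚ ≤ n · 1ℚ → m ℕ.≤ n
  ·1-reflects-≤ zero    n       le = z≤n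
  ·1-reflects-≤ (suc m) zero    le = ⊥-elim (<-irrefl refl (<-≤-trans (0<suc·1 m) le))
  ·1-reflects-≤ (suc m) (suc n) le = s≤s (·1-reflects-≤ m n (subst₂ _≤_ (cancel (m · 1ℚ)) (cancel (n · 1ℚ)) (+-monoʳ-≤ (- 1ℚ) {suc m · 1ℚ} {suc n · 1ℚ} le)))
    where
    cancel : ∀ x → - 1ℚ + (1ℚ + x) ≡ x
    cancel x = trans (sym (+-assoc (- 1ℚ) 1ℚ x)) (+-identityˡ x)

  private variable
    X : Set

  sumℚ : List X → (X → ℚ) → ℚ
  sumℚ []      f = 0ℚ
  sumℚ (x ∷ l) f = f x + sumℚ l f

  sumℚ-+ : ∀ (l : List X) f g → sumℚ l (λ x → f x + g x) ≡ sumℚ l f + sumℚ l g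
  sumℚ-+ []      f g = refl
  sumℚ-+ (x ∷ l) f g = trans (cong (λ z → f x + g x + z) (sumℚ-+ l f g)) (interchange (f x) (g x) (sumℚ l f) (sumℚ l g))

  sumℚ-if : ∀ (l : List X) c p → sumℚ l (λ x → if c x then p else 0ℚ) ≡ count c l · p
  sumℚ-if []      c p = refl
  sumℚ-if (x ∷ l) c p with c x
  ... | true  = cong (λ z → p + z) (sumℚ-if l c p)
  ... | false = trans (+-identityˡ _) (sumℚ-if l c p)

  sumℚ-≥ : ∀ (l : List X) {f q} → (∀ x → q ≤ f x) → length l · q ≤ sumℚ l f
  sumℚ-≥ []      le = ≤-refl
  sumℚ-≥ (x ∷ l) le = +-mono-≤ (le x) (sumℚ-≥ l le)

  module _ {I S X : Set} (h : Rel I S) (inp : X → I → Bool) (xs : List X) (c M : ℕ) where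

    successes : DT I S → ℕ
    successes t = count (λ x → h (inp x) (run t (inp x))) xs

    -- Exchanges the sum over inputs with the sum over trees: each tree contributes its weight times
    -- its number of successes.
    total-success : ∀ (A : RAlg I S) → All (λ pt → 0ℚ ≤ proj₁ pt) A → All (λ pt → c ℕ.* successes (proj₂ pt) ℕ.≤ M) A →
      c · sumℚ xs (λ x → successProb A h (inp x)) ≤ M · totalWeight A
    total-success [] nn few = ≤-trans (≤-reflexive (trans (cong (c ·_) (sumℚ-0 xs)) (·-zero c))) (·-nonneg M ≤-refl)
      where
      ·-zero : ∀ n → n · 0ℚ ≡ 0ℚ
      ·-zero zero    = refl
      ·-zero (suc n) = trans (+-identityˡ _) (·-zero n)
      sumℚ-0 : ∀ (l : List X) → sumℚ l (λ _ → 0ℚ) ≡ 0ℚ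
      sumℚ-0 []      = refl
      sumℚ-0 (x ∷ l) = trans (+-identityˡ _) (sumℚ-0 l)
    total-success ((p , t) ∷ A) (nn ∷ nns) (few ∷ fews) = begin
      c · sumℚ xs (λ x → (if h (inp x) (run t (inp x)) then p else 0ℚ) + successProb A h (inp x))
        ≡⟨ cong (c ·_) (trans (sumℚ-+ xs _ _) (cong (_+ rest) (sumℚ-if xs _ p))) ⟩
      c · (successes t · p + rest)
        ≡⟨ ×-distrib-+ (successes t · p) rest c ⟩
      c · (successes t · p) + c · rest
        ≡⟨ cong (_+ c · rest) (×-assocˡ p c (successes t)) ⟩
      (c ℕ.* successes t) · p + c · rest
        ≤⟨ +-mono-≤ (·-monoˡ nn few) (total-success A nns fews) ⟩
      M · p + M · totalWeight A
        ≡⟨ ×-distrib-+ p (totalWeight A) M ⟨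
      M · (p + totalWeight A) ∎
      where
      open ≤-Reasoning
      rest = sumℚ xs (λ x → successProb A h (inp x))

    -- Yao's principle; the bounds c · successes ≤ M and b · (1 - ε) = a keep fractions integral.
    averaging : ∀ ε a b (A : RAlg I S) → b · (1ℚ - ε) ≡ a · 1ℚ → IsRAlg A → ComputesWithError ε h A →
      All (λ pt → c ℕ.* successes (proj₂ pt) ℕ.≤ M) A → c ℕ.* length xs ℕ.* a ℕ.≤ b ℕ.* M
    averaging ε a b A ratio isA good few = ·1-reflects-≤ _ _ (begin
      (c ℕ.* length xs ℕ.* a) · 1ℚ         ≡⟨ ×-assocˡ 1ℚ (c ℕ.* length xs) a ⟨
      (c ℕ.* length xs) · (a · 1ℚ)         ≡⟨ cong ((c ℕ.* length xs) ·_) ratio ⟨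
      (c ℕ.* length xs) · (b · (1ℚ - ε))   ≡⟨ ·-comm (c ℕ.* length xs) b (1ℚ - ε) ⟩
      b · ((c ℕ.* length xs) · (1ℚ - ε))   ≡⟨ cong (b ·_) (×-assocˡ (1ℚ - ε) c (length xs)) ⟨
      b · (c · (length xs · (1ℚ - ε)))     ≤⟨ ·-mono b (≤-trans (·-mono c (sumℚ-≥ xs (λ x → good (inp x)))) (total-success A (IsRAlg.nonneg isA) few)) ⟩
      b · (M · totalWeight A)         ≡⟨ cong (λ z → b · (M · z)) (IsRAlg.sums1 isA) ⟩
      b · (M · 1ℚ)                    ≡⟨ ×-assocˡ 1ℚ b M ⟩
      (b ℕ.* M) · 1ℚ                  ∎)
      where open ≤-Reasoning

  -- Splitting off a first tree guarantees that the number of trees is nonzero, so the common weight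
  -- `1/N` exists.
  module Uniform {I S : Set} (t : DT I S) (ts : List (DT I S)) where

    private
      l = t ∷ ts
      N = length l

    N·1-positive : Positive (N · 1ℚ)
    N·1-positive = positive (0<suc·1 (length ts))

    instance
      _ : Positive (N · 1ℚ)
      _ = N·1-positive
      N·1-nonZero : NonZero (N · 1ℚ)
      N·1-nonZero = pos⇒nonZero (N · 1ℚ)

    weight : ℚ
    weight = 1/ (N · 1ℚ)

    weight≥0 : 0ℚ ≤ weight
    weight≥0 = <⇒≤ (positive⁻¹ weight {{1/pos⇒pos (N · 1ℚ)}})

    N·weight : N · weight ≡ 1ℚ
    N·weight = trans (cong (N ·_) (sym (*-identityˡ weight)))
      (trans (sym (×-assoc-* N 1ℚ weight)) (*-inverseʳ (N · 1ℚ)))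

    uniform : RAlg I S
    uniform = map (weight ,_) l

    private
      total : ∀ (k : List (DT I S)) → totalWeight (map (weight ,_) k) ≡ length k · weight
      total []      = refl
      total (_ ∷ k) = cong (weight +_) (total k)

      nonneg : ∀ (k : List (DT I S)) → All (λ (pt : ℚ Product.× DT I S) → 0ℚ ≤ proj₁ pt) (map (weight ,_) k)
      nonneg []      = []
      nonneg (_ ∷ k) = weight≥0 ∷ nonneg k

      success : ∀ (h : Rel I S) x k → successProb (map (weight ,_) k) h x ≡ count (λ s → h x (run s x)) k · weight
      success h x []      = refl
      success h x (s ∷ k) with h x (run s x)
      ... | true  = cong (weight +_) (success h x k)
      ... | false = trans (+-identityˡ _) (success h x k)

    uniform-isRAlg : IsRAlg uniform
    uniform-isRAlg = record { nonneg = nonneg l ; sums1 = trans (total l) N·weight }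

    uniform-cost : ∀ q → All (λ s → ∀ x → cost s x ℕ.≤ q) l → CostAtMost uniform q
    uniform-cost q = go l
      where
      go : ∀ (k : List (DT I S)) → All (λ s → ∀ x → cost s x ℕ.≤ q) k → CostAtMost (map (weight ,_) k) q
      go []      []       = []
      go (_ ∷ k) (c ∷ cs) = c ∷ go k cs

    uniform-computes : ∀ ε a b h → suc b · (1ℚ - ε) ≡ a · 1ℚ →
      (∀ x → a ℕ.* N ℕ.≤ suc b ℕ.* count (λ s → h x (run s x)) l) → ComputesWithError ε h uniform
    uniform-computes ε a b h ratio many x = ·-cancel b (begin
      suc b · (1ℚ - ε)                              ≡⟨ ratio ⟩
      a · 1ℚ                                        ≡⟨ cong (a ·_) N·weight ⟨
      a · (N · weight)                              ≡⟨ ×-assocˡ weight a N ⟩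
      (a ℕ.* N) · weight                            ≤⟨ ·-monoˡ weight≥0 (many x) ⟩
      (suc b ℕ.* count (λ s → h x (run s x)) l) · weight ≡⟨ ×-assocˡ weight (suc b) (count (λ s → h x (run s x)) l) ⟨
      suc b · (count (λ s → h x (run s x)) l · weight)   ≡⟨ cong (suc b ·_) (success h x l) ⟨
      suc b · successProb uniform h x ∎)
      where open ≤-Reasoning

-- The relation, the partial function and their composition.

module Functions where

  open import Data.Nat using (ℕ; zero; suc; z≤n; s≤s)
  import Data.Nat as ℕ
  open import Data.Bool using (Bool; true; false)
  open import Data.Maybe using (Maybe; just; nothing)
  open import Data.Fin using (Fin; zero; suc; toℕ)
  open import Data.List using (List; []; _∷_; map; length)
  open import Data.List.Properties using (length-map)
  open import Data.Vec using (Vec; []; _∷_)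
  open import Data.Product using (Σ; _×_; _,_)
  open import Data.Integer hiding (suc)
  open import Data.Integer.Properties
  open import Algebra.Properties.CommutativeMonoid.Sum +-0-commutativeMonoid using () renaming (sum to sumℤ)
  open import Relation.Nullary using (does; yes; no)
  open import Relation.Binary.PropositionalEquality
  open Threshold
  open Sums
  open PartialAssignments

  -- Agreements minus disagreements, so a threshold `T` asks for at least `n/2 + T/2` agreeing
  -- positions.
  agreement : ∀ {n} → (Fin n → Bool) → (Fin n → Bool) → ℤ
  agreement x s = sumℤ (λ i → σ (s i) * σ (x i))

  agreementRel : ∀ n → ℕ → Rel (Fin n) (Fin n → Bool)
  agreementRel n T x s = does (+ T ≤? agreement x s)

  -- Truncation at `n` makes `gapMajority` total in all its parameters; bits from position `m` on
  -- are padding.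
  initial : ∀ n → ℕ → List (Fin n)
  initial zero    _       = []
  initial (suc n) zero    = []
  initial (suc n) (suc m) = zero ∷ map suc (initial n m)

  gapMajority : ∀ n → ℕ → ℕ → PartialFn n
  gapMajority n m u x = decide u (∑ (initial n m) (λ j → σ (x j)))

  agreementRel-sound : ∀ {n} T x s → agreementRel n T x s ≡ true → + T ≤ agreement x s
  agreementRel-sound T x s eq with + T ≤? agreement x s
  agreementRel-sound T x s eq | yes le = le
  agreementRel-sound T x s () | no _

  agreementRel-fails : ∀ {n} T x s → agreementRel n T x s ≡ false → agreement x s < + T
  agreementRel-fails T x s eq with + T ≤? agreement x s
  agreementRel-fails T x s () | yes _
  agreementRel-fails T x s eq | no ≰  = ≰⇒> ≰

  length-initial : ∀ {n m} → m ℕ.≤ n → length (initial n m) ≡ m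
  length-initial {zero}  z≤n      = refl
  length-initial {suc n} z≤n      = refl
  length-initial {suc n} (s≤s le) = cong suc (trans (length-map suc (initial n _)) (length-initial le))

  ∑-initial-at : ∀ {n m} → m ℕ.≤ n → (v : Vec Bool m) → ∑ (initial n m) (λ j → σ (at v (toℕ j))) ≡ signSum v
  ∑-initial-at {zero}  z≤n      []      = refl
  ∑-initial-at {suc n} z≤n      []      = refl
  ∑-initial-at {suc n} (s≤s le) (b ∷ v) = cong (λ z → σ b + z)
    (trans (∑-map suc (initial n _) (λ j → σ (at (b ∷ v) (toℕ j)))) (∑-initial-at le v))

  -- `allJust` rebuilds its result by cases on the index, so the function it returns is only
  -- pointwise equal to `w`; that is enough for a sum such as `agreement`.
  allJust-just : ∀ n {v : Fin n → Maybe Bool} (w : Fin n → Bool) → (∀ i → v i ≡ just (w i)) →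
    Σ (Fin n → Bool) λ y → allJust n v ≡ just y × (∀ i → y i ≡ w i)
  allJust-just zero    w eq = _ , refl , λ ()
  allJust-just (suc n) {v} w eq with v zero | eq zero | allJust n (λ i → v (suc i)) | allJust-just n (λ i → w (suc i)) (λ i → eq (suc i))
  ... | .(just (w zero)) | refl | .(just y) | y , refl , same = _ , refl , λ { zero → refl ; (suc i) → same i }

  allJust-inv : ∀ n {v : Fin n → Maybe Bool} {y} → allJust n v ≡ just y → ∀ i → v i ≡ just (y i)
  allJust-inv (suc n) {v} eq i with v zero in eq₀ | allJust n (λ j → v (suc j)) in eq₁
  allJust-inv (suc n) refl zero    | just b | just w = eq₀
  allJust-inv (suc n) refl (suc i) | just b | just w = allJust-inv n eq₁ i

  compose-just : ∀ {n m} {S : Set} (f : Rel (Fin n) S) (g : PartialFn m) x s {y} →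
    allJust n (λ i → g (λ j → x (i , j))) ≡ just y → compose f g x s ≡ f y s
  compose-just {n} f g x s eq with allJust n (λ i → g (λ j → x (i , j)))
  compose-just f g x s refl | just y = refl

  compose-nothing : ∀ {n m} {S : Set} (f : Rel (Fin n) S) (g : PartialFn m) x s →
    allJust n (λ i → g (λ j → x (i , j))) ≡ nothing → compose f g x s ≡ true
  compose-nothing {n} f g x s eq with allJust n (λ i → g (λ j → x (i , j)))
  compose-nothing f g x s refl | nothing = refl

-- Success counts of deterministic trees.

module TreeBounds where

  open import Data.Nat using (ℕ; zero; suc; z≤n)
  import Data.Nat as ℕ
  import Data.Nat.Properties as ℕₚ
  import Data.Nat.Tactic.RingSolver as ℕR
  open import Data.Bool using (Bool; true; false; T)
  open import Data.Maybe using (just; nothing)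
  open import Data.Fin using (Fin; zero; suc; toℕ)
  open import Data.List using (List; []; _∷_; map; length)
  open import Data.List.Relation.Unary.All using (All; []; _∷_)
  import Data.List.Relation.Unary.All as All
  open import Data.Vec using (Vec; []; _∷_; lookup; replicate)
  open import Data.Product using (proj₂)
  open import Data.Integer hiding (suc)
  open import Data.Integer.Properties
  open import Data.Integer.Tactic.RingSolver
  open import Algebra.Properties.CommutativeMonoid.Sum +-0-commutativeMonoid using () renaming (sum to sumℤ)
  open import Algebra.Bundles using (CommutativeRing)
  open import Algebra.Properties.Semiring.Sum (CommutativeRing.semiring +-*-commutativeRing) using (*-distribˡ-sum)
  open import Relation.Binary.PropositionalEquality
  open Walk
  open Threshold
  open Sums
  open PartialAssignments
  open Adversary
  open Averaging
  open Functions

  blank : ∀ n m → Vec (Partial m) n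
  blank n m = replicate n (replicate m nothing)

  fixed-blank : ∀ m → fixed (replicate m nothing) ≡ 0
  fixed-blank zero    = refl
  fixed-blank (suc m) = fixed-blank m

  queries-blank : ∀ n m → queries (blank n m) ≡ 0
  queries-blank zero    m = refl
  queries-blank (suc n) m = cong₂ ℕ._+_ (fixed-blank m) (queries-blank n m)

  σ²≡1 : ∀ b → σ b * σ b ≡ 1ℤ
  σ²≡1 true  = refl
  σ²≡1 false = refl

  vote²≤1 : ∀ u s → vote u s * vote u s ≤ 1ℤ
  vote²≤1 u s with decide u s
  ... | just true  = ≤-refl
  ... | just false = ≤-refl
  ... | nothing    = +≤+ z≤n

  -- The hypothesis `bias` isolates what is used of a block: knowing `q` of its bits biases its sign
  -- by at most `q / u`. One-bit blocks satisfy it with `u = 1`, which covers `f₀` by the same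
  -- argument.
  module ProductLower
    (u m : ℕ)
    (bias : ∀ (ρ : Partial m) → u ℕ.* ∣ ∑ (validCompletions u ρ) (λ v → vote u (signSum v)) ∣ ℕ.≤ fixed ρ ℕ.* length (validCompletions u ρ))
    {n : ℕ} {I : Set} (row : I → Fin n) (col : I → ℕ) (h : Rel I (Fin n → Bool)) (θ : ℕ) where

    open Game {m} {n} {I} {Fin n → Bool} (valid u) row col

    X : List (Vec (Vec Bool m) n)
    X = inputs (valid u) (blank n m)

    -- Agreement with the block signs, multiplied by `u` so that the bound on the mean of a row
    -- becomes the integer `fixed`.
    score : (Fin n → Bool) → Vec (Vec Bool m) n → ℤ
    score s = dot (λ i v → + u * (σ (s i) * vote u (signSum v)))

    module _ (sound : ∀ V s → (∀ i → T (valid u (lookup V i))) → h (input V) s ≡ true →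
                + θ ≤ sumℤ (λ i → σ (s i) * vote u (signSum (lookup V i)))) where

      private
        K = u ℕ.* θ ℕ.* (u ℕ.* θ)

      score-large : ∀ V s → (∀ i → T (valid u (lookup V i))) → h (input V) s ≡ true → + K ≤ score s V * score s V
      score-large V s ok succ = begin
        + K                              ≡⟨ pos-* (u ℕ.* θ) (u ℕ.* θ) ⟩
        + (u ℕ.* θ) * + (u ℕ.* θ)        ≤⟨ *-mono-≤-nonNeg (+≤+ z≤n) (+≤+ z≤n) large large ⟩
        score s V * score s V            ∎
        where
        open ≤-Reasoning
        large : + (u ℕ.* θ) ≤ score s V
        large = begin
          + (u ℕ.* θ)      ≡⟨ pos-* u θ ⟩
          + u * + θ        ≤⟨ *-monoˡ-≤-nonNeg (+ u) (sound V s ok succ) ⟩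
          + u * sumℤ (λ i → σ (s i) * vote u (signSum (lookup V i)))
            ≡⟨ *-distribˡ-sum (+ u) (λ i → σ (s i) * vote u (signSum (lookup V i))) ⟩
          score s V        ∎

      first-moment : ∀ (ρ : Partial m) b →
        ∣ ∑ (validCompletions u ρ) (λ v → + u * (σ b * vote u (signSum v))) ∣ ℕ.≤ fixed ρ ℕ.* length (validCompletions u ρ)
      first-moment ρ b = subst (ℕ._≤ fixed ρ ℕ.* length (validCompletions u ρ)) (sym (begin
        ∣ ∑ (validCompletions u ρ) (λ v → + u * (σ b * vote u (signSum v))) ∣
          ≡⟨ cong ∣_∣ (trans (∑-*ˡ (validCompletions u ρ) (+ u) (λ v → σ b * vote u (signSum v)))
               (cong (+ u *_) (∑-*ˡ (validCompletions u ρ) (σ b) (λ v → vote u (signSum v))))) ⟩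
        ∣ + u * (σ b * total) ∣        ≡⟨ abs-* (+ u) (σ b * total) ⟩
        u ℕ.* ∣ σ b * total ∣          ≡⟨ cong (u ℕ.*_) (trans (abs-* (σ b) total) (trans (cong (ℕ._* ∣ total ∣) (∣σ∣ b)) (ℕₚ.*-identityˡ ∣ total ∣))) ⟩
        u ℕ.* ∣ total ∣                ∎)) (bias ρ)
        where
        open ≡-Reasoning
        total = ∑ (validCompletions u ρ) (λ v → vote u (signSum v))

      square-≤ : ∀ b w → w * w ≤ 1ℤ → (+ u * (σ b * w)) * (+ u * (σ b * w)) ≤ + (u ℕ.* u)
      square-≤ b w w²≤1 = begin
        (+ u * (σ b * w)) * (+ u * (σ b * w))    ≡⟨ e (+ u) (σ b) w ⟩
        (+ u * + u) * ((σ b * σ b) * (w * w))    ≡⟨ cong₂ _*_ (sym (pos-* u u)) (trans (cong (_* (w * w)) (σ²≡1 b)) (*-identityˡ (w * w))) ⟩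
        + (u ℕ.* u) * (w * w)                    ≤⟨ *-monoˡ-≤-nonNeg (+ (u ℕ.* u)) w²≤1 ⟩
        + (u ℕ.* u) * 1ℤ                         ≡⟨ *-identityʳ (+ (u ℕ.* u)) ⟩
        + (u ℕ.* u)                              ∎
        where
        open ≤-Reasoning
        e : ∀ u b w → (u * (b * w)) * (u * (b * w)) ≡ (u * u) * ((b * b) * (w * w))
        e = solve-∀

      second-moment : ∀ (ρ : Partial m) b →
        ∑ (validCompletions u ρ) (λ v → (+ u * (σ b * vote u (signSum v))) * (+ u * (σ b * vote u (signSum v))))
        ≤ + (u ℕ.* u ℕ.* length (validCompletions u ρ))
      second-moment ρ b = begin
        ∑ L (λ v → (+ u * (σ b * vote u (signSum v))) * (+ u * (σ b * vote u (signSum v))))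
          ≤⟨ ∑-mono (All.universal (λ v → square-≤ b (vote u (signSum v)) (vote²≤1 u (signSum v))) L) ⟩
        ∑ L (λ _ → + (u ℕ.* u))          ≡⟨ ∑-const L (+ (u ℕ.* u)) ⟩
        + length L * + (u ℕ.* u)         ≡⟨ *-comm (+ length L) (+ (u ℕ.* u)) ⟩
        + (u ℕ.* u) * + length L         ≡⟨ pos-* (u ℕ.* u) (length L) ⟨
        + (u ℕ.* u ℕ.* length L)         ∎
        where
        open ≤-Reasoning
        L = validCompletions u ρ

      -- At a leaf the output is constant and the rows are independent, so `moments` bounds the mean
      -- square of the score by `queries² + n u²`. A success forces this square to be at least
      -- `K = (u θ)²`, and Markov's inequality finishes.
      few-successes : ∀ t D → (∀ x → cost t x ℕ.≤ D) →
        K ℕ.* count (λ V → h (input V) (run t (input V))) X ℕ.≤ (D ℕ.* D ℕ.+ n ℕ.* (u ℕ.* u)) ℕ.* length X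
      few-successes t D cheap = drop‿+≤+ (begin
        + (K ℕ.* count good X)             ≡⟨ pos-* K (count good X) ⟩
        + K * + count good X               ≡⟨ cong (+ K *_) (∑-𝟙 good X) ⟨
        + K * ∑ X (λ V → 𝟙 (good V))       ≡⟨ ∑-*ˡ X (+ K) (λ V → 𝟙 (good V)) ⟨
        ∑ X (λ V → + K * 𝟙 (good V))
          ≤⟨ tree-bound (λ s V → + K * 𝟙 (h (input V) s)) Ψ D at-leaf (λ d R → ≤-refl) split t D (blank n m)
               (λ x _ → cheap x) (ℕₚ.≤-reflexive (cong (ℕ._+ D) (queries-blank n m))) ⟩
        + (B ℕ.* length X)                 ∎)
        where
        open ≤-Reasoning
        good : Vec (Vec Bool m) n → Bool
        good V = h (input V) (run t (input V))
        B = D ℕ.* D ℕ.+ n ℕ.* (u ℕ.* u)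
        -- The same constant `B` serves every leaf with at most `D` queries, and the number of
        -- remaining inputs is exactly additive, so the budget need not enter the potential.
        Ψ : ℕ → State → ℤ
        Ψ d R = + (B ℕ.* length (inputs (valid u) R))
        at-leaf : ∀ d R s → queries R ℕ.+ d ℕ.≤ D → ∑ (inputs (valid u) R) (λ V → + K * 𝟙 (h (input V) s)) ≤ Ψ d R
        at-leaf d R s small = begin
          ∑ Y (λ V → + K * 𝟙 (h (input V) s))      ≡⟨ ∑-*ˡ Y (+ K) (λ V → 𝟙 (h (input V) s)) ⟩
          + K * ∑ Y (λ V → 𝟙 (h (input V) s))      ≡⟨ cong (+ K *_) (∑-𝟙 (λ V → h (input V) s) Y) ⟩
          + K * + count (λ V → h (input V) s) Y
            ≤⟨ markov Y (λ V → h (input V) s) (score s) (+ K) (All.map (λ {V} → score-large V s) (inputs-all (valid u) R)) ⟩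
          ∑ Y (λ V → score s V * score s V)
            ≤⟨ proj₂ (SecondMoment.moments (u ℕ.* u) n (λ i → validCompletions u (lookup R i)) (λ i v → + u * (σ (s i) * vote u (signSum v)))
                 (λ i → fixed (lookup R i)) (λ i → first-moment (lookup R i) (s i)) (λ i → second-moment (lookup R i) (s i))) ⟩
          + ((queries R ℕ.* queries R ℕ.+ n ℕ.* (u ℕ.* u)) ℕ.* length Y)
            ≤⟨ +≤+ (ℕₚ.*-monoˡ-≤ (length Y) (ℕₚ.+-monoˡ-≤ (n ℕ.* (u ℕ.* u)) (ℕₚ.*-mono-≤ q≤D q≤D))) ⟩
          + (B ℕ.* length Y) ∎
          where
          Y = inputs (valid u) R
          q≤D : queries R ℕ.≤ D
          q≤D = ℕₚ.≤-trans (ℕₚ.m≤m+n (queries R) d) small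
        split : ∀ d R q → knownAt R q ≡ nothing → Ψ d (answer R q true) + Ψ d (answer R q false) ≤ Ψ (suc d) R
        split d R q un = ≤-reflexive (begin-equality
          + (B ℕ.* a) + + (B ℕ.* b)      ≡⟨ cong +_ (ℕₚ.*-distribˡ-+ B a b) ⟨
          + (B ℕ.* (a ℕ.+ b))            ≡⟨ cong (λ z → + (B ℕ.* z)) (+-injective (begin-equality
            + a + + b                                        ≡⟨ cong₂ _+_ (∑-1 (inputs (valid u) (answer R q true))) (∑-1 (inputs (valid u) (answer R q false))) ⟨
            ∑ (inputs (valid u) (answer R q true)) (λ _ → 1ℤ) + ∑ (inputs (valid u) (answer R q false)) (λ _ → 1ℤ)
              ≡⟨ inputs-split (valid u) R (row q) (col q) (λ _ → 1ℤ) un ⟨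
            ∑ (inputs (valid u) R) (λ _ → 1ℤ)                ≡⟨ ∑-1 (inputs (valid u) R) ⟩
            + length (inputs (valid u) R)                    ∎)) ⟩
          + (B ℕ.* length (inputs (valid u) R)) ∎)
          where
          a = length (inputs (valid u) (answer R q true))
          b = length (inputs (valid u) (answer R q false))

  free-blank : ∀ m → free (replicate m nothing) ≡ m
  free-blank zero    = refl
  free-blank (suc m) = cong suc (free-blank m)

  seen-blank : ∀ m → seen (replicate m nothing) ≡ 0ℤ
  seen-blank zero    = refl
  seen-blank (suc m) = seen-blank m

  asRel-just : ∀ {n} (g : PartialFn n) x s {c} → g x ≡ just c → σ s * σ c ≡ + 2 * 𝟙 (asRel g x s) - 1ℤ
  asRel-just g x s eq with g x
  asRel-just g x true  refl | just true  = refl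
  asRel-just g x false refl | just true  = refl
  asRel-just g x true  refl | just false = refl
  asRel-just g x false refl | just false = refl

  module GapMajorityLower (u : ℕ) (1≤u : 1 ℕ.≤ u) (n : ℕ) (m≤n : 32 ℕ.* (u ℕ.* u) ℕ.≤ n) where

    private
      m  = 32 ℕ.* (u ℕ.* u)
      u² = u ℕ.* u

    open Game {m} {1} {Fin n} {Bool} (valid u) (λ _ → zero) toℕ

    g : PartialFn n
    g = gapMajority n m u

    Y : List (Vec (Vec Bool m) 1)
    Y = inputs (valid u) (blank 1 m)

    gain : Bool → Vec (Vec Bool m) 1 → ℤ
    gain s V = σ s * vote u (signSum (lookup V zero))

    -- A new bit replaces `s²` by `(s ± 1)²`, whose average is `s² + 1`, so the term in `d` pays
    -- exactly for the remaining growth. At a leaf `16 s² + u²` dominates the drift, which is linear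
    -- in `s`. The power of two counts all completions; invalid ones have vote zero.
    Ψ : ℕ → State → ℤ
    Ψ d (ρ ∷ []) = + (2 ℕ.^ free ρ) * (+ 16 * (seen ρ * seen ρ) + + u² + + 16 * + d)

    half : m ≡ 16 ℕ.* u² ℕ.+ 16 ℕ.* u²
    half = e u
      where
      e : ∀ u → 32 ℕ.* (u ℕ.* u) ≡ 16 ℕ.* (u ℕ.* u) ℕ.+ 16 ℕ.* (u ℕ.* u)
      e = ℕR.solve-∀

    -- Trades the linear drift |s| for s², whose mean is the number of queries.
    am-gm : ∀ (u s : ℕ) → 8 ℕ.* u ℕ.* s ℕ.≤ 16 ℕ.* (s ℕ.* s) ℕ.+ u ℕ.* u
    am-gm u s = drop‿+≤+ (begin
      + (8 ℕ.* u ℕ.* s)                                        ≡⟨ trans (pos-* (8 ℕ.* u) s) (cong (_* + s) (pos-* 8 u)) ⟩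
      + 8 * + u * + s                                          ≤⟨ i≤i+j (+ 8 * + u * + s) _ {{nonNegative (sq≥0 (+ 4 * + s - + u))}} ⟩
      + 8 * + u * + s + (+ 4 * + s - + u) * (+ 4 * + s - + u)  ≡⟨ e (+ u) (+ s) ⟩
      + 16 * (+ s * + s) + + u * + u                           ≡⟨ cong₂ _+_ (trans (cong (+ 16 *_) (sym (pos-* s s))) (sym (pos-* 16 (s ℕ.* s)))) (sym (pos-* u u)) ⟩
      + (16 ℕ.* (s ℕ.* s) ℕ.+ u ℕ.* u)                         ∎)
      where
      open ≤-Reasoning
      e : ∀ u s → + 8 * u * s + (+ 4 * s - u) * (+ 4 * s - u) ≡ + 16 * (s * s) + u * u
      e = solve-∀

    at-leaf : ∀ d R s → queries R ℕ.+ d ℕ.≤ 16 ℕ.* u² → ∑ (inputs (valid u) R) (λ V → + (16 ℕ.* u²) * gain s V) ≤ Ψ d R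
    at-leaf d (ρ ∷ []) s small = begin
      ∑ (inputs (valid u) (ρ ∷ [])) (λ V → + (16 ℕ.* u²) * gain s V)
        ≡⟨ ∑-*ˡ (inputs (valid u) (ρ ∷ [])) (+ (16 ℕ.* u²)) (gain s) ⟩
      + (16 ℕ.* u²) * ∑ (inputs (valid u) (ρ ∷ [])) (gain s)
        ≡⟨ cong (+ (16 ℕ.* u²) *_) (trans (∑-tuples 0 (λ i → validCompletions u (lookup (ρ ∷ []) i)) (gain s))
             (∑-cong (validCompletions u ρ) (λ v → +-identityʳ (σ s * vote u (signSum v))))) ⟩
      + (16 ℕ.* u²) * ∑ (validCompletions u ρ) (λ v → σ s * vote u (signSum v))
        ≡⟨ cong (+ (16 ℕ.* u²) *_) (trans (∑-*ˡ (validCompletions u ρ) (σ s) (λ v → vote u (signSum v))) (cong (σ s *_) (∑-vote u ρ))) ⟩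
      + (16 ℕ.* u²) * (σ s * W)
        ≤⟨ *-monoˡ-≤-nonNeg (+ (16 ℕ.* u²)) (i≤∣i∣ (σ s * W)) ⟩
      + (16 ℕ.* u²) * + ∣ σ s * W ∣
        ≡⟨ cong (λ z → + (16 ℕ.* u²) * + z) (trans (abs-* (σ s) W) (trans (cong (ℕ._* ∣ W ∣) (∣σ∣ s)) (ℕₚ.*-identityˡ ∣ W ∣))) ⟩
      + (16 ℕ.* u²) * + ∣ W ∣
        ≡⟨ trans (sym (pos-* (16 ℕ.* u²) ∣ W ∣)) (cong +_ (e₁ u ∣ W ∣)) ⟩
      + (8 ℕ.* u ℕ.* (2 ℕ.* u ℕ.* ∣ W ∣))
        ≤⟨ +≤+ (ℕₚ.*-monoʳ-≤ (8 ℕ.* u) (walk-vote-bound u 1≤u (free ρ) big (seen ρ))) ⟩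
      + (8 ℕ.* u ℕ.* (∣ seen ρ ∣ ℕ.* 2 ℕ.^ free ρ))
        ≡⟨ cong +_ (sym (ℕₚ.*-assoc (8 ℕ.* u) ∣ seen ρ ∣ (2 ℕ.^ free ρ))) ⟩
      + (8 ℕ.* u ℕ.* ∣ seen ρ ∣ ℕ.* 2 ℕ.^ free ρ)
        ≤⟨ +≤+ (ℕₚ.*-monoˡ-≤ (2 ℕ.^ free ρ) (ℕₚ.≤-trans (am-gm u ∣ seen ρ ∣) (ℕₚ.m≤m+n _ (16 ℕ.* d)))) ⟩
      + ((16 ℕ.* (∣ seen ρ ∣ ℕ.* ∣ seen ρ ∣) ℕ.+ u² ℕ.+ 16 ℕ.* d) ℕ.* 2 ℕ.^ free ρ)
        ≡⟨ trans (pos-* (16 ℕ.* (∣ seen ρ ∣ ℕ.* ∣ seen ρ ∣) ℕ.+ u² ℕ.+ 16 ℕ.* d) (2 ℕ.^ free ρ)) (*-comm _ (+ (2 ℕ.^ free ρ))) ⟩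
      + (2 ℕ.^ free ρ) * (+ (16 ℕ.* (∣ seen ρ ∣ ℕ.* ∣ seen ρ ∣)) + + u² + + (16 ℕ.* d))
        ≡⟨ cong (+ (2 ℕ.^ free ρ) *_) (cong₂ (λ a b → a + + u² + b)
             (trans (pos-* 16 (∣ seen ρ ∣ ℕ.* ∣ seen ρ ∣)) (cong (+ 16 *_) (sym (sq≡ (seen ρ))))) (pos-* 16 d)) ⟩
      Ψ d (ρ ∷ []) ∎
      where
      open ≤-Reasoning
      W = walk (free ρ) (vote u) (seen ρ)
      e₁ : ∀ u w → 16 ℕ.* (u ℕ.* u) ℕ.* w ≡ 8 ℕ.* u ℕ.* (2 ℕ.* u ℕ.* w)
      e₁ = ℕR.solve-∀
      few : fixed ρ ℕ.≤ 16 ℕ.* u²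
      few = ℕₚ.≤-trans (ℕₚ.m≤m+n (fixed ρ) 0) (ℕₚ.≤-trans (ℕₚ.m≤m+n (fixed ρ ℕ.+ 0) d) small)
      -- At most half of the `32u²` bits are fixed, which leaves enough free steps for
      -- `walk-vote-bound`.
      big : 16 ℕ.* u² ℕ.≤ free ρ
      big = ℕₚ.+-cancelʳ-≤ (16 ℕ.* u²) _ _ (ℕₚ.≤-trans (ℕₚ.≤-reflexive (trans (sym half) (sym (free+fixed ρ)))) (ℕₚ.+-monoʳ-≤ (free ρ) few))

    weaken : ∀ d R → Ψ d R ≤ Ψ (suc d) R
    weaken d (ρ ∷ []) = *-monoˡ-≤-nonNeg (+ (2 ℕ.^ free ρ))
      (+-monoʳ-≤ (+ 16 * (seen ρ * seen ρ) + + u²) (*-monoˡ-≤-nonNeg (+ 16) (+≤+ (ℕₚ.n≤1+n d))))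

    split : ∀ d R q → knownAt R q ≡ nothing → Ψ d (answer R q true) + Ψ d (answer R q false) ≤ Ψ (suc d) R
    split d (ρ ∷ []) q un = ≤-reflexive (begin
      Ψ d (set ρ j true ∷ []) + Ψ d (set ρ j false ∷ [])
        ≡⟨ cong₂ _+_ (half-Ψ true) (half-Ψ false) ⟩
      + p * (+ 16 * ((s + 1ℤ) * (s + 1ℤ)) + + u² + + 16 * + d) + + p * (+ 16 * ((s + -1ℤ) * (s + -1ℤ)) + + u² + + 16 * + d)
        ≡⟨ e (+ p) s (+ u²) (+ d) ⟩
      + 2 * + p * (+ 16 * (s * s) + + u² + + 16 * (1ℤ + + d))
        ≡⟨ cong (_* (+ 16 * (s * s) + + u² + + 16 * (1ℤ + + d))) (trans (sym (pos-* 2 p)) (cong (λ z → + (2 ℕ.^ z)) (sym (free-set ρ j true un)))) ⟩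
      Ψ (suc d) (ρ ∷ []) ∎)
      where
      open ≡-Reasoning
      j = toℕ q
      s = seen ρ
      p = 2 ℕ.^ free (set ρ j true)
      half-Ψ : ∀ b → Ψ d (set ρ j b ∷ []) ≡ + p * (+ 16 * ((s + σ b) * (s + σ b)) + + u² + + 16 * + d)
      half-Ψ b = cong₂ (λ r z → + (2 ℕ.^ r) * (+ 16 * (z * z) + + u² + + 16 * + d))
        (ℕₚ.suc-injective (trans (sym (free-set ρ j b un)) (free-set ρ j true un))) (seen-set ρ j b un)
      e : ∀ p s v d → p * (+ 16 * ((s + 1ℤ) * (s + 1ℤ)) + v + + 16 * d) + p * (+ 16 * ((s + -1ℤ) * (s + -1ℤ)) + v + + 16 * d)
          ≡ + 2 * p * (+ 16 * (s * s) + v + + 16 * (1ℤ + d))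
      e = solve-∀

    length-Y : length Y ≡ length (validCompletions u (replicate m nothing))
    length-Y = trans (length-tuples 0 (λ i → validCompletions u (lookup (blank 1 m) i))) (ℕₚ.*-identityʳ _)

    2^m≤2Y : 2 ℕ.^ m ℕ.≤ 2 ℕ.* length Y
    2^m≤2Y = subst₂ (λ a b → 2 ℕ.^ a ℕ.≤ 2 ℕ.* b) (free-blank m) (sym length-Y)
      (length-valid-≥ u (replicate m nothing) 1≤u
        (subst (16 ℕ.* u² ℕ.≤_) (trans (sym half) (sym (free-blank m))) (ℕₚ.m≤m+n (16 ℕ.* u²) (16 ℕ.* u²))))

    g-input : ∀ V → g (input V) ≡ decide u (signSum (lookup V zero))
    g-input V = cong (decide u) (∑-initial-at m≤n (lookup V zero))

    gain-success : ∀ V s → T (valid u (lookup V zero)) → gain s V ≡ + 2 * 𝟙 (asRel g (input V) s) - 1ℤ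
    gain-success V s ok with decide u (signSum (lookup V zero)) in eq
    ... | just c = asRel-just g (input V) s (trans (g-input V) eq)

    -- The initial potential is at most `2 ^ m` times `2u²`, and `2 ^ m` is at most twice the number
    -- of valid inputs. After division by `16u²` the mean gain is at most 1/4, so the success rate
    -- is at most 5/8, below the required 2/3.
    few-successes : ∀ t d → (∀ x → cost t x ℕ.≤ d) → 16 ℕ.* d ℕ.≤ u² →
      8 ℕ.* count (λ V → asRel g (input V) (run t (input V))) Y ℕ.≤ 5 ℕ.* length Y
    few-successes t d cheap 16d≤u² = ℕₚ.*-cancelˡ-≤ (4 ℕ.* u²) {{ℕₚ.m*n≢0 4 u² {{_}} {{ℕₚ.m*n≢0 u u {{ℕ.>-nonZero 1≤u}} {{ℕ.>-nonZero 1≤u}}}}}} (drop‿+≤+ (begin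
      + (4 ℕ.* u² ℕ.* (8 ℕ.* c))
        ≡⟨ trans (cong +_ (e₀ u² c)) (trans (pos-* (16 ℕ.* u²) (2 ℕ.* c)) (cong (+ (16 ℕ.* u²) *_) (pos-* 2 c))) ⟩
      + (16 ℕ.* u²) * (+ 2 * + c)
        ≡⟨ e₁ (+ (16 ℕ.* u²)) (+ 2 * + c) (+ length Y) ⟩
      + (16 ℕ.* u²) * (+ 2 * + c - + length Y) + + (16 ℕ.* u²) * + length Y
        ≡⟨ cong (λ z → + (16 ℕ.* u²) * z + + (16 ℕ.* u²) * + length Y) (sym signs) ⟩
      + (16 ℕ.* u²) * ∑ Y (λ V → gain (run t (input V)) V) + + (16 ℕ.* u²) * + length Y
        ≡⟨ cong (_+ + (16 ℕ.* u²) * + length Y) (sym (∑-*ˡ Y (+ (16 ℕ.* u²)) (λ V → gain (run t (input V)) V))) ⟩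
      ∑ Y (λ V → + (16 ℕ.* u²) * gain (run t (input V)) V) + + (16 ℕ.* u²) * + length Y
        ≤⟨ +-monoˡ-≤ (+ (16 ℕ.* u²) * + length Y) (tree-bound (λ s V → + (16 ℕ.* u²) * gain s V) Ψ (16 ℕ.* u²) at-leaf weaken split t d (blank 1 m)
             (λ x _ → cheap x) small) ⟩
      Ψ d (blank 1 m) + + (16 ℕ.* u²) * + length Y
        ≡⟨ cong₂ _+_ root (sym (pos-* (16 ℕ.* u²) (length Y))) ⟩
      + (2 ℕ.^ m ℕ.* (u² ℕ.+ 16 ℕ.* d) ℕ.+ 16 ℕ.* u² ℕ.* length Y)
        ≤⟨ +≤+ (ℕₚ.+-monoˡ-≤ (16 ℕ.* u² ℕ.* length Y) (ℕₚ.*-mono-≤ 2^m≤2Y (ℕₚ.+-monoʳ-≤ u² 16d≤u²))) ⟩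
      + (2 ℕ.* length Y ℕ.* (u² ℕ.+ u²) ℕ.+ 16 ℕ.* u² ℕ.* length Y)
        ≡⟨ cong +_ (e₂ (length Y) u²) ⟩
      + (4 ℕ.* u² ℕ.* (5 ℕ.* length Y)) ∎))
      where
      open ≤-Reasoning
      c = count (λ V → asRel g (input V) (run t (input V))) Y
      e₀ : ∀ v c → 4 ℕ.* v ℕ.* (8 ℕ.* c) ≡ 16 ℕ.* v ℕ.* (2 ℕ.* c)
      e₀ = ℕR.solve-∀
      e₁ : ∀ k c l → k * c ≡ k * (c - l) + k * l
      e₁ = solve-∀
      e₂ : ∀ l v → 2 ℕ.* l ℕ.* (v ℕ.+ v) ℕ.+ 16 ℕ.* v ℕ.* l ≡ 4 ℕ.* v ℕ.* (5 ℕ.* l)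
      e₂ = ℕR.solve-∀
      small : queries (blank 1 m) ℕ.+ d ℕ.≤ 16 ℕ.* u²
      small = subst (ℕ._≤ 16 ℕ.* u²) (cong (ℕ._+ d) (sym (queries-blank 1 m)))
        (ℕₚ.≤-trans (ℕₚ.m≤n*m d 16) (ℕₚ.≤-trans 16d≤u² (ℕₚ.m≤n*m u² 16)))
      root : Ψ d (blank 1 m) ≡ + (2 ℕ.^ m ℕ.* (u² ℕ.+ 16 ℕ.* d))
      root = begin-equality
        Ψ d (blank 1 m)
          ≡⟨ cong₂ (λ r s → + (2 ℕ.^ r) * (+ 16 * (s * s) + + u² + + 16 * + d)) (free-blank m) (seen-blank m) ⟩
        + (2 ℕ.^ m) * (+ u² + + 16 * + d)
          ≡⟨ cong (λ z → + (2 ℕ.^ m) * (+ u² + z)) (sym (pos-* 16 d)) ⟩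
        + (2 ℕ.^ m) * + (u² ℕ.+ 16 ℕ.* d)
          ≡⟨ pos-* (2 ℕ.^ m) (u² ℕ.+ 16 ℕ.* d) ⟨
        + (2 ℕ.^ m ℕ.* (u² ℕ.+ 16 ℕ.* d)) ∎
      signs : ∑ Y (λ V → gain (run t (input V)) V) ≡ + 2 * + c - + length Y
      signs = begin-equality
        ∑ Y (λ V → gain (run t (input V)) V)
          ≡⟨ ∑-cong-All (All.map (λ {V} ok → gain-success V (run t (input V)) (ok zero)) (inputs-all (valid u) (blank 1 m))) ⟩
        ∑ Y (λ V → + 2 * 𝟙 (asRel g (input V) (run t (input V))) + - 1ℤ)
          ≡⟨ ∑-+ Y (λ V → + 2 * 𝟙 (asRel g (input V) (run t (input V)))) (λ _ → - 1ℤ) ⟩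
        ∑ Y (λ V → + 2 * 𝟙 (asRel g (input V) (run t (input V)))) + ∑ Y (λ _ → - 1ℤ)
          ≡⟨ cong₂ _+_ (trans (∑-*ˡ Y (+ 2) (λ V → 𝟙 (asRel g (input V) (run t (input V))))) (cong (+ 2 *_) (∑-𝟙 (λ V → asRel g (input V) (run t (input V))) Y)))
               (trans (∑-const Y (- 1ℤ)) (trans (*-comm (+ length Y) (- 1ℤ)) (-1*i≡-i (+ length Y)))) ⟩
        + 2 * + c - + length Y ∎

-- Randomized lower bounds.

module LowerBounds where

  open import Data.Nat
  open import Data.Nat.Properties
  open import Data.Nat.Tactic.RingSolver
  open import Data.Bool using (Bool; true; false; T)
  open import Data.Maybe using (just; nothing)
  open import Data.Fin using (Fin; zero; suc; toℕ)
  open import Data.List using ([]; _∷_; length)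
  import Data.List.Relation.Unary.All as All
  open import Data.Vec using (Vec; []; _∷_; lookup; replicate)
  open import Data.Vec.Properties using (lookup-replicate)
  open import Data.Product using (Σ; _×_; _,_; proj₁; proj₂)
  import Data.Integer as ℤ
  import Data.Integer.Properties as ℤₚ
  open import Data.Rational using (1ℚ; _-_)
  import Data.Rational.Properties as ℚₚ
  open import Algebra.Bundles using (CommutativeRing)
  open import Algebra.Properties.Semiring.Mult (CommutativeRing.semiring ℚₚ.+-*-commutativeRing) using () renaming (_×_ to _·_)
  open import Algebra.Properties.CommutativeMonoid.Sum ℤₚ.+-0-commutativeMonoid using (sum-cong-≗) renaming (sum to sumℤ)
  open import Relation.Nullary using (¬_)
  open import Relation.Binary.PropositionalEquality
  open Threshold
  open Sums
  open PartialAssignments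
  open Adversary
  open Averaging
  open Functions
  open TreeBounds

  yao : ∀ {I S X : Set} ε (h : Rel I S) (inp : X → I → Bool) xs a b c M q → b · (1ℚ - ε) ≡ a · 1ℚ →
    (∀ t k → k < q → (∀ x → cost t x ≤ k) → c * successes h inp xs c M t ≤ M) →
    ¬ (c * length xs * a ≤ b * M) → R≥ ε h q
  yao ε h inp xs a b c M q ratio few absurd A k isA good cheap = ≮⇒≥ λ k<q →
    absurd (averaging h inp xs c M ε a b A ratio isA good (All.map (λ {pt} → few (proj₂ pt) k k<q) cheap))

  -- While the squared total bias stays within the variance `v`, the second moment is at most `2v`.
  -- A squared threshold of at least `4v` is then reached on at most half of the inputs.
  half-of-inputs : ∀ {K v s X} k q → 1 ≤ v → 4 * v ≤ K → q * q ≤ v → k < q → K * s ≤ (k * k + v) * X → 2 * s ≤ X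
  half-of-inputs {K} {v} {s} {X} k q 1≤v 4v≤K q²≤v k<q le = *-cancelˡ-≤ (2 * v) {{m*n≢0 2 v {{_}} {{>-nonZero 1≤v}}}} (begin
    2 * v * (2 * s)        ≡⟨ e₁ v s ⟩
    4 * v * s              ≤⟨ *-monoˡ-≤ s 4v≤K ⟩
    K * s                  ≤⟨ le ⟩
    (k * k + v) * X        ≤⟨ *-monoˡ-≤ X (+-monoˡ-≤ v (≤-trans (*-mono-≤ (<⇒≤ k<q) (<⇒≤ k<q)) q²≤v)) ⟩
    (v + v) * X            ≡⟨ e₂ v X ⟩
    2 * v * X              ∎)
    where
    open ≤-Reasoning
    e₁ : ∀ v s → 2 * v * (2 * s) ≡ 4 * v * s
    e₁ = solve-∀
    e₂ : ∀ v X → (v + v) * X ≡ 2 * v * X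
    e₂ = solve-∀

  exceeds : ∀ {x} a b → 1 ≤ x → b < a → ¬ (a * x ≤ b * x)
  exceeds {x} a b 1≤x b<a le = <⇒≱ (*-monoˡ-< x {{>-nonZero 1≤x}} b<a) le

  inputs-nonempty : ∀ u n m → 1 ≤ length (validCompletions u (replicate m nothing)) → 1 ≤ length (inputs (valid u) (blank n m))
  inputs-nonempty u n m ne = tuples-nonempty n _ (λ i → subst (λ ρ → 1 ≤ length (validCompletions u ρ)) (sym (lookup-replicate i (replicate m nothing))) ne)

  bit-bias : ∀ (ρ : Partial 1) → 1 * ℤ.∣ ∑ (validCompletions 1 ρ) (λ v → vote 1 (signSum v)) ∣ ≤ fixed ρ * length (validCompletions 1 ρ)
  bit-bias (just true ∷ [])  = ≤-refl
  bit-bias (just false ∷ []) = ≤-refl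
  bit-bias (nothing ∷ [])    = ≤-refl

  -- For `m = u = 1` every single bit meets the promise, so the blocks are plain uniform bits and
  -- the general product bound applies. The resulting success rate 1/2 falls short of the 5/9
  -- demanded by error 4/9.
  agreementRel-lower : ∀ n θ q → 1 ≤ n → 4 * n ≤ θ * θ → q * q ≤ n → R≥ 4/9 (agreementRel n θ) q
  agreementRel-lower n θ q 1≤n 4n≤θ² q²≤n = yao 4/9 (agreementRel n θ) input X 5 9 2 (length X) q refl few absurd
    where
    open Game {1} {n} {Fin n} {Fin n → Bool} (valid 1) (λ i → i) (λ _ → 0)
    module P = ProductLower 1 1 bit-bias (λ i → i) (λ _ → 0) (agreementRel n θ) θ
    X = P.X
    read : ∀ v → σ (at {1} v 0) ≡ vote 1 (signSum v)
    read (true ∷ [])  = refl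
    read (false ∷ []) = refl
    sound : ∀ V s → (∀ i → T (valid 1 (lookup V i))) → agreementRel n θ (input V) s ≡ true →
      ℤ.+ θ ℤ.≤ sumℤ (λ i → σ (s i) ℤ.* vote 1 (signSum (lookup V i)))
    sound V s _ succ = subst (ℤ.+ θ ℤ.≤_) (sum-cong-≗ (λ i → cong (σ (s i) ℤ.*_) (read (lookup V i))))
      (agreementRel-sound θ (input V) s succ)
    1*1 : n * (1 * 1) ≡ n
    1*1 = *-identityʳ n
    few : ∀ t k → k < q → (∀ x → cost t x ≤ k) → 2 * count (λ V → agreementRel n θ (input V) (run t (input V))) X ≤ length X
    few t k k<q cheap = half-of-inputs {v = n * (1 * 1)} k q (subst (1 ≤_) (sym 1*1) 1≤n)
      (subst₂ (λ a b → 4 * a ≤ b * b) (sym 1*1) (sym (*-identityˡ θ)) 4n≤θ²) (subst (q * q ≤_) (sym 1*1) q²≤n) k<q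
      (P.few-successes sound t k cheap)
    absurd : ¬ (2 * length X * 5 ≤ 9 * length X)
    absurd le = exceeds 10 9 (inputs-nonempty 1 n 1 (s≤s z≤n)) ≤-refl (subst (_≤ 9 * length X) (e (length X)) le)
      where
      e : ∀ x → 2 * x * 5 ≡ 10 * x
      e = solve-∀

  rows-nonempty : ∀ u → 1 ≤ u → 1 ≤ length (validCompletions {32 * (u * u)} u (replicate (32 * (u * u)) nothing))
  rows-nonempty u 1≤u = pos (≤-trans (m^n>0 2 (free ρ)) (length-valid-≥ u ρ 1≤u
      (subst (16 * (u * u) ≤_) (sym (free-blank (32 * (u * u)))) (*-monoˡ-≤ (u * u) (m≤m+n 16 16)))))
    where
    ρ = replicate (32 * (u * u)) nothing
    pos : ∀ {x} → 1 ≤ 2 * x → 1 ≤ x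
    pos {suc x} _ = s≤s z≤n

  -- `Q` queries create a total bias of at most `Q / u`, which has to compete with a deviation of
  -- order `√n`; hence `q ≤ u √n`. This is linear in `n` once `u` is of order `√n`.
  composition-lower : ∀ n θ u q → 1 ≤ n → 1 ≤ u → 32 * (u * u) ≤ n → 4 * n ≤ θ * θ → q * q ≤ n * (u * u) →
    R≥ 1/3 (compose (agreementRel n θ) (gapMajority n (32 * (u * u)) u)) q
  composition-lower n θ u q 1≤n 1≤u m≤n 4n≤θ² q²≤ = yao 1/3 h input X 2 3 2 (length X) q refl few absurd
    where
    m = 32 * (u * u)
    f = agreementRel n θ
    g = gapMajority n m u
    h = compose f g
    open Game {m} {n} {Fin n × Fin n} {Fin n → Bool} (valid u) proj₁ (λ q → toℕ (proj₂ q))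
    module P = ProductLower u m (λ ρ → vote-bias u ρ 1≤u refl) proj₁ (λ q → toℕ (proj₂ q)) h θ
    X = P.X
    decision : ∀ (v : Vec Bool m) → T (valid u v) → Σ Bool λ c → decide u (signSum v) ≡ just c
    decision v ok with decide u (signSum v)
    ... | just c = c , refl
    sound : ∀ V s → (∀ i → T (valid u (lookup V i))) → h (input V) s ≡ true →
      ℤ.+ θ ℤ.≤ sumℤ (λ i → σ (s i) ℤ.* vote u (signSum (lookup V i)))
    sound V s ok succ = subst (ℤ.+ θ ℤ.≤_) (sum-cong-≗ same) (agreementRel-sound θ y s (trans (sym (compose-just f g (input V) s (proj₁ (proj₂ all)))) succ))
      where
      w : Fin n → Bool
      w i = proj₁ (decision (lookup V i) (ok i))
      all = allJust-just n w (λ i → trans (cong (decide u) (∑-initial-at m≤n (lookup V i))) (proj₂ (decision (lookup V i) (ok i))))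
      y = proj₁ all
      same : ∀ i → σ (s i) ℤ.* σ (y i) ≡ σ (s i) ℤ.* vote u (signSum (lookup V i))
      same i = cong (σ (s i) ℤ.*_) (trans (cong σ (proj₂ (proj₂ all) i)) (sym (voted (proj₂ (decision (lookup V i) (ok i))))))
        where
        voted : ∀ {c} → decide u (signSum (lookup V i)) ≡ just c → vote u (signSum (lookup V i)) ≡ σ c
        voted eq rewrite eq = refl
    few : ∀ t k → k < q → (∀ x → cost t x ≤ k) → 2 * count (λ V → h (input V) (run t (input V))) X ≤ length X
    few t k k<q cheap = half-of-inputs {v = n * (u * u)} k q (*-mono-≤ 1≤n (*-mono-≤ 1≤u 1≤u))
      (begin
        4 * (n * (u * u))      ≡⟨ e₁ n u ⟩
        u * u * (4 * n)        ≤⟨ *-monoʳ-≤ (u * u) 4n≤θ² ⟩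
        u * u * (θ * θ)        ≡⟨ e₂ u θ ⟩
        u * θ * (u * θ)        ∎) q²≤ k<q (P.few-successes sound t k cheap)
      where
      open ≤-Reasoning
      e₁ : ∀ n u → 4 * (n * (u * u)) ≡ u * u * (4 * n)
      e₁ = solve-∀
      e₂ : ∀ u θ → u * u * (θ * θ) ≡ u * θ * (u * θ)
      e₂ = solve-∀
    absurd : ¬ (2 * length X * 2 ≤ 3 * length X)
    absurd le = exceeds 4 3 (inputs-nonempty u n m (rows-nonempty u 1≤u)) ≤-refl (subst (_≤ 3 * length X) (e (length X)) le)
      where
      e : ∀ x → 2 * x * 2 ≡ 4 * x
      e = solve-∀

  gapMajority-lower : ∀ n u q → 1 ≤ u → 32 * (u * u) ≤ n → (∀ k → k < q → 16 * k ≤ u * u) →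
    R≥ 1/3 (asRel (gapMajority n (32 * (u * u)) u)) q
  gapMajority-lower n u q 1≤u m≤n small = yao 1/3 (asRel (gapMajority n m u)) input G.Y 2 3 8 (5 * length G.Y) q refl
    (λ t k k<q cheap → G.few-successes t k cheap (small k k<q)) absurd
    where
    m = 32 * (u * u)
    open Game {m} {1} {Fin n} {Bool} (valid u) (λ _ → zero) toℕ
    module G = GapMajorityLower u 1≤u n m≤n
    absurd : ¬ (8 * length G.Y * 2 ≤ 3 * (5 * length G.Y))
    absurd le = exceeds 16 15 (inputs-nonempty u 1 m (rows-nonempty u 1≤u)) ≤-refl
      (subst₂ _≤_ (e₁ (length G.Y)) (e₂ (length G.Y)) le)
      where
      e₁ : ∀ x → 8 * x * 2 ≡ 16 * x
      e₁ = solve-∀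
      e₂ : ∀ x → 3 * (5 * x) ≡ 15 * x
      e₂ = solve-∀

-- Algorithms that choose independently for each output bit, and Chebyshev's inequality for them.

module ProductAlgorithms where

  open import Data.Nat using (ℕ; zero; suc; z≤n; s≤s)
  import Data.Nat as ℕ
  import Data.Nat.Properties as ℕₚ
  import Data.Nat.Tactic.RingSolver as ℕR
  open import Data.Bool using (Bool; true; false; if_then_else_; not)
  open import Data.Fin using (Fin; zero; suc; toℕ)
  open import Data.List using (List; []; _∷_; length)
  import Data.List as List
  open import Data.List.Properties using (length-map)
  open import Data.List.Relation.Unary.All using (All; []; _∷_)
  import Data.List.Relation.Unary.All as All
  import Data.List.Relation.Unary.All.Properties as Allₚ
  open import Data.Vec using (Vec; []; _∷_; lookup; map)
  open import Data.Vec.Properties using (lookup-map)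
  open import Data.Product using (_,_; proj₂)
  open import Data.Rational using (1ℚ)
  import Data.Rational as ℚ
  import Data.Rational.Properties as ℚₚ
  open import Data.Integer hiding (suc)
  open import Data.Integer.Properties
  open import Data.Integer.Tactic.RingSolver
  open import Algebra.Bundles using (CommutativeRing)
  open import Algebra.Properties.Semiring.Mult (CommutativeRing.semiring ℚₚ.+-*-commutativeRing) using () renaming (_×_ to _·_)
  open import Algebra.Properties.Semiring.Sum (CommutativeRing.semiring +-*-commutativeRing) using (*-distribˡ-sum)
  open import Algebra.Properties.CommutativeMonoid.Sum +-0-commutativeMonoid using (sum-cong-≗; ∑-distrib-+) renaming (sum to sumℤ)
  open import Algebra.Properties.CommutativeMonoid.Sum ℕₚ.+-0-commutativeMonoid using () renaming (sum to sumℕ)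
  open import Relation.Binary.PropositionalEquality
  open Walk using (*-mono-≤-nonNeg; sq≡)
  open Threshold
  open Sums
  open Averaging
  open Functions
  open TreeBounds using (σ²≡1)

  bind : ∀ {I A B : Set} → DT I A → (A → DT I B) → DT I B
  bind (leaf a)        k = k a
  bind (query i t₀ t₁) k = query i (bind t₀ k) (bind t₁ k)

  run-bind : ∀ {I A B : Set} (t : DT I A) (k : A → DT I B) x → run (bind t k) x ≡ run (k (run t x)) x
  run-bind (leaf a)        k x = refl
  run-bind (query i t₀ t₁) k x with x i
  ... | true  = run-bind t₁ k x
  ... | false = run-bind t₀ k x

  cost-bind : ∀ {I A B : Set} (t : DT I A) (k : A → DT I B) x → cost (bind t k) x ≡ cost t x ℕ.+ cost (k (run t x)) x
  cost-bind (leaf a)        k x = refl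
  cost-bind (query i t₀ t₁) k x with x i
  ... | true  = cong suc (cost-bind t₁ k x)
  ... | false = cong suc (cost-bind t₀ k x)

  sequence : ∀ {I S : Set} {n} → Vec (DT I Bool) n → (Vec Bool n → S) → DT I S
  sequence []       k = leaf (k [])
  sequence (t ∷ ts) k = bind t (λ b → sequence ts (λ v → k (b ∷ v)))

  run-sequence : ∀ {I S : Set} {n} (ts : Vec (DT I Bool) n) (k : Vec Bool n → S) x →
    run (sequence ts k) x ≡ k (map (λ t → run t x) ts)
  run-sequence []       k x = refl
  run-sequence (t ∷ ts) k x = trans (run-bind t _ x) (run-sequence ts (λ v → k (run t x ∷ v)) x)

  cost-sequence : ∀ {I S : Set} {n} (ts : Vec (DT I Bool) n) (k : Vec Bool n → S) x →
    cost (sequence ts k) x ≡ sumℕ (λ i → cost (lookup ts i) x)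
  cost-sequence []       k x = refl
  cost-sequence (t ∷ ts) k x = trans (cost-bind t _ x) (cong (cost t x ℕ.+_) (cost-sequence ts _ x))

  probe : ∀ {I : Set} → I → DT I Bool
  probe i = query i (leaf false) (leaf true)

  run-probe : ∀ {I : Set} (i : I) x → run (probe i) x ≡ x i
  run-probe i x with x i
  ... | true  = refl
  ... | false = refl

  cost-probe : ∀ {I : Set} (i : I) x → cost (probe i) x ≡ 1
  cost-probe i x with x i
  ... | true  = refl
  ... | false = refl

  sumℕ-mono : ∀ {n} {a b : Fin n → ℕ} → (∀ i → a i ℕ.≤ b i) → sumℕ a ℕ.≤ sumℕ b
  sumℕ-mono {zero}  le = z≤n
  sumℕ-mono {suc n} le = ℕₚ.+-mono-≤ (le zero) (sumℕ-mono (λ i → le (suc i)))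

  sumℕ-const : ∀ n a → sumℕ {n} (λ _ → a) ≡ n ℕ.* a
  sumℕ-const zero    a = refl
  sumℕ-const (suc n) a = cong (a ℕ.+_) (sumℕ-const n a)

  sum-prefix : ∀ n k a → k ℕ.≤ n → sumℕ {n} (λ i → if toℕ i ℕ.<ᵇ k then a else 0) ≡ k ℕ.* a
  sum-prefix n zero a le = trans (sumℕ-const n 0) (ℕₚ.*-zeroʳ n)
  sum-prefix (suc n) (suc k) a (s≤s le) = cong (a ℕ.+_) (sum-prefix n k a le)

  count-cong : ∀ {A : Set} (l : List A) {p q : A → Bool} → (∀ a → p a ≡ q a) → count p l ≡ count q l
  count-cong []      eq = refl
  count-cong (a ∷ l) eq = cong₂ (λ b z → (if b then 1 else 0) ℕ.+ z) (eq a) (count-cong l eq)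

  count-map : ∀ {A B : Set} (f : A → B) (p : B → Bool) l → count p (List.map f l) ≡ count (λ a → p (f a)) l
  count-map f p []      = refl
  count-map f p (a ∷ l) = cong ((if p (f a) then 1 else 0) ℕ.+_) (count-map f p l)

  count-true : ∀ {A : Set} (l : List A) → count (λ _ → true) l ≡ length l
  count-true []      = refl
  count-true (a ∷ l) = cong suc (count-true l)

  count-not : ∀ {A : Set} (p : A → Bool) l → count p l ℕ.+ count (λ a → not (p a)) l ≡ length l
  count-not p []      = refl
  count-not p (a ∷ l) with p a
  ... | true  = cong suc (count-not p l)
  ... | false = trans (ℕₚ.+-suc (count p l) _) (cong suc (count-not p l))

  uniform-R≤ : ∀ {I S : Set} ε a b q (h : Rel I S) (l : List (DT I S)) → suc b · (1ℚ ℚ.- ε) ≡ a · 1ℚ → 1 ℕ.≤ length l →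
    (∀ x → a ℕ.* length l ℕ.≤ suc b ℕ.* count (λ s → h x (run s x)) l) →
    All (λ s → ∀ x → cost s x ℕ.≤ q) l → R≤ ε h q
  uniform-R≤ ε a b q h (t ∷ ts) ratio ne many cheap =
    uniform , uniform-isRAlg , uniform-computes ε a b h ratio many , uniform-cost q cheap
    where open Uniform t ts

  -- Independent uniform choices t i ∈ L i, analysed by Chebyshev; κ i / c bounds the mean of σ (run (t i) x) σ (y i) from below.
  module ProductAlgorithm {n : ℕ} {I : Set} (L : Fin n → List (DT I Bool)) (c : ℕ) (len : ∀ i → length (L i) ≡ c) where

    choices : List (Vec (DT I Bool) n)
    choices = tuples n L

    output : Vec (DT I Bool) n → (I → Bool) → Fin n → Bool
    output ts x = lookup (map (λ t → run t x) ts)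

    module _ (x : I → Bool) (y : Fin n → Bool) (κ : Fin n → ℕ)
             (κ≤ : ∀ i → + κ i ≤ ∑ (L i) (λ t → σ (run t x) * σ (y i))) where

      private
        F : Fin n → DT I Bool → ℤ
        F i t = σ (run t x) * σ (y i)
        b : Fin n → ℤ
        b i = ∑ (L i) (F i)
        -- The mean of `F i` is `b i / c`; this is `c` times the deviation from it, hence integral.
        e : Fin n → DT I Bool → ℤ
        e i t = - b i + + c * F i t

      F²≡1 : ∀ i t → F i t * F i t ≡ 1ℤ
      F²≡1 i t = trans (e₁ (σ (run t x)) (σ (y i))) (cong₂ _*_ (σ²≡1 (run t x)) (σ²≡1 (y i)))
        where
        e₁ : ∀ a b → (a * b) * (a * b) ≡ (a * a) * (b * b)
        e₁ = solve-∀

      centred : ∀ i → ∑ (L i) (e i) ≡ 0ℤ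
      centred i = begin
        ∑ (L i) (e i)                                        ≡⟨ ∑-shift (L i) (- b i) (λ t → + c * F i t) ⟩
        + length (L i) * - b i + ∑ (L i) (λ t → + c * F i t) ≡⟨ cong₂ (λ k z → + k * - b i + z) (len i) (∑-*ˡ (L i) (+ c) (F i)) ⟩
        + c * - b i + + c * b i                              ≡⟨ e₁ (+ c) (b i) ⟩
        0ℤ                                                   ∎
        where
        open ≡-Reasoning
        e₁ : ∀ c b → c * - b + c * b ≡ 0ℤ
        e₁ = solve-∀

      variance : ∀ i → ∑ (L i) (λ t → e i t * e i t) ≤ + (c ℕ.* c ℕ.* length (L i))
      variance i = begin
        ∑ (L i) (λ t → e i t * e i t)
          ≡⟨ ∑-shift² (L i) (- b i) (λ t → + c * F i t) ⟩
        + length (L i) * (- b i * - b i) + + 2 * - b i * ∑ (L i) (λ t → + c * F i t) + ∑ (L i) (λ t → (+ c * F i t) * (+ c * F i t))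
          ≡⟨ cong₂ _+_ (cong₂ (λ k z → + k * (- b i * - b i) + + 2 * - b i * z) (len i) (∑-*ˡ (L i) (+ c) (F i)))
               (trans (∑-cong (L i) (λ t → trans (e₁ (+ c) (F i t)) (trans (cong (+ c * + c *_) (F²≡1 i t)) (*-identityʳ (+ c * + c))))) (∑-const (L i) (+ c * + c))) ⟩
        + c * (- b i * - b i) + + 2 * - b i * (+ c * b i) + + length (L i) * (+ c * + c)
          ≡⟨ e₂ (+ c) (b i) (+ length (L i)) ⟩
        (+ c * + c) * + length (L i) - + c * (b i * b i)
          ≤⟨ drop-square ((+ c * + c) * + length (L i)) (b i) ⟩
        (+ c * + c) * + length (L i)
          ≡⟨ trans (cong (_* + length (L i)) (sym (pos-* c c))) (sym (pos-* (c ℕ.* c) (length (L i)))) ⟩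
        + (c ℕ.* c ℕ.* length (L i)) ∎
        where
        open ≤-Reasoning
        e₁ : ∀ c f → (c * f) * (c * f) ≡ (c * c) * (f * f)
        e₁ = solve-∀
        e₂ : ∀ c b l → c * (- b * - b) + + 2 * - b * (c * b) + l * (c * c) ≡ (c * c) * l - c * (b * b)
        e₂ = solve-∀
        drop-square : ∀ z w → z - + c * (w * w) ≤ z
        drop-square z w = ≤-trans (+-monoʳ-≤ z (neg-mono-≤ (subst (0ℤ ≤_) (trans (pos-* c _) (cong (+ c *_) (sym (sq≡ w)))) (+≤+ z≤n)))) (≤-reflexive (+-identityʳ z))

      sum-neg : ∀ {n} (κ : Fin n → ℕ) (b : Fin n → ℤ) → (∀ i → + κ i ≤ b i) → sumℤ (λ i → - b i) ≤ - + sumℕ κ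
      sum-neg {zero}  κ b le = ≤-refl
      sum-neg {suc n} κ b le = ≤-trans (+-mono-≤ (neg-mono-≤ (le zero)) (sum-neg (λ i → κ (suc i)) (λ i → b (suc i)) (λ i → le (suc i))))
        (≤-reflexive (sym (neg-distrib-+ (+ κ zero) (+ sumℕ (λ i → κ (suc i))))))

      dot-agreement : ∀ ts → dot e ts ≡ sumℤ (λ i → - b i) + + c * agreement y (output ts x)
      dot-agreement ts = trans (∑-distrib-+ (λ i → - b i) (λ i → + c * F i (lookup ts i)))
        (cong (λ z → sumℤ (λ i → - b i) + z) (trans (sym (*-distribˡ-sum (+ c) (λ i → F i (lookup ts i))))
          (cong (+ c *_) (sum-cong-≗ (λ i → cong (λ v → σ v * σ (y i)) (sym (lookup-map i (λ t → run t x) ts)))))))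

      module _ (θ G : ℕ) (gap : c ℕ.* θ ℕ.+ G ℕ.≤ sumℕ κ) where

        private
          good : Vec (DT I Bool) n → Bool
          good ts = agreementRel n θ y (output ts x)

        -- The mean agreement is at least the sum of `κ` divided by `c`, which exceeds `θ` by a
        -- margin of at least `G / c`. A failing choice therefore deviates from the mean by at least
        -- this margin.
        failure-far : ∀ ts → not (good ts) ≡ true → + (G ℕ.* G) ≤ dot e ts * dot e ts
        failure-far ts bad = begin
          + (G ℕ.* G)                  ≡⟨ pos-* G G ⟩
          + G * + G                    ≤⟨ *-mono-≤-nonNeg (+≤+ z≤n) (+≤+ z≤n) far far ⟩
          - dot e ts * - dot e ts      ≡⟨ e₁ (dot e ts) ⟩
          dot e ts * dot e ts          ∎
          where
          open ≤-Reasoning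
          e₁ : ∀ z → - z * - z ≡ z * z
          e₁ = solve-∀
          not-true : ∀ {b} → not b ≡ true → b ≡ false
          not-true {false} _ = refl
          agr<θ : agreement y (output ts x) < + θ
          agr<θ = agreementRel-fails θ y (output ts x) (not-true bad)
          e₂ : ∀ g k → - (g + k) + k ≡ - g
          e₂ = solve-∀
          far : + G ≤ - dot e ts
          far = subst (_≤ - dot e ts) (neg-involutive (+ G)) (neg-mono-≤ (begin
            dot e ts                                                          ≡⟨ dot-agreement ts ⟩
            sumℤ (λ i → - b i) + + c * agreement y (output ts x)              ≤⟨ +-mono-≤ (sum-neg κ b κ≤) (*-monoˡ-≤-nonNeg (+ c) (<⇒≤ agr<θ)) ⟩
            - + sumℕ κ + + c * + θ                                            ≤⟨ +-monoˡ-≤ (+ c * + θ) (neg-mono-≤ (+≤+ gap)) ⟩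
            - + (c ℕ.* θ ℕ.+ G) + + c * + θ                                   ≡⟨ cong₂ (λ p q → - p + q) (cong +_ (ℕₚ.+-comm (c ℕ.* θ) G)) (sym (pos-* c θ)) ⟩
            - (+ G + + (c ℕ.* θ)) + + (c ℕ.* θ)                               ≡⟨ e₂ (+ G) (+ (c ℕ.* θ)) ⟩
            - + G                                                             ∎))

        few-failures : G ℕ.* G ℕ.* count (λ ts → not (good ts)) choices ℕ.≤ n ℕ.* (c ℕ.* c) ℕ.* length choices
        few-failures = drop‿+≤+ (begin
          + (G ℕ.* G ℕ.* count (λ ts → not (good ts)) choices)
            ≡⟨ pos-* (G ℕ.* G) _ ⟩
          + (G ℕ.* G) * + count (λ ts → not (good ts)) choices
            ≤⟨ markov choices (λ ts → not (good ts)) (dot e) (+ (G ℕ.* G)) (All.universal failure-far choices) ⟩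
          ∑ choices (λ ts → dot e ts * dot e ts)
            -- The summands are centred, so all bounds on the means are zero and only the variance
            -- term remains.
            ≤⟨ proj₂ (SecondMoment.moments (c ℕ.* c) n L e (λ _ → 0) (λ i → ℕₚ.≤-reflexive (cong ∣_∣ (centred i))) variance) ⟩
          + ((sumℕ {n} (λ _ → 0) ℕ.* sumℕ {n} (λ _ → 0) ℕ.+ n ℕ.* (c ℕ.* c)) ℕ.* length choices)
            ≡⟨ cong (λ z → + ((z ℕ.* z ℕ.+ n ℕ.* (c ℕ.* c)) ℕ.* length choices)) (trans (sumℕ-const n 0) (ℕₚ.*-zeroʳ n)) ⟩
          + (n ℕ.* (c ℕ.* c) ℕ.* length choices) ∎)
          where open ≤-Reasoning

        -- Chebyshev's bound on failures, with allowed failure rate `α / (a + α)`; adding `α N` to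
        -- both sides avoids subtraction of naturals.
        many-successes : ∀ a α → 1 ℕ.≤ n → 1 ℕ.≤ c → (a ℕ.+ α) ℕ.* (n ℕ.* (c ℕ.* c)) ℕ.≤ α ℕ.* (G ℕ.* G) →
          a ℕ.* length choices ℕ.≤ (a ℕ.+ α) ℕ.* count good choices
        many-successes a α 1≤n 1≤c wide = ℕₚ.+-cancelʳ-≤ (α ℕ.* N) _ _ (begin
          a ℕ.* N ℕ.+ α ℕ.* N                        ≡⟨ ℕₚ.*-distribʳ-+ N a α ⟨
          (a ℕ.+ α) ℕ.* N                            ≡⟨ cong ((a ℕ.+ α) ℕ.*_) (count-not good choices) ⟨
          (a ℕ.+ α) ℕ.* (succ ℕ.+ fail)              ≡⟨ ℕₚ.*-distribˡ-+ (a ℕ.+ α) succ fail ⟩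
          (a ℕ.+ α) ℕ.* succ ℕ.+ (a ℕ.+ α) ℕ.* fail  ≤⟨ ℕₚ.+-monoʳ-≤ ((a ℕ.+ α) ℕ.* succ) fail≤ ⟩
          (a ℕ.+ α) ℕ.* succ ℕ.+ α ℕ.* N             ∎)
          where
          open ℕₚ.≤-Reasoning
          N = length choices
          V = n ℕ.* (c ℕ.* c)
          succ = count good choices
          fail = count (λ ts → not (good ts)) choices
          1≤V : 1 ℕ.≤ V
          1≤V = ℕₚ.*-mono-≤ 1≤n (ℕₚ.*-mono-≤ 1≤c 1≤c)
          e₁ : ∀ V b f → V ℕ.* (b ℕ.* f) ≡ b ℕ.* V ℕ.* f
          e₁ = ℕR.solve-∀
          e₂ : ∀ V α N → α ℕ.* (V ℕ.* N) ≡ V ℕ.* (α ℕ.* N)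
          e₂ = ℕR.solve-∀
          fail≤ : (a ℕ.+ α) ℕ.* fail ℕ.≤ α ℕ.* N
          fail≤ = ℕₚ.*-cancelˡ-≤ V {{ℕ.>-nonZero 1≤V}} (begin
            V ℕ.* ((a ℕ.+ α) ℕ.* fail)    ≡⟨ e₁ V (a ℕ.+ α) fail ⟩
            (a ℕ.+ α) ℕ.* V ℕ.* fail      ≤⟨ ℕₚ.*-monoˡ-≤ fail wide ⟩
            α ℕ.* (G ℕ.* G) ℕ.* fail      ≡⟨ ℕₚ.*-assoc α (G ℕ.* G) fail ⟩
            α ℕ.* (G ℕ.* G ℕ.* fail)      ≤⟨ ℕₚ.*-monoʳ-≤ α few-failures ⟩
            α ℕ.* (V ℕ.* N)               ≡⟨ e₂ V α N ⟩
            V ℕ.* (α ℕ.* N)               ∎)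

    trees : List (DT I (Fin n → Bool))
    trees = List.map (λ ts → sequence ts lookup) choices

    trees-cost : (ν : Fin n → ℕ) → (∀ i → All (λ t → ∀ x → cost t x ℕ.≤ ν i) (L i)) → All (λ s → ∀ x → cost s x ℕ.≤ sumℕ ν) trees
    trees-cost ν cheap = Allₚ.map⁺ (All.map (λ {ts} each x → subst (ℕ._≤ sumℕ ν) (sym (cost-sequence ts lookup x)) (sumℕ-mono (λ i → each i x)))
      (tuples-All n L cheap))

    trees-count : ∀ (h : Rel I (Fin n → Bool)) x → count (λ s → h x (run s x)) trees ≡ count (λ ts → h x (output ts x)) choices
    trees-count h x = trans (count-map (λ ts → sequence ts lookup) (λ s → h x (run s x)) choices)
      (count-cong choices (λ ts → cong (h x) (run-sequence ts lookup x)))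

    trees-length : length trees ≡ length choices
    trees-length = length-map (λ ts → sequence ts lookup) choices

-- Randomized upper bounds.

module UpperBounds where

  open import Data.Nat using (ℕ; z≤n; s≤s)
  import Data.Nat as ℕ
  import Data.Nat.Properties as ℕₚ
  import Data.Nat.Tactic.RingSolver as ℕR
  open import Data.Bool using (Bool; true; false; if_then_else_)
  open import Data.Maybe using (just; nothing; fromMaybe)
  open import Data.Fin using (Fin; toℕ)
  open import Data.List using (List; []; _∷_; length; map)
  open import Data.List.Properties using (length-map)
  open import Data.List.Relation.Unary.All using (All; []; _∷_)
  import Data.List.Relation.Unary.All as All
  import Data.List.Relation.Unary.All.Properties as Allₚ
  open import Data.Vec using (lookup; tabulate)
  open import Data.Vec.Properties using (lookup-map; lookup∘tabulate)
  open import Data.Product using (_×_; _,_)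
  open import Data.Integer hiding (suc)
  open import Data.Integer.Properties
  open import Algebra.Properties.CommutativeMonoid.Sum ℕₚ.+-0-commutativeMonoid using (sum-cong-≗) renaming (sum to sumℕ)
  open import Relation.Nullary using (yes; no)
  open import Relation.Binary.PropositionalEquality
  open Threshold
  open Sums
  open Functions
  open TreeBounds using (σ²≡1)
  open ProductAlgorithms

  -- The `θ + r` positions read agree for certain and the guesses average to zero, so the mean
  -- exceeds the threshold by `r`. The failure probability is at most `n / r²`, which `9n ≤ 4r²`
  -- brings down to 4/9.
  agreementRel-upper : ∀ n θ r → 1 ℕ.≤ n → θ ℕ.+ r ℕ.≤ n → 9 ℕ.* n ℕ.≤ 4 ℕ.* (r ℕ.* r) →
    R≤ 4/9 (agreementRel n θ) (θ ℕ.+ r)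
  agreementRel-upper n θ r 1≤n k≤n wide = uniform-R≤ 4/9 5 8 k h P.trees refl
    (subst (1 ℕ.≤_) (sym P.trees-length) (tuples-nonempty n L (λ i → subst (1 ℕ.≤_) (sym (len i)) (s≤s z≤n))))
    (λ x → subst₂ (λ a b → 5 ℕ.* a ℕ.≤ 9 ℕ.* b) (sym P.trees-length) (sym (P.trees-count h x))
      (P.many-successes x x κ (κ≤ x) θ (2 ℕ.* r) gap 5 4 1≤n (s≤s z≤n) wide′))
    (All.map (λ c x → ℕₚ.≤-trans (c x) (ℕₚ.≤-reflexive (trans (sum-prefix n k 1 k≤n) (ℕₚ.*-identityʳ k)))) (P.trees-cost ν cheap))
    where
    k = θ ℕ.+ r
    h = agreementRel n θ
    L : Fin n → List (DT (Fin n) Bool)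
    -- The probe is listed twice because all coordinates must offer the same number `c = 2` of
    -- choices.
    L i = if toℕ i ℕ.<ᵇ k then probe i ∷ probe i ∷ [] else leaf true ∷ leaf false ∷ []
    len : ∀ i → length (L i) ≡ 2
    len i with toℕ i ℕ.<ᵇ k
    ... | true  = refl
    ... | false = refl
    module P = ProductAlgorithm L 2 len
    κ ν : Fin n → ℕ
    κ i = if toℕ i ℕ.<ᵇ k then 2 else 0
    ν i = if toℕ i ℕ.<ᵇ k then 1 else 0
    cheap : ∀ i → All (λ t → ∀ x → cost t x ℕ.≤ ν i) (L i)
    cheap i with toℕ i ℕ.<ᵇ k
    ... | true  = (λ x → ℕₚ.≤-reflexive (cost-probe i x)) ∷ (λ x → ℕₚ.≤-reflexive (cost-probe i x)) ∷ []
    ... | false = (λ x → z≤n) ∷ (λ x → z≤n) ∷ []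
    κ≤ : ∀ x i → + κ i ≤ ∑ (L i) (λ t → σ (run t x) * σ (x i))
    κ≤ x i with toℕ i ℕ.<ᵇ k
    ... | true  = ≤-reflexive (sym (cong₂ (λ a b → a + (b + 0ℤ)) exact exact))
      where
      exact : σ (run (probe i) x) * σ (x i) ≡ 1ℤ
      exact = trans (cong (λ b → σ b * σ (x i)) (run-probe i x)) (σ²≡1 (x i))
    ... | false with x i
    ...   | true  = ≤-refl
    ...   | false = ≤-refl
    gap : 2 ℕ.* θ ℕ.+ 2 ℕ.* r ℕ.≤ sumℕ κ
    gap = ℕₚ.≤-reflexive (trans (e θ r) (sym (sum-prefix n k 2 k≤n)))
      where
      e : ∀ θ r → 2 ℕ.* θ ℕ.+ 2 ℕ.* r ≡ (θ ℕ.+ r) ℕ.* 2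
      e = ℕR.solve-∀
    wide′ : 9 ℕ.* (n ℕ.* 4) ℕ.≤ 4 ℕ.* (2 ℕ.* r ℕ.* (2 ℕ.* r))
    wide′ = subst₂ ℕ._≤_ (e₁ n) (e₂ r) (ℕₚ.*-monoˡ-≤ 4 wide)
      where
      e₁ : ∀ n → 9 ℕ.* n ℕ.* 4 ≡ 9 ℕ.* (n ℕ.* 4)
      e₁ = ℕR.solve-∀
      e₂ : ∀ r → 4 ℕ.* (r ℕ.* r) ℕ.* 4 ≡ 4 ℕ.* (2 ℕ.* r ℕ.* (2 ℕ.* r))
      e₂ = ℕR.solve-∀

  decide-sound : ∀ u s {c} → decide u s ≡ just c → + u ≤ s * σ c
  decide-sound u s eq with + u ≤? s | s ≤? - + u
  decide-sound u s refl | yes u≤s | _        = subst (+ u ≤_) (sym (*-identityʳ s)) u≤s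
  decide-sound u s refl | no _    | yes s≤-u = subst₂ _≤_ (neg-involutive (+ u)) (trans (sym (-1*i≡-i s)) (*-comm -1ℤ s)) (neg-mono-≤ s≤-u)

  -- Each sampled bit has correlation at least `u / m` with the value of its block. `G` is the
  -- margin of the mean over the threshold, scaled by `m`, and the last hypothesis makes Chebyshev's
  -- failure probability at most 1/3.
  composition-upper : ∀ n m u θ G → 1 ℕ.≤ n → 1 ℕ.≤ m → m ℕ.≤ n → m ℕ.* θ ℕ.+ G ℕ.≤ n ℕ.* u →
    3 ℕ.* (n ℕ.* (m ℕ.* m)) ℕ.≤ G ℕ.* G →
    R≤ 1/3 (compose (agreementRel n θ) (gapMajority n m u)) n
  composition-upper n m u θ G 1≤n 1≤m m≤n gap wide = uniform-R≤ 1/3 2 2 n h P.trees refl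
    (subst (1 ℕ.≤_) (sym P.trees-length) (tuples-nonempty n L (λ i → subst (1 ℕ.≤_) (sym (len i)) 1≤m)))
    (λ x → subst₂ (λ a b → 2 ℕ.* a ℕ.≤ 3 ℕ.* b) (sym P.trees-length) (sym (P.trees-count h x)) (many x))
    (All.map (λ c x → ℕₚ.≤-trans (c x) (ℕₚ.≤-reflexive (trans (sumℕ-const n 1) (ℕₚ.*-identityʳ n)))) (P.trees-cost (λ _ → 1) cheap))
    where
    f = agreementRel n θ
    g = gapMajority n m u
    h = compose f g
    L : Fin n → List (DT (Fin n × Fin n) Bool)
    L i = map (λ j → probe (i , j)) (initial n m)
    len : ∀ i → length (L i) ≡ m
    len i = trans (length-map (λ j → probe (i , j)) (initial n m)) (length-initial m≤n)
    module P = ProductAlgorithm L m len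
    cheap : ∀ i → All (λ t → ∀ x → cost t x ℕ.≤ 1) (L i)
    cheap i = Allₚ.map⁺ (All.universal (λ j x → ℕₚ.≤-reflexive (cost-probe (i , j) x)) (initial n m))
    many : ∀ x → 2 ℕ.* length P.choices ℕ.≤ 3 ℕ.* count (λ ts → h x (P.output ts x)) P.choices
    many x = go (allJust n (λ i → g (λ j → x (i , j)))) refl
      where
      go : ∀ w → allJust n (λ i → g (λ j → x (i , j))) ≡ w →
        2 ℕ.* length P.choices ℕ.≤ 3 ℕ.* count (λ ts → h x (P.output ts x)) P.choices
      -- Some block breaks the promise, so the composed relation accepts every output.
      go nothing eq = subst (2 ℕ.* length P.choices ℕ.≤_) (cong (3 ℕ.*_)
            (sym (trans (count-cong P.choices (λ ts → compose-nothing f g x (P.output ts x) eq)) (count-true P.choices))))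
            (ℕₚ.*-monoˡ-≤ (length P.choices) (ℕₚ.n≤1+n 2))
      go (just y) eq = subst (2 ℕ.* length P.choices ℕ.≤_) (cong (3 ℕ.*_)
            (sym (count-cong P.choices (λ ts → compose-just f g x (P.output ts x) eq))))
            (P.many-successes x y (λ _ → u) κ≤ θ G (subst (m ℕ.* θ ℕ.+ G ℕ.≤_) (sym (sumℕ-const n u)) gap) 2 1 1≤n 1≤m
              (subst (3 ℕ.* (n ℕ.* (m ℕ.* m)) ℕ.≤_) (sym (ℕₚ.*-identityˡ (G ℕ.* G))) wide))
        where
        κ≤ : ∀ i → + u ≤ ∑ (L i) (λ t → σ (run t x) * σ (y i))
        κ≤ i = subst (+ u ≤_) (sym (begin
          ∑ (L i) (λ t → σ (run t x) * σ (y i))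
            ≡⟨ ∑-map (λ j → probe (i , j)) (initial n m) (λ t → σ (run t x) * σ (y i)) ⟩
          ∑ (initial n m) (λ j → σ (run (probe (i , j)) x) * σ (y i))
            ≡⟨ ∑-cong (initial n m) (λ j → trans (cong (λ b → σ b * σ (y i)) (run-probe (i , j) x)) (*-comm (σ (x (i , j))) (σ (y i)))) ⟩
          ∑ (initial n m) (λ j → σ (y i) * σ (x (i , j)))
            ≡⟨ ∑-*ˡ (initial n m) (σ (y i)) (λ j → σ (x (i , j))) ⟩
          σ (y i) * ∑ (initial n m) (λ j → σ (x (i , j)))
            ≡⟨ *-comm (σ (y i)) (∑ (initial n m) (λ j → σ (x (i , j)))) ⟩
          ∑ (initial n m) (λ j → σ (x (i , j))) * σ (y i) ∎))
          (decide-sound u (∑ (initial n m) (λ j → σ (x (i , j)))) (allJust-inv n eq i))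
          where open ≡-Reasoning

  gapMajority-upper : ∀ n m u → R≤ 1/3 (asRel (gapMajority n m u)) n
  gapMajority-upper n m u = uniform-R≤ 1/3 2 2 n (asRel g) (tree ∷ []) refl (s≤s z≤n)
    (λ x → ℕₚ.≤-trans (ℕₚ.n≤1+n 2) (ℕₚ.≤-reflexive (cong (λ b → 3 ℕ.* ((if b then 1 else 0) ℕ.+ 0)) (sym (correct x)))))
    ((λ x → ℕₚ.≤-reflexive (begin
        cost tree x                                           ≡⟨ cost-sequence probes _ x ⟩
        sumℕ (λ i → cost (lookup probes i) x)                 ≡⟨ sum-cong-≗ (λ i → trans (cong (λ t → cost t x) (lookup∘tabulate probe i)) (cost-probe i x)) ⟩
        sumℕ {n} (λ _ → 1)                                    ≡⟨ trans (sumℕ-const n 1) (ℕₚ.*-identityʳ n) ⟩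
        n                                                     ∎)) ∷ [])
    where
    open ≡-Reasoning
    g = gapMajority n m u
    probes = tabulate {n = n} probe
    tree : DT (Fin n) Bool
    -- Off the promise `asRel` accepts both bits, so any default serves.
    tree = sequence probes (λ v → fromMaybe true (g (lookup v)))
    value : ∀ x → run tree x ≡ fromMaybe true (g x)
    value x = trans (run-sequence probes _ x) (cong (λ s → fromMaybe true (decide u s)) (∑-cong (initial n m) (λ j → cong σ
      (trans (lookup-map j (λ t → run t x) probes) (trans (cong (λ t → run t x) (lookup∘tabulate probe j)) (run-probe j x))))))
    reflexive : ∀ x → asRel g x (fromMaybe true (g x)) ≡ true
    reflexive x with g x
    ... | just true  = refl
    ... | just false = refl
    ... | nothing    = refl
    correct : ∀ x → asRel g x (run tree x) ≡ true
    correct x = trans (cong (asRel g x) (value x)) (reflexive x)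

-- The choice of parameters as functions of `n`.

module Constants where

  open import Data.Nat using (ℕ; zero; suc; _≤_; _<_; _*_; _+_; z≤n; s≤s; _/_; _≤?_; _≤ᵇ_; >-nonZero)
  open import Data.Nat.Properties
  open import Data.Nat.DivMod using (m/n*n≤m; m≡m%n+[m/n]*n; m%n<n)
  open import Data.Nat.Tactic.RingSolver
  open import Data.Fin using (Fin)
  open import Data.Bool using (Bool; T)
  open import Data.Empty using (⊥-elim)
  open import Data.Product using (Σ; _×_; _,_; proj₁; proj₂)
  open import Relation.Nullary using (yes; no)
  open import Relation.Binary.PropositionalEquality
  open Functions
  open LowerBounds
  open UpperBounds

  -- The integer part of the square root of `n / K`. When `n` grows by one the root grows by at most
  -- one, since the next square leaves room for at least one more step.
  scaled-sqrt : ∀ K → 1 ≤ K → ∀ n → Σ ℕ λ u → K * (u * u) ≤ n × n < K * (suc u * suc u)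
  scaled-sqrt K 1≤K zero = 0 , ≤-reflexive (*-zeroʳ K) , *-mono-≤ 1≤K (≤-refl {1})
  scaled-sqrt K 1≤K (suc n) with scaled-sqrt K 1≤K n
  ... | u , lo , hi with K * (suc u * suc u) ≤? suc n
  ...   | yes le = suc u , le , ≤-<-trans hi (*-monoʳ-< K {{>-nonZero 1≤K}} (*-mono-< (n<1+n (suc u)) (n<1+n (suc u))))
  ...   | no ≰   = u , m≤n⇒m≤1+n lo , ≰⇒> ≰

  scale : ℕ → ℕ
  scale n = proj₁ (scaled-sqrt 65536 (s≤s z≤n) n)

  -- `K` is a variable tied by an equation that callers close with `refl`; the ring solver thus sees
  -- only variables and never a large literal.
  square : ∀ k u K → k * k ≡ K → k * u * (k * u) ≡ K * (u * u)
  square k u _ refl = e k u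
    where
    e : ∀ k u → k * u * (k * u) ≡ k * k * (u * u)
    e = solve-∀

  merge : ∀ j k a K → j * k ≡ K → j * (k * a) ≡ K * a
  merge j k a _ refl = sym (*-assoc j k a)

  merge-+ : ∀ j k a K → j + k ≡ K → j * a + k * a ≡ K * a
  merge-+ j k a _ refl = sym (*-distribʳ-+ a j k)

  coefficient-≤ : ∀ j k a → {_ : T (j ≤ᵇ k)} → j * a ≤ k * a
  coefficient-≤ j k a {le} = *-monoˡ-≤ a (≤ᵇ⇒≤ j k le)

  module Parameters (n : ℕ) (n₀≤n : 65536 ≤ n) where

    u = scale n
    a = u * u

    squareᵤ : ∀ k K → k * k ≡ K → k * u * (k * u) ≡ K * a
    squareᵤ k K eq = square k u K eq

    lo : 65536 * a ≤ n
    lo = proj₁ (proj₂ (scaled-sqrt 65536 (s≤s z≤n) n))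

    1≤n : 1 ≤ n
    1≤n = ≤-trans (s≤s z≤n) n₀≤n

    positive : ∀ v → n < 65536 * (suc v * suc v) → 1 ≤ v
    positive zero    hi = ⊥-elim (<⇒≱ hi n₀≤n)
    positive (suc v) hi = s≤s z≤n

    1≤u : 1 ≤ u
    1≤u = positive u (proj₂ (proj₂ (scaled-sqrt 65536 (s≤s z≤n) n)))

    -- Since `u ≥ 1`, rounding the root down costs at most a factor 2, hence a factor 4 in the
    -- square. With `lo` this makes `a` of exact order `n`.
    hi : n ≤ 262144 * a
    hi = begin
      n                            ≤⟨ <⇒≤ (proj₂ (proj₂ (scaled-sqrt 65536 (s≤s z≤n) n))) ⟩
      65536 * (suc u * suc u)      ≤⟨ *-monoʳ-≤ 65536 (*-mono-≤ double double) ⟩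
      65536 * (2 * u * (2 * u))    ≡⟨ cong (65536 *_) (squareᵤ 2 4 refl) ⟩
      65536 * (4 * a)              ≡⟨ merge 65536 4 a 262144 refl ⟩
      262144 * a                   ∎
      where
      open ≤-Reasoning
      double : suc u ≤ 2 * u
      double = ≤-trans (+-monoˡ-≤ u 1≤u) (≤-reflexive (cong (u +_) (sym (+-identityʳ u))))

    m≤n : 32 * a ≤ n
    m≤n = ≤-trans (coefficient-≤ 32 65536 a) lo

    -- The threshold must reach two standard deviations even for the largest `n` with this `u`. The
    -- fit is exact: `4 · 262144 = 1024²`.
    4n≤θ² : 4 * n ≤ 1024 * u * (1024 * u)
    4n≤θ² = ≤-trans (*-monoʳ-≤ 4 hi) (≤-reflexive (trans (merge 4 262144 a 1048576 refl) (sym (squareᵤ 1024 1048576 refl))))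

    f-lower : R≥ 4/9 (agreementRel n (1024 * u)) (256 * u) × n ≤ 4194304 * (256 * u * (256 * u))
    f-lower = agreementRel-lower n (1024 * u) (256 * u) 1≤n 4n≤θ² (≤-trans (≤-reflexive (squareᵤ 256 65536 refl)) lo) ,
      (begin
        n                                      ≤⟨ hi ⟩
        262144 * a                             ≡⟨ merge 4 65536 a 262144 refl ⟨
        4 * (65536 * a)                        ≤⟨ coefficient-≤ 4 4194304 (65536 * a) ⟩
        4194304 * (65536 * a)                  ≡⟨ cong (4194304 *_) (squareᵤ 256 65536 refl) ⟨
        4194304 * (256 * u * (256 * u))        ∎)
      where open ≤-Reasoning

    f-upper : R≤ 4/9 (agreementRel n (1024 * u)) (1024 * u + 1024 * u) × (1024 * u + 1024 * u) * (1024 * u + 1024 * u) ≤ 64 * n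
    f-upper = agreementRel-upper n (1024 * u) (1024 * u) 1≤n
        (begin
          1024 * u + 1024 * u      ≡⟨ double ⟩
          2048 * u                 ≤⟨ *-monoʳ-≤ 2048 (m≤m*n u u {{>-nonZero 1≤u}}) ⟩
          2048 * a                 ≤⟨ coefficient-≤ 2048 65536 a ⟩
          65536 * a                ≤⟨ lo ⟩
          n                        ∎)
        (begin
          9 * n                            ≤⟨ *-monoʳ-≤ 9 hi ⟩
          9 * (262144 * a)                 ≡⟨ merge 9 262144 a 2359296 refl ⟩
          2359296 * a                      ≤⟨ coefficient-≤ 2359296 4194304 a ⟩
          4194304 * a                      ≡⟨ merge 4 1048576 a 4194304 refl ⟨
          4 * (1048576 * a)                ≡⟨ cong (4 *_) (squareᵤ 1024 1048576 refl) ⟨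
          4 * (1024 * u * (1024 * u))      ∎) ,
        (begin
          (1024 * u + 1024 * u) * (1024 * u + 1024 * u) ≡⟨ cong₂ _*_ double double ⟩
          2048 * u * (2048 * u)            ≡⟨ squareᵤ 2048 4194304 refl ⟩
          4194304 * a                      ≡⟨ merge 64 65536 a 4194304 refl ⟨
          64 * (65536 * a)                 ≤⟨ *-monoʳ-≤ 64 lo ⟩
          64 * n                           ∎)
      where
      open ≤-Reasoning
      double : 1024 * u + 1024 * u ≡ 2048 * u
      double = merge-+ 1024 1024 u 2048 refl

    -- The tree bound applies as long as `16 k ≤ u²`, that is up to `a / 16` queries; the successor
    -- is the first cost not excluded.
    g-lower : R≥ 1/3 (asRel (gapMajority n (32 * a) u)) (suc (a / 16)) × n ≤ 4194304 * suc (a / 16)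
    g-lower = gapMajority-lower n u (suc (a / 16)) 1≤u m≤n (λ { k (s≤s k≤) →
        ≤-trans (*-monoʳ-≤ 16 k≤) (≤-trans (≤-reflexive (*-comm 16 (a / 16))) (m/n*n≤m a 16)) }) ,
      (begin
        n                              ≤⟨ hi ⟩
        262144 * a                     ≤⟨ *-monoʳ-≤ 262144 below ⟩
        262144 * (suc (a / 16) * 16)   ≡⟨ cong (262144 *_) (*-comm (suc (a / 16)) 16) ⟩
        262144 * (16 * suc (a / 16))   ≡⟨ merge 262144 16 (suc (a / 16)) 4194304 refl ⟩
        4194304 * suc (a / 16)         ∎)
      where
      open ≤-Reasoning
      below : a ≤ suc (a / 16) * 16
      below = ≤-trans (≤-reflexive (m≡m%n+[m/n]*n a 16)) (+-monoˡ-≤ (a / 16 * 16) (<⇒≤ (m%n<n a 16)))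

    g-upper : R≤ 1/3 (asRel (gapMajority n (32 * a) u)) n × n ≤ 64 * n
    g-upper = gapMajority-upper n (32 * a) u , m≤n*m n 64

    fg : Rel (Fin n × Fin n) (Fin n → Bool)
    fg = compose (agreementRel n (1024 * u)) (gapMajority n (32 * a) u)

    -- Here `q² = 65536 a²`, so the condition `q² ≤ n a` is precisely `lo` multiplied by `a`.
    fg-lower : R≥ 1/3 fg (256 * a) × n ≤ 4194304 * (256 * a)
    fg-lower = composition-lower n (1024 * u) u (256 * a) 1≤n 1≤u m≤n 4n≤θ²
        (begin
          256 * a * (256 * a)      ≡⟨ square 256 a 65536 refl ⟩
          65536 * (a * a)          ≡⟨ *-assoc 65536 a a ⟨
          65536 * a * a            ≤⟨ *-monoˡ-≤ a lo ⟩
          n * a                    ∎) ,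
        (begin
          n                        ≤⟨ hi ⟩
          262144 * a               ≡⟨ merge 1024 256 a 262144 refl ⟨
          1024 * (256 * a)         ≤⟨ coefficient-≤ 1024 4194304 (256 * a) ⟩
          4194304 * (256 * a)      ∎)
      where open ≤-Reasoning

    -- After scaling by `m = 32a`, the mean is at least `65536 a u`. The threshold consumes half of
    -- it, `32 · 1024 a u`, and the other half is the margin for Chebyshev. The latter needs
    -- `3 · 262144 · 1024 ≤ 32768²`, by `a³ = (a u)²`.
    fg-upper : R≤ 1/3 fg n × n ≤ 64 * n
    fg-upper = composition-upper n (32 * a) u (1024 * u) (32768 * (a * u)) 1≤n
        (*-mono-≤ (s≤s {0} {31} z≤n) (*-mono-≤ 1≤u 1≤u)) m≤n
        (begin
          32 * a * (1024 * u) + 32768 * (a * u)   ≡⟨ cong (_+ 32768 * (a * u)) (product 32 1024 a u 32768 refl) ⟩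
          32768 * (a * u) + 32768 * (a * u)       ≡⟨ merge-+ 32768 32768 (a * u) 65536 refl ⟩
          65536 * (a * u)                         ≡⟨ *-assoc 65536 a u ⟨
          65536 * a * u                           ≤⟨ *-monoˡ-≤ u lo ⟩
          n * u                                   ∎)
        (begin
          3 * (n * (32 * a * (32 * a)))           ≡⟨ cong (λ z → 3 * (n * z)) (square 32 a 1024 refl) ⟩
          3 * (n * (1024 * (a * a)))              ≤⟨ *-monoʳ-≤ 3 (*-monoˡ-≤ (1024 * (a * a)) hi) ⟩
          3 * (262144 * a * (1024 * (a * a)))     ≡⟨ cong (3 *_) (product 262144 1024 a (a * a) 268435456 refl) ⟩
          3 * (268435456 * (a * (a * a)))         ≡⟨ merge 3 268435456 (a * (a * a)) 805306368 refl ⟩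
          805306368 * (a * (a * a))               ≤⟨ coefficient-≤ 805306368 1073741824 (a * (a * a)) ⟩
          1073741824 * (a * (a * a))              ≡⟨ cong (1073741824 *_) cube ⟩
          1073741824 * (a * u * (a * u))          ≡⟨ square 32768 (a * u) 1073741824 refl ⟨
          32768 * (a * u) * (32768 * (a * u))     ∎) ,
        m≤n*m n 64
      where
      open ≤-Reasoning
      product : ∀ j k x y K → j * k ≡ K → j * x * (k * y) ≡ K * (x * y)
      product j k x y _ refl = e j k x y
        where
        e : ∀ j k x y → j * x * (k * y) ≡ j * k * (x * y)
        e = solve-∀
      cube : a * (a * a) ≡ a * u * (a * u)
      cube = e u
        where
        e : ∀ u → u * u * (u * u * (u * u)) ≡ u * u * u * (u * u * u)
        e = solve-∀

open import Data.Nat using (ℕ; suc; _≤_; _+_; _*_; _/_)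
open import Data.Fin using (Fin)
open import Data.Bool using (Bool)
open import Data.Product using (Σ; _×_; _,_)
open Functions using (agreementRel; gapMajority)
open Constants using (scale; module Parameters)

theorem5 : Σ ((n : ℕ) → Rel (Fin n) (Fin n → Bool)) λ f₀ →
    Σ ((n : ℕ) → PartialFn n) λ g₀ →
    Σ ℕ λ c → Σ ℕ λ C → Σ ℕ λ n₀ →
    ∀ n → n₀ ≤ n →
    ((Σ ℕ λ k → R≥ 4/9 (f₀ n) k × n ≤ c * (k * k)) ×
    (Σ ℕ λ k → R≤ 4/9 (f₀ n) k × k * k ≤ C * n)) ×
    ((Σ ℕ λ k → R≥ 1/3 (asRel (g₀ n)) k × n ≤ c * k) ×
    (Σ ℕ λ k → R≤ 1/3 (asRel (g₀ n)) k × k ≤ C * n)) ×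
    ((Σ ℕ λ k → R≥ 1/3 (compose (f₀ n) (g₀ n)) k × n ≤ c * k) ×
    (Σ ℕ λ k → R≤ 1/3 (compose (f₀ n) (g₀ n)) k × k ≤ C * n))
theorem5 =
  (λ n → agreementRel n (1024 * scale n)) , (λ n → gapMajority n (32 * (scale n * scale n)) (scale n)) ,
  -- The lower constant is `16 · 262144`, forced by the bound for `g₀`. The upper constant is
  -- `2048² / 65536`, forced by the bound for `f₀`. From `65536` on, `u` is at least 1.
  4194304 , 64 , 65536 , λ n n₀≤n → let open Parameters n n₀≤n in
    ((256 * u , f-lower) , (1024 * u + 1024 * u , f-upper)) ,
    ((suc (a / 16) , g-lower) , (n , g-upper)) ,
    ((256 * a , fg-lower) , (n , fg-upper))
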